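{- For all $n \geq 0$, $$p_{\xi}(45n+33) \equiv 0 \pmod{5}\qquad\text{and}\qquad p_{\xi}(45n+42) \equiv 0 \pmod{5}.$$
   Context: $(a;q)_n=(1-a)(1-aq)\cdots(1-aq^{n-1})$, $(a;q)_0=1$. The coefficients $p_\xi(n)$ are defined by $\sum_{n\ge0}p_\xi(n)q^n=\xi(q)=1+2\sum_{n\ge1}\frac{q^{6n^2-6n+1}}{(q;q^6)_n(q^5;q^6)_n}$. -}

module Defs where

open import Data.Nat using (ℕ; zero; suc; _+_; _*_; _∸_; _≤?_)
open import Data.Nat.Divisibility using (_∣?_)
open import Relation.Nullary.Decidable using (does)
open import Data.Bool using (if_then_else_)

Series : Set
Series = ℕ → ℕ

sumTo : ℕ → (ℕ → ℕ) → ℕ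
sumTo zero    f = f zero
sumTo (suc N) f = sumTo N f + f (suc N)

_⊛_ : Series → Series → Series
(f ⊛ g) N = sumTo N (λ i → f i * g (N ∸ i))

one : Series
one zero    = 1
one (suc _) = 0

-- 1/(1 - q^(suc k)) = sum_{m ≥ 0} q^{(suc k) m}
geomInv : ℕ → Series
geomInv k m = if does (suc k ∣? m) then 1 else 0

-- 1 / ((q;q^6)_n (q^5;q^6)_n)
--   = prod_{j<n} 1/(1 - q^{6j+1}) * 1/(1 - q^{6j+5})
invPoch : ℕ → Series
invPoch zero    = one
invPoch (suc j) = (invPoch j ⊛ geomInv (6 * j)) ⊛ geomInv (6 * j + 4)

shift : ℕ → Series → Series
shift d f m = if does (d ≤? m) then f (m ∸ d) else 0

term : ℕ → Series
term n = shift (6 * n * n ∸ 6 * n + 1) (invPoch n)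

-- p_ξ(N): coefficient of q^N in
--   ξ(q) = 1 + 2 sum_{n≥1} q^{6n^2-6n+1} / ((q;q^6)_n (q^5;q^6)_n).
-- Summands with n > N have lowest exponent 6n^2-6n+1 ≥ n > N and so
-- contribute nothing to q^N; hence the sum over 1 ≤ n ≤ N is exact.
pξ : ℕ → ℕ
pξ N = one N + 2 * sumTo N (λ n → if does (1 ≤? n) then term n N else 0)

-- Write E(y) = (y;y)_∞, φ(y) = Σ (-1)^k y^(k²) over k ∈ ℤ, B(y) = Σ (-1)^k y^(3k²-2k).
-- Expanding 1/((q;q⁶)_n (q⁵;q⁶)_n) in partial fractions and summing over n by Durfee's
-- identity turns ξ into an Appell–Lerch sum divided by E(q⁶). Its exponents divisible by 3
-- form, in x = q³, the sum F with
--   E(x²) F = Σ (-1)^n x^(3n²+n) (1 + x^(6n+1)) / (1 - x^(6n+1)),   n ∈ ℤ.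
-- Two rearrangements of double series, through the Lambert series Σ x^(2n) / (1 - x^(6n+1)),
-- convert this into F φ(x) = φ(x³)².
-- For ω a primitive cube root of unity, the dissection φ(x) = φ(x⁹) - 2x B(x³) gives
--   1/φ(x) = φ(ωx) φ(ω²x) / N   with   N = φ(x) φ(ωx) φ(ω²x) a series in x³,
-- and E(x) E(ωx) E(ω²x) = E(x³)⁴ / E(x⁹) evaluates N. So the exponents of F that are 6 mod 9 in q
-- form H with H E(x³)² = 4x² E(x¹⁸)³. In characteristic 5 this reads
--   H E(q⁴⁵) = 4 q⁶ E(q⁹)³ E(q⁵⁴)³,
-- and by Jacobi's series Σ (-1)^k (2k+1) y^(k(k+1)/2) for E(y)³ the right-hand side has only
-- exponents 0, 1, 4 mod 5. All identities are proved over ℤ[ω]/5, where they hold exactly.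
module Submission where

open import Algebra.Bundles using (CommutativeRing; RawRing)
import Algebra.Properties.CommutativeSemiring.Exp as Exp
import Algebra.Properties.Monoid.Mult.TCOptimised as Mult
import Algebra.Properties.Ring as RingProperties
import Algebra.Properties.Semiring.Mult.TCOptimised as SemiringMult
import Algebra.Solver.Ring as Solver
open import Algebra.Solver.Ring.AlmostCommutativeRing using (_-Raw-AlmostCommutative⟶_; fromCommutativeRing)
open import Algebra.Structures using (IsCommutativeRing)
open import Data.Bool.Base using (if_then_else_)
open import Data.Empty using (⊥-elim)
open import Data.Integer.Base as ℤ using (ℤ; -[1+_]; _⊖_; ∣_∣) renaming (+_ to pos)
import Data.Integer.Properties as ℤ
open import Data.Integer.Tactic.RingSolver using () renaming (solve-∀ to ℤ-solve-∀)
open import Data.Maybe.Base using (Maybe; just; nothing)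
open import Data.Nat.Base as ℕ using (ℕ; zero; suc; _∸_; z≤n; s≤s)
open import Data.Nat.DivMod using (_%_; [m+kn]%n≡m%n; m*n≤o⇒[o∸m*n]%n≡o%n; %-distribˡ-*; %-distribˡ-+; m*n%n≡0)
open import Data.Nat.Divisibility using (_∣_; _∣?_; divides; _∣0; ∣-refl; ∣⇒≤; ∣m∣n⇒∣m+n; ∣m+n∣m⇒∣n)
import Data.Nat.Properties as ℕ
open import Data.Nat.Tactic.RingSolver using (solve-∀)
open import Data.Product.Base using (_×_; _,_; proj₁; proj₂)
open import Data.Sum.Base using (_⊎_; inj₁; inj₂)
open import Function.Base using (_∘_)
open import Level using (0ℓ)
open import Relation.Binary.PropositionalEquality as ≡ using (_≡_; _≢_)
open import Relation.Nullary using (¬_; yes; no; does)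
open import Relation.Nullary.Decidable using (dec-true; dec-false)

-- The series have nonnegative exponents and coefficients in a commutative ring, so terms such as
-- y^(-k) / (1 - y) with y = x^(6n+1) and n < 0 must be written without negative powers. Hence the
-- completed squares in the exponents, the offsets in the recurrences and, for every bilateral sum,
-- a bound of the index by the exponent. Quotient identities are stated multiplied out, and only
-- factors with constant term 1 are cancelled. The Lambert series is never evaluated: both
-- rearrangements end in the same product with it, which is eliminated. What remains is an Appell
-- sum equal to a quotient of infinite products; it comes from the same partial fractions that
-- expand the terms of ξ. In the class 6 mod 9 the numerator over N is 4x²(ab)² with a = φ(x³) and b
-- = B(x³), and its quotient by N reduces to 4x² E(x^18)³ / E(x³)². One more cube of E(x³) completes
-- a fifth power in the denominator, and mod 5 this is a series in q^5 that cannot mix residues. The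
-- residues 2 and 3 mod 5 are missed; together with 6 mod 9 they are 42 and 33 mod 45.

module IntegerSolver (S : CommutativeRing 0ℓ 0ℓ) where
  open CommutativeRing S
  open RingProperties ring
  open Mult +-monoid using (1+×; ×-homo-+) renaming (_×_ to _·_)
  open SemiringMult semiring using (×1-homo-*)
  open import Relation.Binary.Reasoning.Setoid setoid

  -- The solver needs coefficients with decidable equality, which `S` need not have; integers supply
  -- them. With optimised multiples the images of 0 and 1 reduce to `0#` and `1#`.
  ⟦_⟧ℤ : ℤ → Carrier
  ⟦ pos n ⟧ℤ = n · 1#
  ⟦ -[1+ n ] ⟧ℤ = - (suc n · 1#)

  private
    ⊖-homo : ∀ m n → ⟦ m ⊖ n ⟧ℤ ≈ m · 1# - n · 1#
    ⊖-homo zero zero = sym (-‿inverseʳ 0#)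
    ⊖-homo zero (suc n) = sym (+-identityˡ _)
    ⊖-homo (suc m) zero = sym (trans (+-congˡ -0#≈0#) (+-identityʳ _))
    ⊖-homo (suc m) (suc n) = begin
      ⟦ suc m ⊖ suc n ⟧ℤ                ≡⟨ ≡.cong ⟦_⟧ℤ (ℤ.[1+m]⊖[1+n]≡m⊖n m n) ⟩
      ⟦ m ⊖ n ⟧ℤ                        ≈⟨ ⊖-homo m n ⟩
      m · 1# - n · 1#                   ≈⟨ +-congˡ (+-identityˡ _) ⟨
      m · 1# + (0# - n · 1#)            ≈⟨ +-congˡ (+-congʳ (-‿inverseʳ 1#)) ⟨
      m · 1# + ((1# - 1#) - n · 1#)     ≈⟨ +-congˡ (+-assoc _ _ _) ⟩
      m · 1# + (1# + (- 1# - n · 1#))   ≈⟨ +-assoc _ _ _ ⟨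
      (m · 1# + 1#) + (- 1# - n · 1#)   ≈⟨ +-cong (+-comm _ _) (-‿+-comm _ _) ⟩
      (1# + m · 1#) - (1# + n · 1#)     ≈⟨ +-cong (1+× m 1#) (-‿cong (1+× n 1#)) ⟨
      suc m · 1# - suc n · 1#           ∎

    +-homo : ∀ i j → ⟦ i ℤ.+ j ⟧ℤ ≈ ⟦ i ⟧ℤ + ⟦ j ⟧ℤ
    +-homo (pos m) (pos n) = ×-homo-+ 1# m n
    +-homo (pos m) -[1+ n ] = ⊖-homo m (suc n)
    +-homo -[1+ m ] (pos n) = trans (⊖-homo n (suc m)) (+-comm _ _)
    +-homo -[1+ m ] -[1+ n ] = begin
      - (suc (suc (m ℕ.+ n)) · 1#)        ≡⟨ ≡.cong (λ k → - (k · 1#)) (≡.cong suc (ℕ.+-suc m n)) ⟨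
      - ((suc m ℕ.+ suc n) · 1#)          ≈⟨ -‿cong (×-homo-+ 1# (suc m) (suc n)) ⟩
      - (suc m · 1# + suc n · 1#)         ≈⟨ -‿+-comm _ _ ⟨
      - (suc m · 1#) + - (suc n · 1#)     ∎

    -homo : ∀ i → ⟦ ℤ.- i ⟧ℤ ≈ - ⟦ i ⟧ℤ
    -homo (pos zero) = sym -0#≈0#
    -homo (pos (suc n)) = refl
    -homo -[1+ n ] = sym (-‿involutive _)

    *-homo⁺ : ∀ m j → ⟦ pos m ℤ.* j ⟧ℤ ≈ m · 1# * ⟦ j ⟧ℤ
    *-homo⁺ m (pos n) =
      trans (reflexive (≡.cong ⟦_⟧ℤ (≡.sym (ℤ.pos-* m n)))) (×1-homo-* m n)
    *-homo⁺ m -[1+ n ] = begin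
      ⟦ pos m ℤ.* -[1+ n ] ⟧ℤ             ≡⟨ ≡.cong ⟦_⟧ℤ (ℤ.neg-distribʳ-* (pos m) (pos (suc n))) ⟨
      ⟦ ℤ.- (pos m ℤ.* pos (suc n)) ⟧ℤ    ≈⟨ -homo (pos m ℤ.* pos (suc n)) ⟩
      - ⟦ pos m ℤ.* pos (suc n) ⟧ℤ        ≈⟨ -‿cong (*-homo⁺ m (pos (suc n))) ⟩
      - (m · 1# * suc n · 1#)             ≈⟨ -‿distribʳ-* _ _ ⟩
      m · 1# * - (suc n · 1#)             ∎

    *-homo : ∀ i j → ⟦ i ℤ.* j ⟧ℤ ≈ ⟦ i ⟧ℤ * ⟦ j ⟧ℤ
    *-homo (pos m) j = *-homo⁺ m j
    *-homo -[1+ m ] j = begin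
      ⟦ -[1+ m ] ℤ.* j ⟧ℤ                 ≡⟨ ≡.cong ⟦_⟧ℤ (ℤ.neg-distribˡ-* (pos (suc m)) j) ⟨
      ⟦ ℤ.- (pos (suc m) ℤ.* j) ⟧ℤ        ≈⟨ -homo (pos (suc m) ℤ.* j) ⟩
      - ⟦ pos (suc m) ℤ.* j ⟧ℤ            ≈⟨ -‿cong (*-homo⁺ (suc m) j) ⟩
      - (suc m · 1# * ⟦ j ⟧ℤ)             ≈⟨ -‿distribˡ-* _ _ ⟩
      - (suc m · 1#) * ⟦ j ⟧ℤ             ∎

    ℤ-rawRing : RawRing 0ℓ 0ℓ
    ℤ-rawRing = record
      { Carrier = ℤ ; _≈_ = _≡_ ; _+_ = ℤ._+_ ; _*_ = ℤ._*_ ; -_ = ℤ.-_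
      ; 0# = ℤ.0ℤ ; 1# = ℤ.1ℤ }

    morphism : ℤ-rawRing -Raw-AlmostCommutative⟶ fromCommutativeRing S
    morphism = record
      { ⟦_⟧ = ⟦_⟧ℤ ; +-homo = +-homo ; *-homo = *-homo ; -‿homo = -homo
      ; 0-homo = refl ; 1-homo = refl }

    ≟-weakly : ∀ i j → Maybe (⟦ i ⟧ℤ ≈ ⟦ j ⟧ℤ)
    ≟-weakly i j with i ℤ.≟ j
    ... | yes i≡j = just (reflexive (≡.cong ⟦_⟧ℤ i≡j))
    ... | no _ = nothing

  open Solver ℤ-rawRing (fromCommutativeRing S) morphism ≟-weakly
    public using (solve; _:+_; _:*_; _:-_; :-_; _:=_; con)

-- This is n(n-1)/2, the exponent in the triple product; the triangular number k(k+1)/2 is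
-- `tri k + k`.
tri : ℕ → ℕ
tri zero = zero
tri (suc n) = tri n ℕ.+ n

-- Finite sums and products

module FiniteSums (S : CommutativeRing 0ℓ 0ℓ) where
  open CommutativeRing S
  open IntegerSolver S
  open import Relation.Binary.Reasoning.Setoid setoid

  sgn : ℕ → Carrier
  sgn zero = 1#
  sgn (suc n) = - sgn n

  ∑ : ℕ → (ℕ → Carrier) → Carrier
  ∑ zero f = 0#
  ∑ (suc n) f = ∑ n f + f n

  ∏ : ℕ → (ℕ → Carrier) → Carrier
  ∏ zero f = 1#
  ∏ (suc n) f = ∏ n f * f n

  ∑-cong : ∀ n {f g} → (∀ i → i ℕ.< n → f i ≈ g i) → ∑ n f ≈ ∑ n g
  ∑-cong zero f≈g = refl
  ∑-cong (suc n) f≈g =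
    +-cong (∑-cong n λ i i<n → f≈g i (ℕ.m<n⇒m<1+n i<n)) (f≈g n ℕ.≤-refl)

  ∑-0 : ∀ n {f} → (∀ i → i ℕ.< n → f i ≈ 0#) → ∑ n f ≈ 0#
  ∑-0 zero f≈0 = refl
  ∑-0 (suc n) f≈0 = trans
    (+-cong (∑-0 n λ i i<n → f≈0 i (ℕ.m<n⇒m<1+n i<n)) (f≈0 n ℕ.≤-refl)) (+-identityˡ 0#)

  ∑-+ : ∀ n f g → ∑ n (λ i → f i + g i) ≈ ∑ n f + ∑ n g
  ∑-+ zero f g = sym (+-identityˡ 0#)
  ∑-+ (suc n) f g = trans (+-congʳ (∑-+ n f g))
    (solve 4 (λ a b c d → (a :+ b) :+ (c :+ d) := (a :+ c) :+ (b :+ d)) refl _ _ _ _)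

  *-∑ : ∀ n c f → c * ∑ n f ≈ ∑ n (λ i → c * f i)
  *-∑ zero c f = zeroʳ c
  *-∑ (suc n) c f = trans (distribˡ c _ _) (+-congʳ (*-∑ n c f))

  ∑-head : ∀ n f → ∑ (suc n) f ≈ f 0 + ∑ n (λ i → f (suc i))
  ∑-head zero f = +-comm _ _
  ∑-head (suc n) f = trans (+-congʳ (∑-head n f)) (+-assoc _ _ _)

  ∑-swap : ∀ m n (f : ℕ → ℕ → Carrier) →
    ∑ m (λ i → ∑ n (f i)) ≈ ∑ n (λ j → ∑ m (λ i → f i j))
  ∑-swap zero n f = sym (∑-0 n λ _ _ → refl)
  ∑-swap (suc m) n f = trans (+-congʳ (∑-swap m n f)) (sym (∑-+ n _ _))

  ∏-cong : ∀ n {f g} → (∀ i → f i ≈ g i) → ∏ n f ≈ ∏ n g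
  ∏-cong zero f≈g = refl
  ∏-cong (suc n) f≈g = *-cong (∏-cong n f≈g) (f≈g n)

  ∏-* : ∀ n f g → ∏ n (λ i → f i * g i) ≈ ∏ n f * ∏ n g
  ∏-* zero f g = sym (*-identityˡ 1#)
  ∏-* (suc n) f g = trans (*-congʳ (∏-* n f g))
    (solve 4 (λ a b c d → (a :* b) :* (c :* d) := (a :* c) :* (b :* d)) refl _ _ _ _)

  ∏-head : ∀ n f → ∏ (suc n) f ≈ f 0 * ∏ n (λ i → f (suc i))
  ∏-head zero f = *-comm _ _
  ∏-head (suc n) f = trans (*-congʳ (∏-head n f)) (*-assoc _ _ _)

-- Finite forms of Jacobi's identities and of the partial fraction expansion

module FiniteIdentities (S : CommutativeRing 0ℓ 0ℓ) (Q : CommutativeRing.Carrier S)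
  (q⁻¹ : ℕ → CommutativeRing.Carrier S) where

  open CommutativeRing S
  open Exp commutativeSemiring using (_^_; ^-homo-*)
  open IntegerSolver S
  open FiniteSums S
  open import Relation.Binary.Reasoning.Setoid setoid

  -- The inverse of (Q;Q)_n, when q⁻¹ k is the inverse of 1 - Q^(k+1).
  r : ℕ → Carrier
  r zero = 1#
  r (suc n) = r n * q⁻¹ n

  -- 1/(Q;Q)_{N-k}, which is 0 for k > N.
  r∸ : ℕ → ℕ → Carrier
  r∸ N zero = r N
  r∸ zero (suc k) = 0#
  r∸ (suc N) (suc k) = r∸ N k

  -- Times (Q;Q)_{2N+1} this is the Gaussian binomial coefficient of 2N+1 over N-k.
  w : ℕ → ℕ → Carrier
  w N k = r∸ N k * r (suc (N ℕ.+ k))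

  r∸-above : ∀ N k → r∸ N (suc (N ℕ.+ k)) ≈ 0#
  r∸-above zero k = refl
  r∸-above (suc N) k = r∸-above N k

  w-above : ∀ N k → w N (suc (N ℕ.+ k)) ≈ 0#
  w-above N k = trans (*-congʳ (r∸-above N k)) (zeroˡ _)

  g : ℕ → ℕ → Carrier
  g N k = sgn k * Q ^ tri k * w N k

  JacobiSum : (ℕ → Carrier) → ℕ → Carrier
  JacobiSum v N = ∑ (suc N) (λ k → g N k * v k)

  -- For κ = α + Qβ and αβ = Q this is (1 - αQ^i)(1 - βQ^(i+1)).
  jacobiFactor : Carrier → ℕ → Carrier
  jacobiFactor κ i = 1# + Q ^ i * Q ^ i * Q * Q - κ * Q ^ i

  module _ (q⁻¹-inverse : ∀ k → q⁻¹ k * (1# - Q ^ suc k) ≈ 1#) where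

    r-step : ∀ n → r n ≈ (1# - Q ^ suc n) * r (suc n)
    r-step n = begin
      r n                                  ≈⟨ *-identityʳ _ ⟨
      r n * 1#                             ≈⟨ *-congˡ (q⁻¹-inverse n) ⟨
      r n * (q⁻¹ n * (1# - Q ^ suc n))     ≈⟨ solve 3 (λ a b c → a :* (b :* c) := c :* (a :* b)) refl _ _ _ ⟩
      (1# - Q ^ suc n) * (r n * q⁻¹ n)     ∎

    r∸-step : ∀ N k → k ℕ.≤ suc N → r∸ N k ≈ (1# - Q ^ (suc N ∸ k)) * r∸ (suc N) k
    r∸-step N zero k≤N = r-step N
    r∸-step zero (suc .0) (s≤s z≤n) =
      sym (trans (*-congʳ (-‿inverseʳ 1#)) (zeroˡ _))
    r∸-step (suc N) (suc k) (s≤s k≤N) = r∸-step N k k≤N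

    -- Two steps of `r∸-step`. The factor Q turns 1 - Q^(N-k) into Q - Q^(N+1-k), whose exponent is
    -- never truncated; at k = N+1 both sides vanish.
    Q·r∸-suc : ∀ N k → k ℕ.≤ suc N →
      Q * r∸ N (suc k) ≈ (Q - Q ^ (suc N ∸ k)) * (1# - Q ^ (suc N ∸ k)) * r∸ (suc N) k
    Q·r∸-suc N k k≤N with k ℕ.≟ suc N
    ... | yes ≡.refl = begin
      Q * r∸ N (suc (suc N))     ≡⟨ ≡.cong (λ j → Q * r∸ N (suc j)) (≡.sym (ℕ.+-comm N 1)) ⟩
      Q * r∸ N (suc (N ℕ.+ 1))   ≈⟨ *-congˡ (r∸-above N 1) ⟩
      Q * 0#                     ≈⟨ zeroʳ Q ⟩
      0#                         ≈⟨ solve 2 (λ a b → con ℤ.0ℤ := a :* (con ℤ.1ℤ :- con ℤ.1ℤ) :* b) refl _ _ ⟩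
      (Q - Q ^ (N ∸ N)) * (1# - 1#) * r∸ N N
        ≡⟨ ≡.cong (λ j → (Q - Q ^ (N ∸ N)) * (1# - Q ^ j) * r∸ N N) (≡.sym (ℕ.n∸n≡0 N)) ⟩
      (Q - Q ^ (N ∸ N)) * (1# - Q ^ (N ∸ N)) * r∸ N N ∎
    ... | no k≢ = begin
      Q * r∸ (suc N) (suc (suc k))
        ≈⟨ *-congˡ (r∸-step (suc N) (suc (suc k)) (s≤s k<N)) ⟩
      Q * ((1# - Q ^ (N ∸ k)) * r∸ N k)
        ≈⟨ *-congˡ (*-congˡ (r∸-step N k k≤N)) ⟩
      Q * ((1# - Q ^ (N ∸ k)) * ((1# - Q ^ (suc N ∸ k)) * r∸ (suc N) k))
        ≈⟨ solve 4 (λ q a b c → q :* ((con ℤ.1ℤ :- a) :* (b :* c)) := (q :- q :* a) :* b :* c) refl Q _ _ _ ⟩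
      (Q - Q * Q ^ (N ∸ k)) * (1# - Q ^ (suc N ∸ k)) * r∸ (suc N) k
        ≡⟨ ≡.cong (λ j → (Q - Q ^ j) * (1# - Q ^ (suc N ∸ k)) * r∸ (suc N) k) (ℕ.+-∸-assoc 1 k≤N') ⟨
      (Q - Q ^ (suc N ∸ k)) * (1# - Q ^ (suc N ∸ k)) * r∸ (suc N) k ∎
      where
      k<N : suc k ℕ.≤ suc N
      k<N = ℕ.≤∧≢⇒< k≤N k≢
      k≤N' : k ℕ.≤ N
      k≤N' = ℕ.≤-pred k<N

    -- For αβ = Q the recurrence holds for v k = α^k - Q^k β^(k+1), which gives the triple
    -- product, and for v k = (2k+1) Q^k, which gives Jacobi's identity for the cube.
    module _ (v : ℕ → Carrier) (κ : Carrier) (κ·v₀ : κ * v 0 ≈ v 1 - Q * v 0)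
      (κ·v₊ : ∀ k → κ * v (suc k) ≈ v (suc (suc k)) + Q * Q * v k) where

      private
        -- The transpose of multiplication by κ: the recurrence for v is moved to the coefficients,
        -- and `d h k` collects what multiplies `v k`.
        d : (ℕ → Carrier) → ℕ → Carrier
        d h zero = Q * Q * h 1 - Q * h 0
        d h (suc k) = h k + Q * Q * h (suc (suc k))

        -- Summation by parts. The terms with Q * Q are what coefficients beyond the range of the
        -- sum would contribute; they vanish for `h = g N` and `n = N`.
        κ-shift : ∀ h n → κ * ∑ (suc n) (λ k → h k * v k)
          + Q * Q * (h (suc n) * v n + h (suc (suc n)) * v (suc n))
          ≈ ∑ (suc (suc n)) (λ k → d h k * v k)
        κ-shift h zero = begin
          κ * (0# + h 0 * v 0) + Q * Q * (h 1 * v 0 + h 2 * v 1)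
            ≈⟨ solve 7 (λ κ q h0 h1 h2 v0 v1 →
                 κ :* (con ℤ.0ℤ :+ h0 :* v0) :+ q :* q :* (h1 :* v0 :+ h2 :* v1)
                 := h0 :* (κ :* v0) :+ q :* q :* (h1 :* v0 :+ h2 :* v1)) refl κ Q _ _ _ _ _ ⟩
          h 0 * (κ * v 0) + Q * Q * (h 1 * v 0 + h 2 * v 1)
            ≈⟨ +-congʳ (*-congˡ κ·v₀) ⟩
          h 0 * (v 1 - Q * v 0) + Q * Q * (h 1 * v 0 + h 2 * v 1)
            ≈⟨ solve 6 (λ q h0 h1 h2 v0 v1 →
                 h0 :* (v1 :- q :* v0) :+ q :* q :* (h1 :* v0 :+ h2 :* v1)
                 := (con ℤ.0ℤ :+ (q :* q :* h1 :- q :* h0) :* v0) :+ (h0 :+ q :* q :* h2) :* v1)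
                 refl Q _ _ _ _ _ ⟩
          (0# + (Q * Q * h 1 - Q * h 0) * v 0) + (h 0 + Q * Q * h 2) * v 1 ∎
        κ-shift h (suc n) = begin
          κ * (∑ (suc n) (λ k → h k * v k) + h1 * v (suc n)) + Q * Q * (h2 * v (suc n) + h3 * v (suc (suc n)))
            ≈⟨ solve 8 (λ κ q s h1 h2 h3 v1 v2 →
                 κ :* (s :+ h1 :* v1) :+ q :* q :* (h2 :* v1 :+ h3 :* v2)
                 := κ :* s :+ h1 :* (κ :* v1) :+ q :* q :* (h2 :* v1 :+ h3 :* v2)) refl κ Q _ _ _ _ _ _ ⟩
          κ * ∑ (suc n) (λ k → h k * v k) + h1 * (κ * v (suc n)) + Q * Q * (h2 * v (suc n) + h3 * v (suc (suc n)))
            ≈⟨ +-congʳ (+-congˡ (*-congˡ (κ·v₊ n))) ⟩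
          κ * ∑ (suc n) (λ k → h k * v k) + h1 * (v (suc (suc n)) + Q * Q * v n) + Q * Q * (h2 * v (suc n) + h3 * v (suc (suc n)))
            ≈⟨ solve 8 (λ q s h1 h2 h3 v0 v1 v2 →
                 s :+ h1 :* (v2 :+ q :* q :* v0) :+ q :* q :* (h2 :* v1 :+ h3 :* v2)
                 := (s :+ q :* q :* (h1 :* v0 :+ h2 :* v1)) :+ (h1 :+ q :* q :* h3) :* v2) refl Q _ _ _ _ _ _ _ ⟩
          (κ * ∑ (suc n) (λ k → h k * v k) + Q * Q * (h1 * v n + h2 * v (suc n))) + (h1 + Q * Q * h3) * v (suc (suc n))
            ≈⟨ +-congʳ (κ-shift h n) ⟩
          ∑ (suc (suc (suc n))) (λ k → d h k * v k) ∎
          where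
          h1 = h (suc n)
          h2 = h (suc (suc n))
          h3 = h (suc (suc (suc n)))

        coefficient-zero : ∀ N → let P = Q ^ N in
          (1# + P * P * Q * Q) * g N 0 - P * d (g N) 0
          ≈ (1# - P * P * Q * Q) * (1# - P * P * Q * Q * Q) * g (suc N) 0
        coefficient-zero N = begin
          (1# + P * P * Q * Q) * (1# * 1# * (r N * r (suc (N ℕ.+ 0))))
            - P * (Q * Q * (- 1# * 1# * (r∸ N 1 * r (suc (N ℕ.+ 1)))) - Q * (1# * 1# * (r N * r (suc (N ℕ.+ 0)))))
            ≡⟨ ≡.cong₂ (λ a b → (1# + P * P * Q * Q) * (1# * 1# * (r N * a))
                 - P * (Q * Q * (- 1# * 1# * (r∸ N 1 * b)) - Q * (1# * 1# * (r N * a))))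
                 (≡.cong (λ j → r (suc j)) (ℕ.+-identityʳ N)) (≡.cong (λ j → r (suc j)) (ℕ.+-comm N 1)) ⟩
          (1# + P * P * Q * Q) * (1# * 1# * (r N * r (suc N)))
            - P * (Q * Q * (- 1# * 1# * (r∸ N 1 * ρ)) - Q * (1# * 1# * (r N * r (suc N))))
            ≈⟨ solve 6 (λ p q a b c ρ → (con ℤ.1ℤ :+ p :* p :* q :* q) :* (con ℤ.1ℤ :* con ℤ.1ℤ :* (a :* b))
                 :- p :* (q :* q :* ((:- con ℤ.1ℤ) :* con ℤ.1ℤ :* (c :* ρ)) :- q :* (con ℤ.1ℤ :* con ℤ.1ℤ :* (a :* b)))
                 := (con ℤ.1ℤ :+ p :* p :* q :* q :+ p :* q) :* a :* b :+ p :* q :* (q :* c) :* ρ) refl P Q _ _ _ _ ⟩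
          (1# + P * P * Q * Q + P * Q) * r N * r (suc N) + P * Q * (Q * r∸ N 1) * ρ
            ≈⟨ +-cong (*-cong (*-congˡ (r-step N)) (r-step (suc N))) (*-congʳ (*-congˡ (Q·r∸-suc N 0 z≤n))) ⟩
          (1# + P * P * Q * Q + P * Q) * ((1# - Q * P) * r (suc N)) * ((1# - Q * (Q * P)) * ρ)
            + P * Q * ((Q - Q * P) * (1# - Q * P) * r (suc N)) * ρ
            ≈⟨ solve 4 (λ p q a ρ →
                 (con ℤ.1ℤ :+ p :* p :* q :* q :+ p :* q) :* ((con ℤ.1ℤ :- q :* p) :* a) :* ((con ℤ.1ℤ :- q :* (q :* p)) :* ρ)
                 :+ p :* q :* ((q :- q :* p) :* (con ℤ.1ℤ :- q :* p) :* a) :* ρ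
                 := (con ℤ.1ℤ :- p :* p :* q :* q) :* (con ℤ.1ℤ :- p :* p :* q :* q :* q) :* (con ℤ.1ℤ :* con ℤ.1ℤ :* (a :* ρ))) refl P Q _ _ ⟩
          (1# - P * P * Q * Q) * (1# - P * P * Q * Q * Q) * (1# * 1# * (r (suc N) * ρ))
            ≡⟨ ≡.cong (λ j → (1# - P * P * Q * Q) * (1# - P * P * Q * Q * Q) * (1# * 1# * (r (suc N) * r (suc (suc j))))) (≡.sym (ℕ.+-identityʳ N)) ⟩
          (1# - P * P * Q * Q) * (1# - P * P * Q * Q * Q) * g (suc N) 0 ∎
          where
          P = Q ^ N
          ρ = r (suc (suc N))

        -- Every inverse product is reduced to `R` and `ρ`, the ones of highest index. Dividing them
        -- out leaves a polynomial identity in Q, q = Q^k and X = Q^(N-k), in which Q^N is X q.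
        coefficient-suc : ∀ N k → k ℕ.≤ N → let P = Q ^ N in
          (1# + P * P * Q * Q) * g N (suc k) - P * d (g N) (suc k)
          ≈ (1# - P * P * Q * Q) * (1# - P * P * Q * Q * Q) * g (suc N) (suc k)
        coefficient-suc N k k≤N = begin
          (1# + P * P * Q * Q) * g N (suc k) - P * d (g N) (suc k)
            ≈⟨ +-cong (*-cong (+-congˡ (*-congʳ (*-congʳ (*-cong P≈Xq P≈Xq)))) g1≈)
                 (-‿cong (*-cong P≈Xq (+-cong g0≈ (*-congˡ g2≈)))) ⟩
          (1# + X * q * (X * q) * Q * Q) * (- s * (t * q) * (r1 * r3))
            - X * q * (s * t * (R * r2) + Q * Q * (s * (t * q * (q * Q)) * (r∸ N (suc (suc k)) * ρ)))
            ≈⟨ solve 10 (λ Q q X s t r1 r3 R r2 u →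
                 (con ℤ.1ℤ :+ X :* q :* (X :* q) :* Q :* Q) :* ((:- s) :* (t :* q) :* (r1 :* r3))
                 :- X :* q :* (s :* t :* (R :* r2) :+ Q :* Q :* (s :* (t :* q :* (q :* Q)) :* u))
                 := :- (s :* t :* q :* ((con ℤ.1ℤ :+ X :* q :* (X :* q) :* Q :* Q) :* (r1 :* r3)
                   :+ X :* (R :* r2) :+ X :* q :* q :* Q :* Q :* (Q :* u)))) refl Q q X s t r1 r3 R r2 _ ⟩
          - (s * t * q * ((1# + X * q * (X * q) * Q * Q) * (r1 * r3)
              + X * (R * r2) + X * q * q * Q * Q * (Q * (r∸ N (suc (suc k)) * ρ))))
            ≈⟨ -‿cong (*-congˡ (+-cong (+-cong (*-congˡ (*-cong r1≈ r3≈)) (*-congˡ (*-congˡ r2≈)))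
                 (*-congˡ (trans (sym (*-assoc _ _ _)) (*-congʳ (Q·r∸-suc N (suc k) (s≤s k≤N))))))) ⟩
          - (s * t * q * ((1# + X * q * (X * q) * Q * Q) * ((1# - X) * R * ((1# - Q * Y) * ρ))
              + X * (R * ((1# - Y) * ((1# - Q * Y) * ρ)))
              + X * q * q * Q * Q * ((Q - X) * (1# - X) * R * ρ)))
            ≈⟨ solve 7 (λ Q q X s t R ρ → let Y = X :* q :* q :* Q :* Q in
                 :- (s :* t :* q :* ((con ℤ.1ℤ :+ X :* q :* (X :* q) :* Q :* Q) :* ((con ℤ.1ℤ :- X) :* R :* ((con ℤ.1ℤ :- Q :* Y) :* ρ))
                   :+ X :* (R :* ((con ℤ.1ℤ :- Y) :* ((con ℤ.1ℤ :- Q :* Y) :* ρ)))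
                   :+ X :* q :* q :* Q :* Q :* ((Q :- X) :* (con ℤ.1ℤ :- X) :* R :* ρ)))
                 := (con ℤ.1ℤ :- X :* q :* (X :* q) :* Q :* Q) :* (con ℤ.1ℤ :- X :* q :* (X :* q) :* Q :* Q :* Q) :* ((:- s) :* (t :* q) :* (R :* ρ)))
                 refl Q q X s t R ρ ⟩
          (1# - X * q * (X * q) * Q * Q) * (1# - X * q * (X * q) * Q * Q * Q) * (- s * (t * q) * (R * ρ))
            ≈⟨ *-cong (*-cong (+-congˡ (-‿cong (*-congʳ (*-congʳ PP)))) (+-congˡ (-‿cong (*-congʳ (*-congʳ (*-congʳ PP))))))
                 (*-congʳ (*-congˡ (sym (^-homo-* Q (tri k) k)))) ⟩
          (1# - P * P * Q * Q) * (1# - P * P * Q * Q * Q) * g (suc N) (suc k) ∎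
          where
          P = Q ^ N
          q = Q ^ k
          X = Q ^ (N ∸ k)
          Y = X * q * q * Q * Q
          s = sgn k
          t = Q ^ tri k
          ρ = r (suc (suc (N ℕ.+ suc k)))
          R = r∸ (suc N) (suc k)
          r1 = r∸ N (suc k)
          r2 = r (suc (N ℕ.+ k))
          r3 = r (suc (N ℕ.+ suc k))

          P≈Xq : P ≈ X * q
          P≈Xq = trans (reflexive (≡.cong (Q ^_) (≡.sym (ℕ.m∸n+n≡m k≤N)))) (^-homo-* Q (N ∸ k) k)

          PP : X * q * (X * q) ≈ P * P
          PP = sym (*-cong P≈Xq P≈Xq)

          Q^[N+k] : Q ^ (N ℕ.+ k) ≈ X * q * q
          Q^[N+k] = trans (^-homo-* Q N k) (*-congʳ P≈Xq)

          g1≈ : g N (suc k) ≈ - s * (t * q) * (r1 * r3)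
          g1≈ = *-congʳ (*-congˡ (^-homo-* Q (tri k) k))

          g0≈ : g N k ≈ s * t * (R * r2)
          g0≈ = refl

          g2≈ : g N (suc (suc k)) ≈ s * (t * q * (q * Q)) * (r∸ N (suc (suc k)) * ρ)
          g2≈ = *-cong (*-cong (solve 1 (λ a → :- (:- a) := a) refl s)
            (trans (^-homo-* Q (tri k ℕ.+ k) (suc k)) (*-cong (^-homo-* Q (tri k) k) (*-comm _ _))))
            (*-congˡ (reflexive (≡.cong (λ j → r (suc j)) (ℕ.+-suc N (suc k)))))

          r1≈ : r1 ≈ (1# - X) * R
          r1≈ = r∸-step N (suc k) (s≤s k≤N)

          r3≈ : r3 ≈ (1# - Q * Y) * ρ
          r3≈ = trans (r-step (suc (N ℕ.+ suc k))) (*-congʳ (+-congˡ (-‿cong (begin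
            Q * (Q * Q ^ (N ℕ.+ suc k))     ≡⟨ ≡.cong (λ j → Q * (Q * Q ^ j)) (ℕ.+-suc N k) ⟩
            Q * (Q * (Q * Q ^ (N ℕ.+ k)))   ≈⟨ *-congˡ (*-congˡ (*-congˡ Q^[N+k])) ⟩
            Q * (Q * (Q * (X * q * q)))     ≈⟨ solve 2 (λ a b → a :* (a :* (a :* b)) := a :* (b :* a :* a)) refl Q (X * q * q) ⟩
            Q * Y                           ∎))))

          r2≈ : r2 ≈ (1# - Y) * ((1# - Q * Y) * ρ)
          r2≈ = begin
            r (suc (N ℕ.+ k))                                ≈⟨ r-step (suc (N ℕ.+ k)) ⟩
            (1# - Q ^ suc (suc (N ℕ.+ k))) * r (suc (suc (N ℕ.+ k)))
              ≈⟨ *-cong (+-congˡ (-‿cong (trans (*-congˡ (*-congˡ Q^[N+k]))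
                   (solve 2 (λ a b → a :* (a :* b) := b :* a :* a) refl Q (X * q * q)))))
                   (reflexive (≡.cong (λ j → r (suc j)) (≡.sym (ℕ.+-suc N k)))) ⟩
            (1# - Y) * r3                                    ≈⟨ *-congˡ r3≈ ⟩
            (1# - Y) * ((1# - Q * Y) * ρ)                    ∎

        coefficient : ∀ N k → k ℕ.≤ suc N → let P = Q ^ N in
          (1# + P * P * Q * Q) * g N k - P * d (g N) k
          ≈ (1# - P * P * Q * Q) * (1# - P * P * Q * Q * Q) * g (suc N) k
        coefficient N zero _ = coefficient-zero N
        coefficient N (suc k) (s≤s k≤N) = coefficient-suc N k k≤N

      g-above : ∀ N k → g N (suc (N ℕ.+ k)) ≈ 0#
      g-above N k = trans (*-congˡ (w-above N k)) (zeroʳ _)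

      -- Multiplication by κ acts on the coefficients through `d`, so both sides can be compared
      -- term by term. The sum for N is first lengthened by a term that is zero.
      JacobiSum-step : ∀ N → let P = Q ^ N in
        jacobiFactor κ N * JacobiSum v N
        ≈ (1# - P * P * Q * Q) * (1# - P * P * Q * Q * Q) * JacobiSum v (suc N)
      JacobiSum-step N = begin
        jacobiFactor κ N * T
          ≈⟨ solve 4 (λ p q κ s → (con ℤ.1ℤ :+ p :* p :* q :* q :- κ :* p) :* s
               := (con ℤ.1ℤ :+ p :* p :* q :* q) :* s :- p :* (κ :* s)) refl P Q κ T ⟩
        (1# + P * P * Q * Q) * T - P * (κ * T)
          ≈⟨ +-cong (*-congˡ S-extend) (-‿cong (*-congˡ κS)) ⟩
        (1# + P * P * Q * Q) * ∑ (suc (suc N)) (λ k → g N k * v k)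
          - P * ∑ (suc (suc N)) (λ k → d (g N) k * v k)
          ≈⟨ +-cong (*-∑ (suc (suc N)) _ _) (trans (-‿cong (*-∑ (suc (suc N)) _ _))
               (trans (solve 1 (λ a → :- a := (:- con ℤ.1ℤ) :* a) refl _) (*-∑ (suc (suc N)) _ _))) ⟩
        ∑ (suc (suc N)) (λ k → (1# + P * P * Q * Q) * (g N k * v k))
          + ∑ (suc (suc N)) (λ k → - 1# * (P * (d (g N) k * v k)))
          ≈⟨ ∑-+ (suc (suc N)) _ _ ⟨
        ∑ (suc (suc N)) (λ k → (1# + P * P * Q * Q) * (g N k * v k) + - 1# * (P * (d (g N) k * v k)))
          ≈⟨ ∑-cong (suc (suc N)) (λ k k<N+2 → trans
               (solve 5 (λ a b c p v → a :* (b :* v) :+ (:- con ℤ.1ℤ) :* (p :* (c :* v)) := (a :* b :- p :* c) :* v) refl _ _ _ _ _)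
               (trans (*-congʳ (coefficient N k (ℕ.≤-pred k<N+2))) (*-assoc _ _ _))) ⟩
        ∑ (suc (suc N)) (λ k → (1# - P * P * Q * Q) * (1# - P * P * Q * Q * Q) * (g (suc N) k * v k))
          ≈⟨ *-∑ (suc (suc N)) _ _ ⟨
        (1# - P * P * Q * Q) * (1# - P * P * Q * Q * Q) * JacobiSum v (suc N) ∎
        where
        P = Q ^ N
        T = JacobiSum v N

        gN+1 : g N (suc N) ≈ 0#
        gN+1 = trans (reflexive (≡.cong (λ j → g N (suc j)) (≡.sym (ℕ.+-identityʳ N)))) (g-above N 0)

        gN+2 : g N (suc (suc N)) ≈ 0#
        gN+2 = trans (reflexive (≡.cong (λ j → g N (suc j)) (≡.sym (ℕ.+-comm N 1)))) (g-above N 1)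

        S-extend : T ≈ ∑ (suc (suc N)) (λ k → g N k * v k)
        S-extend = sym (trans (+-congˡ (trans (*-congʳ gN+1) (zeroˡ _))) (+-identityʳ _))

        κS : κ * T ≈ ∑ (suc (suc N)) (λ k → d (g N) k * v k)
        κS = begin
          κ * T  ≈⟨ solve 4 (λ a q x y → a := a :+ q :* q :* (con ℤ.0ℤ :* x :+ con ℤ.0ℤ :* y)) refl _ Q (v N) (v (suc N)) ⟩
          κ * T + Q * Q * (0# * v N + 0# * v (suc N))
            ≈⟨ +-congˡ (*-congˡ (+-cong (*-congʳ gN+1) (*-congʳ gN+2))) ⟨
          κ * T + Q * Q * (g N (suc N) * v N + g N (suc (suc N)) * v (suc N))
            ≈⟨ κ-shift (g N) N ⟩
          ∑ (suc (suc N)) (λ k → d (g N) k * v k) ∎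

      -- Induction on N: the factors 1 - Q^(2N+2) and 1 - Q^(2N+3) of `JacobiSum-step` are inverted
      -- and become the last two factors of the new inverse product.
      finite-Jacobi : ∀ N →
        JacobiSum v N ≈ r (suc (N ℕ.+ N)) * (∏ N (jacobiFactor κ) * v 0)
      finite-Jacobi zero = begin
        0# + 1# * 1# * (1# * (1# * q⁻¹ 0)) * v 0
          ≈⟨ solve 2 (λ a b → con ℤ.0ℤ :+ con ℤ.1ℤ :* con ℤ.1ℤ :* (con ℤ.1ℤ :* (con ℤ.1ℤ :* a)) :* b
               := con ℤ.1ℤ :* a :* (con ℤ.1ℤ :* b)) refl _ _ ⟩
        1# * q⁻¹ 0 * (1# * v 0) ∎
      finite-Jacobi (suc N) = begin
        JacobiSum v (suc N)
          ≈⟨ solve 1 (λ a → a := con ℤ.1ℤ :* con ℤ.1ℤ :* a) refl _ ⟩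
        1# * 1# * JacobiSum v (suc N)
          ≈⟨ *-congʳ (*-cong (q⁻¹-inverse (suc (N ℕ.+ N))) (q⁻¹-inverse (suc (suc (N ℕ.+ N))))) ⟨
        (i₁ * (1# - Q * (Q * Q ^ (N ℕ.+ N)))) * (i₂ * (1# - Q * (Q * (Q * Q ^ (N ℕ.+ N))))) * JacobiSum v (suc N)
          ≈⟨ *-congʳ (*-cong (*-congˡ (+-congˡ (-‿cong (*-congˡ (*-congˡ Q^2N)))))
               (*-congˡ (+-congˡ (-‿cong (*-congˡ (*-congˡ (*-congˡ Q^2N))))))) ⟩
        (i₁ * (1# - Q * (Q * (P * P)))) * (i₂ * (1# - Q * (Q * (Q * (P * P))))) * JacobiSum v (suc N)
          ≈⟨ solve 5 (λ a b p q s → (a :* (con ℤ.1ℤ :- q :* (q :* (p :* p)))) :* (b :* (con ℤ.1ℤ :- q :* (q :* (q :* (p :* p))))) :* s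
               := a :* b :* ((con ℤ.1ℤ :- p :* p :* q :* q) :* (con ℤ.1ℤ :- p :* p :* q :* q :* q) :* s)) refl i₁ i₂ P Q _ ⟩
        i₁ * i₂ * ((1# - P * P * Q * Q) * (1# - P * P * Q * Q * Q) * JacobiSum v (suc N))
          ≈⟨ *-congˡ (JacobiSum-step N) ⟨
        i₁ * i₂ * (jacobiFactor κ N * JacobiSum v N)
          ≈⟨ *-congˡ (*-congˡ (finite-Jacobi N)) ⟩
        i₁ * i₂ * (jacobiFactor κ N * (r (suc (N ℕ.+ N)) * (∏ N (jacobiFactor κ) * v 0)))
          ≈⟨ solve 6 (λ a b f r p v → a :* b :* (f :* (r :* (p :* v))) := r :* a :* b :* (p :* f :* v)) refl _ _ _ _ _ _ ⟩
        r (suc (suc (suc (N ℕ.+ N)))) * (∏ (suc N) (jacobiFactor κ) * v 0)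
          ≡⟨ ≡.cong (λ j → r (suc (suc j)) * (∏ (suc N) (jacobiFactor κ) * v 0)) (ℕ.+-suc N N) ⟨
        r (suc (suc N ℕ.+ suc N)) * (∏ (suc N) (jacobiFactor κ) * v 0) ∎
        where
        P = Q ^ N
        i₁ = q⁻¹ (suc (N ℕ.+ N))
        i₂ = q⁻¹ (suc (suc (N ℕ.+ N)))

        Q^2N : Q ^ (N ℕ.+ N) ≈ P * P
        Q^2N = ^-homo-* Q N N

    private
      -- The case v k = 1 - Q^(2k+1) of the finite Jacobi identity, in which
      -- the factor with index 0 vanishes.
      alternating-sum-0 : ∀ N → JacobiSum (λ k → 1# - Q ^ k * Q ^ k * Q) (suc N) ≈ 0#
      alternating-sum-0 N = begin
        JacobiSum (λ k → 1# - Q ^ k * Q ^ k * Q) (suc N)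
          ≈⟨ finite-Jacobi _ (1# + Q * Q)
               (solve 1 (λ q → (con ℤ.1ℤ :+ q :* q) :* (con ℤ.1ℤ :- con ℤ.1ℤ :* con ℤ.1ℤ :* q)
                  := (con ℤ.1ℤ :- (q :* con ℤ.1ℤ) :* (q :* con ℤ.1ℤ) :* q) :- q :* (con ℤ.1ℤ :- con ℤ.1ℤ :* con ℤ.1ℤ :* q)) refl Q)
               (λ k → solve 2 (λ q p → (con ℤ.1ℤ :+ q :* q) :* (con ℤ.1ℤ :- (q :* p) :* (q :* p) :* q)
                  := (con ℤ.1ℤ :- (q :* (q :* p)) :* (q :* (q :* p)) :* q) :+ q :* q :* (con ℤ.1ℤ :- p :* p :* q)) refl Q (Q ^ k))
               (suc N) ⟩
        r n * (∏ (suc N) (jacobiFactor (1# + Q * Q)) * v₀)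
          ≈⟨ *-congˡ (*-congʳ (∏-head N _)) ⟩
        r n * ((1# + 1# * 1# * Q * Q - (1# + Q * Q) * 1#) * p * v₀)
          ≈⟨ solve 4 (λ a q b c → a :* ((con ℤ.1ℤ :+ con ℤ.1ℤ :* con ℤ.1ℤ :* q :* q :- (con ℤ.1ℤ :+ q :* q) :* con ℤ.1ℤ) :* b :* c) := con ℤ.0ℤ) refl (r n) Q p v₀ ⟩
        0# ∎
        where
        n = suc (suc N ℕ.+ suc N)
        v₀ = 1# - 1# * 1# * Q
        p = ∏ N (λ k → jacobiFactor (1# + Q * Q) (suc k))

    module _ (κ : Carrier) (D⁻¹ : ℕ → Carrier) where

      D : ℕ → Carrier
      D k = 1# + Q ^ k * Q ^ k * Q - κ * Q ^ k

      -- The expansion of 1 / (D 0 ... D N). For κ = α + β and αβ = Q the denominator `D k` is (1 -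
      -- αQ^k)(1 - βQ^k).
      partialFractions : ℕ → Carrier
      partialFractions N =
        ∑ (suc N) (λ k → sgn k * Q ^ tri k * Q ^ k * (1# - Q ^ k * Q ^ k * Q) * w N k * D⁻¹ k)

      module _ (D-inverse : ∀ k → D⁻¹ k * D k ≈ 1#) where

        -- D N = Q^(N-k) D k + (1 - Q^(N-k)) (1 - Q^(N+k+1)): the first summand contributes
        -- a multiple of the vanishing sum above, the second one the sum for N - 1.
        partialFractions-step : ∀ N → D (suc N) * partialFractions (suc N) ≈ partialFractions N
        partialFractions-step N = begin
          D (suc N) * partialFractions (suc N)
            ≈⟨ *-∑ (suc (suc N)) _ _ ⟩
          ∑ (suc (suc N)) (λ k → D (suc N) * (t k * w (suc N) k * D⁻¹ k))
            ≈⟨ ∑-cong (suc (suc N)) (λ k k<N+2 → term k (ℕ.≤-pred k<N+2)) ⟩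
          ∑ (suc (suc N)) (λ k → Q ^ suc N * (g (suc N) k * v k) + t k * w N k * D⁻¹ k)
            ≈⟨ ∑-+ (suc (suc N)) _ _ ⟩
          ∑ (suc (suc N)) (λ k → Q ^ suc N * (g (suc N) k * v k)) + ∑ (suc (suc N)) (λ k → t k * w N k * D⁻¹ k)
            ≈⟨ +-cong (sym (*-∑ (suc (suc N)) _ _)) (+-congˡ (trans (*-congʳ (trans (*-congˡ wN+1) (zeroʳ _))) (zeroˡ _))) ⟩
          Q ^ suc N * JacobiSum v (suc N) + (partialFractions N + 0#)
            ≈⟨ +-cong (trans (*-congˡ (alternating-sum-0 N)) (zeroʳ _)) (+-identityʳ _) ⟩
          0# + partialFractions N
            ≈⟨ +-identityˡ _ ⟩
          partialFractions N ∎
          where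
          t v : ℕ → Carrier
          t k = sgn k * Q ^ tri k * Q ^ k * (1# - Q ^ k * Q ^ k * Q)
          v k = 1# - Q ^ k * Q ^ k * Q

          wN+1 : w N (suc N) ≈ 0#
          wN+1 = trans (reflexive (≡.cong (λ j → w N (suc j)) (≡.sym (ℕ.+-identityʳ N)))) (w-above N 0)

          term : ∀ k → k ℕ.≤ suc N → D (suc N) * (t k * w (suc N) k * D⁻¹ k)
            ≈ Q ^ suc N * (g (suc N) k * v k) + t k * w N k * D⁻¹ k
          term k k≤ = begin
            (1# + Q ^ suc N * Q ^ suc N * Q - κ * Q ^ suc N) * (s * u * q * (1# - q * q * Q) * (R * ρ) * i)
              ≈⟨ *-congʳ (+-cong (+-congˡ (*-congʳ (*-cong M≈ M≈))) (-‿cong (*-congˡ M≈))) ⟩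
            (1# + X * q * (X * q) * Q - κ * (X * q)) * (s * u * q * (1# - q * q * Q) * (R * ρ) * i)
              ≈⟨ solve 9 (λ Q q X κ s u R ρ i →
                   (con ℤ.1ℤ :+ X :* q :* (X :* q) :* Q :- κ :* (X :* q)) :* (s :* u :* q :* (con ℤ.1ℤ :- q :* q :* Q) :* (R :* ρ) :* i)
                   := X :* q :* (s :* u :* (R :* ρ) :* (con ℤ.1ℤ :- q :* q :* Q)) :* (i :* (con ℤ.1ℤ :+ q :* q :* Q :- κ :* q))
                      :+ s :* u :* q :* (con ℤ.1ℤ :- q :* q :* Q) :* ((con ℤ.1ℤ :- X) :* R :* ((con ℤ.1ℤ :- Q :* (X :* q :* q)) :* ρ)) :* i)
                   refl Q q X κ s u R ρ i ⟩
            X * q * (s * u * (R * ρ) * (1# - q * q * Q)) * (i * D k)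
              + s * u * q * (1# - q * q * Q) * ((1# - X) * R * ((1# - Q * (X * q * q)) * ρ)) * i
              ≈⟨ +-cong (trans (*-cong (*-congʳ (sym M≈)) (D-inverse k)) (*-identityʳ _))
                   (*-congʳ (*-congˡ (*-cong (sym (r∸-step N k k≤)) (sym r'≈)))) ⟩
            Q ^ suc N * (g (suc N) k * v k) + t k * w N k * D⁻¹ k ∎
            where
            s = sgn k
            u = Q ^ tri k
            q = Q ^ k
            X = Q ^ (suc N ∸ k)
            R = r∸ (suc N) k
            ρ = r (suc (suc (N ℕ.+ k)))
            i = D⁻¹ k

            M≈ : Q ^ suc N ≈ X * q
            M≈ = trans (reflexive (≡.cong (Q ^_) (≡.sym (ℕ.m∸n+n≡m k≤)))) (^-homo-* Q (suc N ∸ k) k)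

            r'≈ : r (suc (N ℕ.+ k)) ≈ (1# - Q * (X * q * q)) * ρ
            r'≈ = trans (r-step (suc (N ℕ.+ k)))
              (*-congʳ (+-congˡ (-‿cong (*-congˡ (trans (^-homo-* Q (suc N) k) (*-congʳ M≈))))))

        partialFractions-product : ∀ N → ∏ (suc N) D * partialFractions N ≈ 1#
        partialFractions-product zero = begin
          1# * D 0 * (0# + 1# * 1# * 1# * (1# - 1# * 1# * Q) * (1# * (1# * q⁻¹ 0)) * D⁻¹ 0)
            ≈⟨ solve 4 (λ d q i j → con ℤ.1ℤ :* d :* (con ℤ.0ℤ :+ con ℤ.1ℤ :* con ℤ.1ℤ :* con ℤ.1ℤ :* (con ℤ.1ℤ :- con ℤ.1ℤ :* con ℤ.1ℤ :* q) :* (con ℤ.1ℤ :* (con ℤ.1ℤ :* i)) :* j)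
                 := (j :* d) :* (i :* (con ℤ.1ℤ :- q :* con ℤ.1ℤ))) refl (D 0) Q (q⁻¹ 0) (D⁻¹ 0) ⟩
          (D⁻¹ 0 * D 0) * (q⁻¹ 0 * (1# - Q * 1#))
            ≈⟨ *-cong (D-inverse 0) (q⁻¹-inverse 0) ⟩
          1# * 1# ≈⟨ *-identityʳ 1# ⟩
          1# ∎
        partialFractions-product (suc N) = trans (*-assoc _ _ _)
          (trans (*-congˡ (partialFractions-step N)) (partialFractions-product N))

-- The ring of formal power series

module PowerSeries (R : CommutativeRing 0ℓ 0ℓ) where
  private
    module R where
      open CommutativeRing R public
      open IntegerSolver R public
      open FiniteSums R public

  open R using (_+_; _*_; -_; 0#; 1#; _≈_)

  PS : Set
  PS = ℕ → R.Carrier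

  infix 4 _≋_
  record _≋_ (f g : PS) : Set where
    constructor coeffs
    field coeff : ∀ n → f n ≈ g n
  open _≋_ public

  tail : PS → PS
  tail f n = f (suc n)

  constant : R.Carrier → PS
  constant c zero = c
  constant c (suc n) = 0#

  infixl 7 _⊗_
  -- The Cauchy product by recursion along the first factor, so that the ring laws are inductions on
  -- the index without manipulation of sums.
  _⊗_ : PS → PS → PS
  (f ⊗ g) zero = f 0 * g 0
  (f ⊗ g) (suc n) = f 0 * g (suc n) + (tail f ⊗ g) n

  private
    open import Relation.Binary.Reasoning.Setoid R.setoid

    ⊗-cong : ∀ {f f′ g g′} → (∀ n → f n ≈ f′ n) → (∀ n → g n ≈ g′ n) → ∀ n → (f ⊗ g) n ≈ (f′ ⊗ g′) n
    ⊗-cong p q zero = R.*-cong (p 0) (q 0)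
    ⊗-cong p q (suc n) = R.+-cong (R.*-cong (p 0) (q (suc n))) (⊗-cong (p ∘ suc) q n)

    ⊗-distribʳ : ∀ f g h n → ((λ k → f k + g k) ⊗ h) n ≈ (f ⊗ h) n + (g ⊗ h) n
    ⊗-distribʳ f g h zero = R.distribʳ _ _ _
    ⊗-distribʳ f g h (suc n) = R.trans (R.+-cong (R.distribʳ _ _ _) (⊗-distribʳ (tail f) (tail g) h n))
      (R.solve 4 (λ a b c d → (a R.:+ b) R.:+ (c R.:+ d) R.:= (a R.:+ c) R.:+ (b R.:+ d)) R.refl _ _ _ _)

    ⊗-scale : ∀ c f g n → ((λ k → c * f k) ⊗ g) n ≈ c * (f ⊗ g) n
    ⊗-scale c f g zero = R.*-assoc _ _ _
    ⊗-scale c f g (suc n) = R.trans (R.+-cong (R.*-assoc _ _ _) (⊗-scale c (tail f) g n))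
      (R.sym (R.distribˡ _ _ _))

    ⊗-assoc : ∀ f g h n → ((f ⊗ g) ⊗ h) n ≈ (f ⊗ (g ⊗ h)) n
    ⊗-assoc f g h zero = R.*-assoc _ _ _
    ⊗-assoc f g h (suc n) = begin
      f 0 * g 0 * h (suc n) + ((λ k → f 0 * tail g k + (tail f ⊗ g) k) ⊗ h) n
        ≈⟨ R.+-congˡ (⊗-distribʳ _ _ h n) ⟩
      f 0 * g 0 * h (suc n) + (((λ k → f 0 * tail g k) ⊗ h) n + ((tail f ⊗ g) ⊗ h) n)
        ≈⟨ R.+-congˡ (R.+-cong (⊗-scale (f 0) (tail g) h n) (⊗-assoc (tail f) g h n)) ⟩
      f 0 * g 0 * h (suc n) + (f 0 * (tail g ⊗ h) n + (tail f ⊗ (g ⊗ h)) n)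
        ≈⟨ R.solve 5 (λ a b c d e → a R.:* b R.:* c R.:+ (a R.:* d R.:+ e) R.:= a R.:* (b R.:* c R.:+ d) R.:+ e) R.refl _ _ _ _ _ ⟩
      f 0 * (g 0 * h (suc n) + (tail g ⊗ h) n) + (tail f ⊗ (g ⊗ h)) n ∎

    ⊗-sucʳ : ∀ f g n → (f ⊗ g) (suc n) ≈ (f ⊗ tail g) n + f (suc n) * g 0
    ⊗-sucʳ f g zero = R.refl
    ⊗-sucʳ f g (suc n) = R.trans (R.+-congˡ (⊗-sucʳ (tail f) g n)) (R.sym (R.+-assoc _ _ _))

    ⊗-comm : ∀ f g n → (f ⊗ g) n ≈ (g ⊗ f) n
    ⊗-comm f g zero = R.*-comm _ _
    ⊗-comm f g (suc n) = begin
      f 0 * g (suc n) + (tail f ⊗ g) n   ≈⟨ R.+-cong (R.*-comm _ _) (⊗-comm (tail f) g n) ⟩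
      g (suc n) * f 0 + (g ⊗ tail f) n   ≈⟨ R.+-comm _ _ ⟩
      (g ⊗ tail f) n + g (suc n) * f 0   ≈⟨ ⊗-sucʳ g f n ⟨
      (g ⊗ f) (suc n)                    ∎

    ⊗-zeroˡ : ∀ g n → ((λ _ → 0#) ⊗ g) n ≈ 0#
    ⊗-zeroˡ g zero = R.zeroˡ _
    ⊗-zeroˡ g (suc n) = R.trans (R.+-cong (R.zeroˡ _) (⊗-zeroˡ g n)) (R.+-identityˡ _)

    ⊗-identityˡ : ∀ g n → (constant 1# ⊗ g) n ≈ g n
    ⊗-identityˡ g zero = R.*-identityˡ _
    ⊗-identityˡ g (suc n) = R.trans (R.+-cong (R.*-identityˡ _) (⊗-zeroˡ g n)) (R.+-identityʳ _)

  -- Opaque multiplication keeps the terms of the later proofs small.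
  abstract
    _⊠_ : PS → PS → PS
    _⊠_ = _⊗_

    ⊠-def : ∀ f g n → (f ⊠ g) n ≡ (f ⊗ g) n
    ⊠-def f g n = ≡.refl

    private
      isCommutativeRing : IsCommutativeRing _≋_ (λ f g n → f n + g n) _⊠_ (λ f n → - f n) (λ _ → 0#) (constant 1#)
      isCommutativeRing = record
        { isRing = record
          { +-isAbelianGroup = record
            { isGroup = record
              { isMonoid = record
                { isSemigroup = record
                  { isMagma = record
                    { isEquivalence = record
                      { refl = coeffs λ n → R.refl
                      ; sym = λ p → coeffs λ n → R.sym (coeff p n)
                      ; trans = λ p q → coeffs λ n → R.trans (coeff p n) (coeff q n) }
                    ; ∙-cong = λ p q → coeffs λ n → R.+-cong (coeff p n) (coeff q n) }
                  ; assoc = λ f g h → coeffs λ n → R.+-assoc _ _ _ }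
                ; identity = (λ f → coeffs λ n → R.+-identityˡ _) , (λ f → coeffs λ n → R.+-identityʳ _) }
              ; inverse = (λ f → coeffs λ n → R.-‿inverseˡ _) , (λ f → coeffs λ n → R.-‿inverseʳ _)
              ; ⁻¹-cong = λ p → coeffs λ n → R.-‿cong (coeff p n) }
            ; comm = λ f g → coeffs λ n → R.+-comm _ _ }
          ; *-cong = λ p q → coeffs (⊗-cong (coeff p) (coeff q))
          ; *-assoc = λ f g h → coeffs (⊗-assoc f g h)
          ; *-identity = (λ f → coeffs (⊗-identityˡ f))
              , (λ f → coeffs λ n → R.trans (⊗-comm f _ n) (⊗-identityˡ f n))
          ; distrib = (λ f g h → coeffs λ n → R.trans (⊗-comm f _ n)
                (R.trans (⊗-distribʳ g h f n) (R.+-cong (⊗-comm g f n) (⊗-comm h f n))))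
              , (λ f g h → coeffs (⊗-distribʳ g h f)) }
        ; *-comm = λ f g → coeffs (⊗-comm f g) }

  FPS : CommutativeRing 0ℓ 0ℓ
  FPS = record { isCommutativeRing = isCommutativeRing }

  ⊠-sum : ∀ f g n → (f ⊠ g) n ≈ R.∑ (suc n) (λ i → f i * g (n ∸ i))
  ⊠-sum f g n = R.trans (R.reflexive (⊠-def f g n)) (go f n)
    where
    go : ∀ f n → (f ⊗ g) n ≈ R.∑ (suc n) (λ i → f i * g (n ∸ i))
    go f zero = R.sym (R.+-identityˡ _)
    go f (suc n) = R.trans (R.+-congˡ (go (tail f) n)) (R.sym (R.∑-head (suc n) _))

-- Orders of vanishing, infinite sums and products, sums over the integers

module Limits (R : CommutativeRing 0ℓ 0ℓ) where
  private
    module R where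
      open CommutativeRing R public
      open IntegerSolver R public
      open FiniteSums R public
      open RingProperties ring public using (-0#≈0#)
  open PowerSeries R
  open CommutativeRing FPS
  open Exp commutativeSemiring using (_^_)
  open IntegerSolver FPS
  open FiniteSums FPS
  open import Relation.Binary.Reasoning.Setoid setoid

  infix 4 _≈[_]_
  -- Congruence modulo q^N. Limits are taken by proving an identity modulo every q^N; the record
  -- form keeps f and g inferable.
  record _≈[_]_ (f : PS) (N : ℕ) (g : PS) : Set where
    constructor below
    field at : ∀ n → n ℕ.< N → f n R.≈ g n
  open _≈[_]_ public

  ≈⇒≈[] : ∀ {N f g} → f ≈ g → f ≈[ N ] g
  ≈⇒≈[] p = below λ n _ → coeff p n

  []-sym : ∀ {N f g} → f ≈[ N ] g → g ≈[ N ] f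
  []-sym p = below λ n n<N → R.sym (at p n n<N)

  []-trans : ∀ {N f g h} → f ≈[ N ] g → g ≈[ N ] h → f ≈[ N ] h
  []-trans p q = below λ n n<N → R.trans (at p n n<N) (at q n n<N)

  []-weaken : ∀ {M N f g} → M ℕ.≤ N → f ≈[ N ] g → f ≈[ M ] g
  []-weaken M≤N p = below λ n n<M → at p n (ℕ.<-≤-trans n<M M≤N)

  []-limit : ∀ {f g} → (∀ N → f ≈[ N ] g) → f ≈ g
  []-limit p = coeffs λ n → at (p (suc n)) n ℕ.≤-refl

  []-+ : ∀ {N f f′ g g′} → f ≈[ N ] f′ → g ≈[ N ] g′ → f + g ≈[ N ] f′ + g′
  []-+ p q = below λ n n<N → R.+-cong (at p n n<N) (at q n n<N)

  []-neg : ∀ {N f g} → f ≈[ N ] g → - f ≈[ N ] - g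
  []-neg p = below λ n n<N → R.-‿cong (at p n n<N)

  []-* : ∀ {N f f′ g g′} → f ≈[ N ] f′ → g ≈[ N ] g′ → f * g ≈[ N ] f′ * g′
  []-* {N} {f} {f′} {g} {g′} p q = below λ n n<N → R.trans (⊠-sum f g n) (R.trans
    (R.∑-cong (suc n) λ i i≤n → R.*-cong
      (at p i (ℕ.≤-<-trans (ℕ.≤-pred i≤n) n<N)) (at q (n ∸ i) (ℕ.≤-<-trans (ℕ.m∸n≤m n i) n<N)))
    (R.sym (⊠-sum f′ g′ n)))

  []-sub : ∀ {N f g} → f ≈[ N ] g → f - g ≈[ N ] 0#
  []-sub {g = g} p = []-trans ([]-+ p (≈⇒≈[] refl)) (≈⇒≈[] (-‿inverseʳ g))

  []-unsub : ∀ {N f g} → f - g ≈[ N ] 0# → f ≈[ N ] g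
  []-unsub {f = f} {g} p = []-trans (≈⇒≈[] (solve 2 (λ a b → a := (a :- b) :+ b) refl f g))
    ([]-trans ([]-+ p (≈⇒≈[] refl)) (≈⇒≈[] (+-identityˡ g)))

  order-* : ∀ {a b f g} → f ≈[ a ] 0# → g ≈[ b ] 0# → f * g ≈[ a ℕ.+ b ] 0#
  order-* {a} {b} {f} {g} p q = below λ n n<a+b → R.trans (⊠-sum f g n)
    (R.∑-0 (suc n) λ i i≤n → term n n<a+b i (ℕ.≤-pred i≤n))
    where
    term : ∀ n → n ℕ.< a ℕ.+ b → ∀ i → i ℕ.≤ n → f i R.* g (n ∸ i) R.≈ R.0#
    term n n<a+b i i≤n with i ℕ.<? a
    ... | yes i<a = R.trans (R.*-congʳ (at p i i<a)) (R.zeroˡ _)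
    ... | no i≮a = R.trans (R.*-congˡ (at q (n ∸ i) (ℕ.+-cancelˡ-< a (n ∸ i) b
      (ℕ.≤-<-trans (ℕ.+-monoˡ-≤ (n ∸ i) (ℕ.≮⇒≥ i≮a))
        (≡.subst (ℕ._< a ℕ.+ b) (≡.sym (ℕ.m+[n∸m]≡n i≤n)) n<a+b))))) (R.zeroʳ _)

  order-*ʳ : ∀ {b} f {g} → g ≈[ b ] 0# → f * g ≈[ b ] 0#
  order-*ʳ f q = order-* {0} (below λ n ()) q

  order-*ˡ : ∀ {a f} g → f ≈[ a ] 0# → f * g ≈[ a ] 0#
  order-*ˡ g p = []-trans (≈⇒≈[] (*-comm _ _)) (order-*ʳ g p)

  order-+ : ∀ {N f g} → f ≈[ N ] 0# → g ≈[ N ] 0# → f + g ≈[ N ] 0#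
  order-+ p q = []-trans ([]-+ p q) (≈⇒≈[] (+-identityˡ 0#))

  order-neg : ∀ {N f} → f ≈[ N ] 0# → - f ≈[ N ] 0#
  order-neg p = []-trans ([]-neg p) (below λ _ _ → R.-0#≈0#)

  order-^ : ∀ {f} → f ≈[ 1 ] 0# → ∀ n → f ^ n ≈[ n ] 0#
  order-^ p zero = below λ n ()
  order-^ p (suc n) = order-* p (order-^ p n)

  order-∑ : ∀ {N} n {f} → (∀ i → i ℕ.< n → f i ≈[ N ] 0#) → ∑ n f ≈[ N ] 0#
  order-∑ zero p = below λ _ _ → R.refl
  order-∑ (suc n) p = order-+ (order-∑ n λ i i<n → p i (ℕ.m<n⇒m<1+n i<n)) (p n ℕ.≤-refl)

  -- The k-th term has no exponent below k, so the coefficient of q^n is determined by the terms k ≤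
  -- n. This is where `∑∞` cuts off.
  Summable : (ℕ → PS) → Set
  Summable f = ∀ k → f k ≈[ k ] 0#

  abstract
    ∑∞ : (ℕ → PS) → PS
    ∑∞ f n = ∑ (suc n) f n

    ∑∞-coeff : ∀ f n → ∑∞ f n ≡ ∑ (suc n) f n
    ∑∞-coeff f n = ≡.refl

    private
      ∑-at : ∀ m f n → ∑ m f n R.≈ R.∑ m (λ k → f k n)
      ∑-at zero f n = R.refl
      ∑-at (suc m) f n = R.+-congʳ (∑-at m f n)

      ∑-stable : ∀ {f} → Summable f → ∀ m n → n ℕ.< m → ∑ m f n R.≈ ∑ (suc n) f n
      ∑-stable s (suc m) n n<m+1 with n ℕ.≟ m
      ... | yes ≡.refl = R.refl
      ... | no n≢m = R.trans (R.+-cong (∑-stable s m n n<m) (at (s m) n n<m)) (R.+-identityʳ _)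
        where
        n<m : n ℕ.< m
        n<m = ℕ.≤∧≢⇒< (ℕ.≤-pred n<m+1) n≢m

    ∑∞-truncate : ∀ {f} → Summable f → ∀ N → ∑ N f ≈[ N ] ∑∞ f
    ∑∞-truncate s N = below λ n n<N → ∑-stable s N n n<N

    ∑∞-cong : ∀ {f g} → (∀ k → f k ≈ g k) → ∑∞ f ≈ ∑∞ g
    ∑∞-cong p = coeffs λ n → coeff (∑-cong (suc n) λ k _ → p k) n

    ∑∞-+ : ∀ f g → ∑∞ (λ k → f k + g k) ≈ ∑∞ f + ∑∞ g
    ∑∞-+ f g = coeffs λ n → coeff (∑-+ (suc n) f g) n

    ∑∞-0 : ∀ {f} → (∀ k → f k ≈ 0#) → ∑∞ f ≈ 0#
    ∑∞-0 p = coeffs λ n → coeff (∑-0 (suc n) λ k _ → p k) n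

    *-∑∞ : ∀ c {f} → Summable f → c * ∑∞ f ≈ ∑∞ (λ k → c * f k)
    *-∑∞ c {f} s = []-limit λ N → []-trans ([]-* (≈⇒≈[] refl) ([]-sym (∑∞-truncate s N)))
      ([]-trans (≈⇒≈[] (*-∑ N c f)) (∑∞-truncate (λ k → order-*ʳ c (s k)) N))

    ∑∞-neg : ∀ f → ∑∞ (λ k → - f k) ≈ - ∑∞ f
    ∑∞-neg f = begin
      ∑∞ (λ k → - f k)                             ≈⟨ solve 2 (λ a b → b := (b :+ a) :- a) refl (∑∞ f) _ ⟩
      (∑∞ (λ k → - f k) + ∑∞ f) - ∑∞ f             ≈⟨ +-congʳ (∑∞-+ _ f) ⟨
      ∑∞ (λ k → - f k + f k) - ∑∞ f                ≈⟨ +-congʳ (∑∞-0 λ k → -‿inverseˡ (f k)) ⟩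
      0# - ∑∞ f                                    ≈⟨ +-identityˡ _ ⟩
      - ∑∞ f                                       ∎

    ∑∞-head : ∀ {f} → Summable f → ∑∞ f ≈ f 0 + ∑∞ (f ∘ suc)
    ∑∞-head {f} s = coeffs λ n → R.trans (R.sym (∑-stable s (suc (suc n)) n (ℕ.m<n⇒m<1+n (ℕ.n<1+n n))))
      (coeff (∑-head (suc n) f) n)

    -- Since the cutoff depends only on the coefficient read, the coefficient of q^n is on either
    -- side a sum over the square i, j ≤ n.
    ∑∞-swap : ∀ (f : ℕ → ℕ → PS) → ∑∞ (λ i → ∑∞ (f i)) ≈ ∑∞ (λ j → ∑∞ (λ i → f i j))
    ∑∞-swap f = coeffs λ n → R.trans (∑-at (suc n) (λ i → ∑∞ (f i)) n) (R.trans
      (R.∑-cong (suc n) λ i _ → ∑-at (suc n) (f i) n) (R.trans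
      (R.∑-swap (suc n) (suc n) (λ i j → f i j n)) (R.trans
      (R.∑-cong (suc n) λ j _ → R.sym (∑-at (suc n) (λ i → f i j) n))
      (R.sym (∑-at (suc n) (λ j → ∑∞ (λ i → f i j)) n)))))

    Summable-suc : ∀ {f} → Summable f → Summable (f ∘ suc)
    Summable-suc s k = []-weaken (ℕ.n≤1+n k) (s (suc k))

    -- Tannery's theorem for power series: c k has order k and d N k is exact to order N-k, so each
    -- product is exact to order N.
    ∑∞-dominated : ∀ {c} → Summable c → ∀ (d : ℕ → ℕ → PS) d∞ →
      (∀ N k → k ℕ.≤ N → d N k ≈[ N ∸ k ] d∞) → ∀ N →
      ∑ (suc N) (λ k → c k * d N k) ≈[ N ] ∑∞ c * d∞
    ∑∞-dominated {c} s d d∞ d→ N = []-trans (swap (suc N) ℕ.≤-refl)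
      ([]-trans (≈⇒≈[] (trans (sym (*-∑ (suc N) d∞ c)) (*-comm _ _)))
        ([]-* ([]-weaken (ℕ.n≤1+n N) (∑∞-truncate s (suc N))) (≈⇒≈[] refl)))
      where
      swap : ∀ m → m ℕ.≤ suc N → ∑ m (λ k → c k * d N k) ≈[ N ] ∑ m (λ k → d∞ * c k)
      swap zero _ = ≈⇒≈[] refl
      swap (suc m) m<N+1 = []-+ (swap m (ℕ.<⇒≤ m<N+1)) ([]-unsub ([]-trans
        (≈⇒≈[] (solve 3 (λ c d e → c :* d :- e :* c := c :* (d :- e)) refl _ _ _))
        ([]-weaken (ℕ.≤-reflexive (≡.sym (ℕ.m+[n∸m]≡n (ℕ.≤-pred m<N+1))))
          (order-* (s m) ([]-sub (d→ N m (ℕ.≤-pred m<N+1)))))))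

  -- One order more than in `Summable`, as for the factors 1 - y^(k+1): the first N factors then fix
  -- the coefficients up to q^N inclusive.
  Multipliable : (ℕ → PS) → Set
  Multipliable f = ∀ k → f k ≈[ suc k ] 1#

  abstract
    ∏∞ : (ℕ → PS) → PS
    ∏∞ f n = ∏ (suc n) f n

    ∏∞-coeff : ∀ f n → ∏∞ f n ≡ ∏ (suc n) f n
    ∏∞-coeff f n = ≡.refl

    private
      ∏-stable : ∀ {f} → Multipliable f → ∀ m j → ∏ (j ℕ.+ m) f ≈[ suc m ] ∏ m f
      ∏-stable s m zero = ≈⇒≈[] refl
      ∏-stable s m (suc j) = []-trans ([]-* (∏-stable s m j) ([]-weaken (s≤s (ℕ.m≤n+m m j)) (s (j ℕ.+ m))))
        (≈⇒≈[] (*-identityʳ _))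

    ∏∞-truncate : ∀ {f} → Multipliable f → ∀ N → ∏ N f ≈[ suc N ] ∏∞ f
    ∏∞-truncate {f} s N = below λ n n≤N → R.trans
      (at (≡.subst (λ j → ∏ j f ≈[ suc n ] ∏ n f) (ℕ.m∸n+n≡m (ℕ.≤-pred n≤N)) (∏-stable s n (N ∸ n))) n ℕ.≤-refl)
      (R.sym (at (∏-stable s n 1) n ℕ.≤-refl))

    ∏∞-cong : ∀ {f g} → (∀ k → f k ≈ g k) → ∏∞ f ≈ ∏∞ g
    ∏∞-cong p = coeffs λ n → coeff (∏-cong (suc n) p) n

  Multipliable-* : ∀ {f g} → Multipliable f → Multipliable g → Multipliable (λ k → f k * g k)
  Multipliable-* s t k = []-trans ([]-* (s k) (t k)) (≈⇒≈[] (*-identityˡ 1#))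

  ∏∞-* : ∀ {f g} → Multipliable f → Multipliable g → ∏∞ (λ k → f k * g k) ≈ ∏∞ f * ∏∞ g
  ∏∞-* {f} {g} s t = []-limit λ N → []-weaken (ℕ.n≤1+n N)
    ([]-trans ([]-sym (∏∞-truncate (Multipliable-* s t) N)) ([]-trans (≈⇒≈[] (∏-* N f g))
      ([]-* (∏∞-truncate s N) (∏∞-truncate t N))))

  private
    ∏-append : ∀ m n f → ∏ (n ℕ.+ m) f ≈ ∏ m f * ∏ n (λ j → f (j ℕ.+ m))
    ∏-append m zero f = sym (*-identityʳ _)
    ∏-append m (suc n) f = trans (*-congʳ (∏-append m n f)) (*-assoc _ _ _)

    ∏-split : ∀ m f N → ∏ (N ℕ.* m) f ≈ ∏ N (λ k → ∏ m (λ j → f (j ℕ.+ k ℕ.* m)))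
    ∏-split m f zero = refl
    ∏-split m f (suc N) = trans (∏-append (N ℕ.* m) m f) (*-congʳ (∏-split m f N))

  order-∏ : ∀ {N f} m → (∀ j → f j ≈[ N ] 1#) → ∏ m f ≈[ N ] 1#
  order-∏ zero p = ≈⇒≈[] refl
  order-∏ (suc m) p = []-trans ([]-* (order-∏ m p) (p m)) (≈⇒≈[] (*-identityˡ 1#))

  ∏∞-split : ∀ m {f} → Multipliable f →
    ∏∞ f ≈ ∏∞ (λ k → ∏ (suc m) (λ j → f (j ℕ.+ k ℕ.* suc m)))
  ∏∞-split m {f} s = []-limit λ N → []-weaken (ℕ.n≤1+n N) ([]-trans
    ([]-sym ([]-weaken (s≤s (ℕ.m≤m*n N (suc m))) (∏∞-truncate s (N ℕ.* suc m))))
    ([]-trans (≈⇒≈[] (∏-split (suc m) f N))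
      (∏∞-truncate (λ k → order-∏ (suc m) λ j →
        []-weaken (s≤s (ℕ.≤-trans (ℕ.m≤m*n k (suc m)) (ℕ.m≤n+m (k ℕ.* suc m) j))) (s (j ℕ.+ k ℕ.* suc m))) N)))

  -- From f g = f h follows g - h = -(f - 1)(g - h), and f - 1 has no constant term, so each use of
  -- this equation raises the order of g - h by one.
  *-cancelˡ-unit : ∀ {f g h} → f ≈[ 1 ] 1# → f * g ≈ f * h → g ≈ h
  *-cancelˡ-unit {f} {g} {h} f≈1 fg≈fh = []-limit λ N → []-unsub (go N)
    where
    go : ∀ N → g - h ≈[ N ] 0#
    go zero = below λ n ()
    go (suc N) = []-trans (≈⇒≈[] (begin
      g - h                                    ≈⟨ solve 3 (λ f g h → g :- h := (f :* g :- f :* h) :- (f :- con ℤ.1ℤ) :* (g :- h)) refl f g h ⟩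
      (f * g - f * h) - (f - 1#) * (g - h)     ≈⟨ +-congʳ (trans (+-congʳ fg≈fh) (-‿inverseʳ _)) ⟩
      0# - (f - 1#) * (g - h)                  ≈⟨ +-identityˡ _ ⟩
      - ((f - 1#) * (g - h))                   ∎))
      (order-neg (order-* ([]-sub f≈1) (go N)))

  geometric : PS → PS
  geometric y = ∑∞ (y ^_)

  geometric-inverse : ∀ {y} → y ≈[ 1 ] 0# → geometric y * (1# - y) ≈ 1#
  geometric-inverse {y} s = begin
    geometric y * (1# - y)                        ≈⟨ solve 2 (λ g y → g :* (con ℤ.1ℤ :- y) := g :- y :* g) refl _ y ⟩
    geometric y - y * geometric y                 ≈⟨ +-cong (∑∞-head (order-^ s)) (-‿cong (*-∑∞ y (order-^ s))) ⟩
    (1# + ∑∞ (λ k → y ^ suc k)) - ∑∞ (λ k → y * y ^ k)  ≈⟨ solve 2 (λ a b → (a :+ b) :- b := a) refl 1# _ ⟩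
    1#                                            ∎

  geometric-cong : ∀ {y z} → y ≈ z → geometric y ≈ geometric z
  geometric-cong y≈z = ∑∞-cong λ k → ^-cong-base k
    where
    ^-cong-base : ∀ k → _ ^ k ≈ _ ^ k
    ^-cong-base zero = refl
    ^-cong-base (suc k) = *-cong y≈z (^-cong-base k)

  Summableℤ : (ℤ → PS) → Set
  Summableℤ f = ∀ i → f i ≈[ ∣ i ∣ ] 0#

  -- Pairing n with -1-n brings bilateral theta series into the unilateral form of the triple
  -- product and lets series antisymmetric under n → -1-n cancel term by term.
  fold : (ℤ → PS) → ℕ → PS
  fold f k = f (pos k) + f -[1+ k ]

  fold-summable : ∀ {f} → Summableℤ f → Summable (fold f)
  fold-summable s k = order-+ (s (pos k)) ([]-weaken (ℕ.n≤1+n k) (s -[1+ k ]))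

  abstract
    ∑ℤ : (ℤ → PS) → PS
    ∑ℤ f = ∑∞ (fold f)

    ∑ℤ-def : ∀ f → ∑ℤ f ≈ ∑∞ (fold f)
    ∑ℤ-def f = refl

    ∑ℤ-cong : ∀ {f g} → (∀ i → f i ≈ g i) → ∑ℤ f ≈ ∑ℤ g
    ∑ℤ-cong p = ∑∞-cong λ k → +-cong (p _) (p _)

    ∑ℤ-+ : ∀ f g → ∑ℤ (λ i → f i + g i) ≈ ∑ℤ f + ∑ℤ g
    ∑ℤ-+ f g = trans (∑∞-cong λ k → solve 4 (λ a b c d → (a :+ b) :+ (c :+ d) := (a :+ c) :+ (b :+ d)) refl _ _ _ _)
      (∑∞-+ (fold f) (fold g))

    ∑ℤ-neg : ∀ f → ∑ℤ (λ i → - f i) ≈ - ∑ℤ f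
    ∑ℤ-neg f = trans (∑∞-cong λ k → solve 2 (λ a b → :- a :+ :- b := :- (a :+ b)) refl _ _) (∑∞-neg (fold f))

    *-∑ℤ : ∀ c {f} → Summableℤ f → c * ∑ℤ f ≈ ∑ℤ (λ i → c * f i)
    *-∑ℤ c s = trans (*-∑∞ c (fold-summable s)) (∑∞-cong λ k → distribˡ c _ _)

    ∑ℤ-swap : ∀ (f : ℤ → ℤ → PS) → ∑ℤ (λ i → ∑ℤ (f i)) ≈ ∑ℤ (λ j → ∑ℤ (λ i → f i j))
    ∑ℤ-swap f = begin
      ∑∞ (λ k → ∑∞ (fold (f (pos k))) + ∑∞ (fold (f -[1+ k ])))
        ≈⟨ ∑∞-cong (λ k → sym (∑∞-+ _ _)) ⟩
      ∑∞ (λ k → ∑∞ (λ l → fold (f (pos k)) l + fold (f -[1+ k ]) l))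
        ≈⟨ ∑∞-swap _ ⟩
      ∑∞ (λ l → ∑∞ (λ k → fold (f (pos k)) l + fold (f -[1+ k ]) l))
        ≈⟨ ∑∞-cong (λ l → trans (∑∞-cong λ k →
             solve 4 (λ a b c d → (a :+ b) :+ (c :+ d) := (a :+ c) :+ (b :+ d)) refl _ _ _ _) (∑∞-+ _ _)) ⟩
      ∑∞ (λ l → ∑∞ (fold (λ i → f i (pos l))) + ∑∞ (fold (λ i → f i -[1+ l ]))) ∎

    -- Shifting the symmetric window moves one term in and one out; at the coefficient of q^n both
    -- boundary terms have index of absolute value n+1 and vanish.
    ∑ℤ-suc : ∀ {f} → Summableℤ f → ∑ℤ (f ∘ ℤ.suc) ≈ ∑ℤ f
    ∑ℤ-suc {f} s = coeffs λ n → R.trans (coeff (telescope n) n)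
      (R.trans (R.+-congˡ (R.trans (R.+-cong (at (s (pos (suc n))) n ℕ.≤-refl) (R.-‿cong (at (s -[1+ n ]) n ℕ.≤-refl)))
        (R.-‿inverseʳ R.0#))) (R.+-identityʳ _))
      where
      telescope : ∀ m → ∑ (suc m) (fold (f ∘ ℤ.suc)) ≈ ∑ (suc m) (fold f) + (f (pos (suc m)) - f -[1+ m ])
      telescope zero = solve 3 (λ a b c → con ℤ.0ℤ :+ (a :+ b) := (con ℤ.0ℤ :+ (b :+ c)) :+ (a :- c)) refl _ _ _
      telescope (suc m) = trans (+-congʳ (telescope m))
        (solve 5 (λ s a b c d → (s :+ (a :- b)) :+ (c :+ b) := (s :+ (a :+ d)) :+ (c :- d)) refl _ _ _ _ _)

  -- Shifting f by n passes through the shifts by j ≤ n.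
  ∑ℤ-shift : ∀ n {f} → (∀ j → j ℕ.≤ n → Summableℤ (λ i → f (pos j ℤ.+ i))) →
    ∑ℤ (λ i → f (pos n ℤ.+ i)) ≈ ∑ℤ f
  ∑ℤ-shift zero {f} s = ∑ℤ-cong λ i → reflexive (≡.cong f (ℤ.+-identityˡ i))
  ∑ℤ-shift (suc n) {f} s = begin
    ∑ℤ (λ i → f (pos (suc n) ℤ.+ i))
      ≈⟨ ∑ℤ-cong (λ i → reflexive (≡.cong f (suc-shift i))) ⟩
    ∑ℤ (λ i → f (pos n ℤ.+ ℤ.suc i))
      ≈⟨ ∑ℤ-suc (s n (ℕ.n≤1+n n)) ⟩
    ∑ℤ (λ i → f (pos n ℤ.+ i))
      ≈⟨ ∑ℤ-shift n {f} (λ j j≤n → s j (ℕ.m≤n⇒m≤1+n j≤n)) ⟩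
    ∑ℤ f ∎
    where
    suc-shift : ∀ i → pos (suc n) ℤ.+ i ≡ pos n ℤ.+ ℤ.suc i
    suc-shift i = ≡.trans (≡.cong (ℤ._+ i) (ℤ.+-comm (pos 1) (pos n))) (ℤ.+-assoc (pos n) (pos 1) i)

-- Euler products, the triple product and Jacobi's series for the cube

module EulerProducts (R : CommutativeRing 0ℓ 0ℓ) where
  open PowerSeries R
  open CommutativeRing FPS
  open Exp commutativeSemiring using (_^_)
  open IntegerSolver FPS
  open FiniteSums FPS
  open Limits R
  open import Relation.Binary.Reasoning.Setoid setoid

  poch : PS → PS → PS
  poch α Q = ∏∞ (λ k → 1# - α * Q ^ k)

  E : PS → PS
  E y = ∏∞ (λ k → 1# - y ^ suc k)

  order-1- : ∀ {N f} → f ≈[ N ] 0# → 1# - f ≈[ N ] 1#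
  order-1- p = []-trans ([]-+ (≈⇒≈[] refl) (order-neg p)) (≈⇒≈[] (+-identityʳ 1#))

  order-*^ : ∀ {α Q} → α ≈[ 1 ] 0# → Q ≈[ 1 ] 0# → ∀ k → α * Q ^ k ≈[ suc k ] 0#
  order-*^ p q k = order-* p (order-^ q k)

  poch-multipliable : ∀ {α Q} → α ≈[ 1 ] 0# → Q ≈[ 1 ] 0# → Multipliable (λ k → 1# - α * Q ^ k)
  poch-multipliable p q k = order-1- (order-*^ p q k)

  E-multipliable : ∀ {y} → y ≈[ 1 ] 0# → Multipliable (λ k → 1# - y ^ suc k)
  E-multipliable p k = order-1- (order-^ p (suc k))

  ∏∞-unit : ∀ {f} → Multipliable f → ∏∞ f ≈[ 1 ] 1#
  ∏∞-unit s = []-sym (∏∞-truncate s 0)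

  E-unit : ∀ {y} → y ≈[ 1 ] 0# → E y ≈[ 1 ] 1#
  E-unit p = ∏∞-unit (E-multipliable p)

  ∑∞-finite : ∀ N {f} → Summable f → (∀ k → N ℕ.≤ k → f k ≈ 0#) → ∑ N f ≈ ∑∞ f
  ∑∞-finite N {f} s p = []-limit λ M → []-trans (≈⇒≈[] (sym (extend M)))
    ([]-weaken (ℕ.m≤m+n M N) (∑∞-truncate s (M ℕ.+ N)))
    where
    extend : ∀ M → ∑ (M ℕ.+ N) f ≈ ∑ N f
    extend zero = refl
    extend (suc M) = trans (+-cong (extend M) (p (M ℕ.+ N) (ℕ.m≤n+m N M))) (+-identityʳ _)

  ∑∞-drop : ∀ m {f} → Summable f → (∀ k → k ℕ.< m → f k ≈ 0#) → ∑∞ f ≈ ∑∞ (λ j → f (m ℕ.+ j))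
  ∑∞-drop zero s p = refl
  ∑∞-drop (suc m) {f} s p = begin
    ∑∞ f                            ≈⟨ ∑∞-head s ⟩
    f 0 + ∑∞ (f ∘ suc)              ≈⟨ +-cong (p 0 (s≤s z≤n)) (∑∞-drop m (Summable-suc s) λ k k<m → p (suc k) (s≤s k<m)) ⟩
    0# + ∑∞ (λ j → f (suc m ℕ.+ j)) ≈⟨ +-identityˡ _ ⟩
    ∑∞ (λ j → f (suc m ℕ.+ j))      ∎

  odd : ℕ → PS
  odd zero = 1#
  odd (suc k) = odd k + (1# + 1#)

  module Base {Q : PS} (order-Q : Q ≈[ 1 ] 0#) where
    q⁻¹ : ℕ → PS
    q⁻¹ k = geometric (Q ^ suc k)

    q⁻¹-inverse : ∀ k → q⁻¹ k * (1# - Q ^ suc k) ≈ 1#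
    q⁻¹-inverse k = geometric-inverse ([]-weaken (s≤s z≤n) (order-^ order-Q (suc k)))

    open FiniteIdentities FPS Q q⁻¹ public

    r-product : ∀ n → ∏ n (λ k → 1# - Q ^ suc k) * r n ≈ 1#
    r-product zero = *-identityˡ 1#
    r-product (suc n) = trans
      (solve 4 (λ p a r b → (p :* a) :* (r :* b) := (p :* r) :* (b :* a)) refl _ _ _ _)
      (trans (*-cong (r-product n) (q⁻¹-inverse n)) (*-identityˡ 1#))

    r-limit : ∀ n → r n * E Q ≈[ suc n ] 1#
    r-limit n = []-trans ([]-* (≈⇒≈[] refl) ([]-sym (∏∞-truncate (E-multipliable order-Q) n)))
      (≈⇒≈[] (trans (*-comm _ _) (r-product n)))

    r∸-def : ∀ N k → k ℕ.≤ N → r∸ N k ≡ r (N ∸ k)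
    r∸-def N zero _ = ≡.refl
    r∸-def (suc N) (suc k) (s≤s k≤N) = r∸-def N k k≤N

    w-limit : ∀ N k → k ℕ.≤ N → w N k * (E Q * E Q) ≈[ N ∸ k ] 1#
    w-limit N k k≤N = []-trans
      (≈⇒≈[] (trans (*-congʳ (*-congʳ (reflexive (r∸-def N k k≤N))))
        (solve 3 (λ a b e → (a :* b) :* (e :* e) := (a :* e) :* (b :* e)) refl _ _ (E Q))))
      ([]-trans ([]-* ([]-weaken (ℕ.n≤1+n _) (r-limit (N ∸ k)))
          ([]-weaken (ℕ.≤-trans (ℕ.m∸n≤m N k) (ℕ.≤-trans (ℕ.m≤m+n N k) (ℕ.≤-trans (ℕ.n≤1+n _) (ℕ.n≤1+n _))))
            (r-limit (suc (N ℕ.+ k)))))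
        (≈⇒≈[] (*-identityˡ 1#)))

    -- Each weight times E(Q)² is 1 up to order N-k, so dominated convergence removes the weights.
    weighted-limit : ∀ {c} → Summable c → ∀ N →
      ∑ (suc N) (λ k → c k * w N k) * (E Q * E Q) ≈[ N ] ∑∞ c
    weighted-limit {c} s N = []-trans
      (≈⇒≈[] (trans (*-comm _ _) (trans (*-∑ (suc N) _ _)
        (∑-cong (suc N) λ k _ → solve 3 (λ e c w → e :* (c :* w) := c :* (w :* e)) refl _ _ _))))
      ([]-trans (∑∞-dominated s (λ N k → w N k * (E Q * E Q)) 1# w-limit N) (≈⇒≈[] (*-identityʳ _)))

    order-sgn-Q^ : ∀ {v} k → v ≈[ k ] 0# → sgn k * Q ^ tri k * v ≈[ k ] 0#
    order-sgn-Q^ k = order-*ʳ (sgn k * Q ^ tri k)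

    jacobiFactor-multipliable : ∀ {κ} → κ ≈[ 1 ] 0# → Multipliable (jacobiFactor κ)
    jacobiFactor-multipliable {κ} p i = []-trans
      ([]-+ ([]-+ (≈⇒≈[] refl) ([]-trans
          (≈⇒≈[] (solve 2 (λ p q → p :* p :* q :* q := q :* p :* (p :* q)) refl (Q ^ i) Q))
          (order-*ˡ _ (order-^ order-Q (suc i)))))
        (order-neg (order-*^ p order-Q i)))
      (≈⇒≈[] (solve 0 (con ℤ.1ℤ :+ con ℤ.0ℤ :+ con ℤ.0ℤ := con ℤ.1ℤ) refl))

    -- The limit of `finite-Jacobi`. Multiplication by E(Q)² clears the weights on the left; on the
    -- right one of the two factors cancels the inverse product and the other remains.
    Jacobi : ∀ (v : ℕ → PS) κ → κ ≈[ 1 ] 0# → (∀ k → v k ≈[ k ] 0#) →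
      κ * v 0 ≈ v 1 - Q * v 0 → (∀ k → κ * v (suc k) ≈ v (suc (suc k)) + Q * Q * v k) →
      ∑∞ (λ k → sgn k * Q ^ tri k * v k) ≈ ∏∞ (jacobiFactor κ) * v 0 * E Q
    Jacobi v κ order-κ order-v κ·v₀ κ·v₊ = []-limit λ N → []-trans
      ([]-sym (weighted-limit (λ k → order-sgn-Q^ k (order-v k)) N)) ([]-trans
      (≈⇒≈[] (begin
        ∑ (suc N) (λ k → sgn k * Q ^ tri k * v k * w N k) * (E Q * E Q)
          ≈⟨ *-congʳ (∑-cong (suc N) λ k _ → solve 4 (λ a b c d → a :* b :* c :* d := a :* b :* d :* c) refl _ _ _ _) ⟩
        JacobiSum v N * (E Q * E Q)
          ≈⟨ *-congʳ (finite-Jacobi q⁻¹-inverse v κ κ·v₀ κ·v₊ N) ⟩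
        r (suc (N ℕ.+ N)) * (∏ N (jacobiFactor κ) * v 0) * (E Q * E Q)
          ≈⟨ solve 4 (λ r p v e → r :* (p :* v) :* (e :* e) := (r :* e) :* (p :* v :* e)) refl _ _ _ _ ⟩
        r (suc (N ℕ.+ N)) * E Q * (∏ N (jacobiFactor κ) * v 0 * E Q) ∎))
      ([]-trans ([]-* ([]-weaken (ℕ.≤-trans (ℕ.m≤m+n N N) (ℕ.≤-trans (ℕ.n≤1+n _) (ℕ.n≤1+n _))) (r-limit (suc (N ℕ.+ N))))
          ([]-* ([]-* ([]-weaken (ℕ.n≤1+n N) (∏∞-truncate (jacobiFactor-multipliable order-κ) N)) (≈⇒≈[] refl)) (≈⇒≈[] refl)))
        (≈⇒≈[] (*-identityˡ _))))

    -- The bilateral terms k and -1-k are taken together. The product of the `jacobiFactor`s lacks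
    -- the factor 1 - β of `poch β Q`, which is supplied by v 0.
    triple-product : ∀ {α β} → α ≈[ 1 ] 0# → β ≈[ 1 ] 0# → α * β ≈ Q →
      ∑∞ (λ k → sgn k * Q ^ tri k * (α ^ k - Q ^ k * β ^ suc k)) ≈ poch α Q * poch β Q * E Q
    triple-product {α} {β} order-α order-β αβ≈Q = begin
      ∑∞ (λ k → sgn k * Q ^ tri k * (α ^ k - Q ^ k * β ^ suc k))
        ≈⟨ Jacobi (λ k → α ^ k - Q ^ k * β ^ suc k) (α + Q * β)
             (order-+ order-α (order-*ʳ Q order-β))
             (λ k → order-+ (order-^ order-α k) (order-neg (order-*ˡ _ (order-^ order-Q k))))
             v-start v-step ⟩
      ∏∞ (jacobiFactor (α + Q * β)) * (1# - 1# * (β * 1#)) * E Q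
        ≈⟨ *-congʳ (*-congʳ (trans (∏∞-cong factor)
             (∏∞-* (poch-multipliable order-α order-Q) (λ k → []-weaken (ℕ.n≤1+n _) (poch-multipliable order-β order-Q (suc k)))))) ⟩
      poch α Q * ∏∞ (λ k → 1# - β * Q ^ suc k) * (1# - 1# * (β * 1#)) * E Q
        ≈⟨ solve 4 (λ p s b e → p :* s :* (con ℤ.1ℤ :- con ℤ.1ℤ :* (b :* con ℤ.1ℤ)) :* e := p :* ((con ℤ.1ℤ :- b :* con ℤ.1ℤ) :* s) :* e) refl _ _ β _ ⟩
      poch α Q * ((1# - β * 1#) * ∏∞ (λ k → 1# - β * Q ^ suc k)) * E Q
        ≈⟨ *-congʳ (*-congˡ poch-head) ⟨
      poch α Q * poch β Q * E Q ∎
      where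
      poch-head : poch β Q ≈ (1# - β * 1#) * ∏∞ (λ k → 1# - β * Q ^ suc k)
      poch-head = []-limit λ N → []-trans
        ([]-weaken (ℕ.≤-trans (ℕ.n≤1+n N) (ℕ.n≤1+n _)) ([]-sym (∏∞-truncate (poch-multipliable order-β order-Q) (suc N))))
        ([]-trans (≈⇒≈[] (∏-head N _)) ([]-* (≈⇒≈[] refl) ([]-weaken (ℕ.n≤1+n N)
          (∏∞-truncate (λ k → []-weaken (ℕ.n≤1+n _) (poch-multipliable order-β order-Q (suc k))) N))))

      factor : ∀ i → jacobiFactor (α + Q * β) i ≈ (1# - α * Q ^ i) * (1# - β * Q ^ suc i)
      factor i = begin
        1# + Q ^ i * Q ^ i * Q * Q - (α + Q * β) * Q ^ i
          ≈⟨ +-congʳ (+-congˡ (*-congˡ αβ≈Q)) ⟨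
        1# + Q ^ i * Q ^ i * Q * (α * β) - (α + Q * β) * Q ^ i
          ≈⟨ solve 4 (λ q p a b → con ℤ.1ℤ :+ p :* p :* q :* (a :* b) :- (a :+ q :* b) :* p
               := (con ℤ.1ℤ :- a :* p) :* (con ℤ.1ℤ :- b :* (q :* p))) refl Q (Q ^ i) α β ⟩
        (1# - α * Q ^ i) * (1# - β * Q ^ suc i) ∎

      v-start : (α + Q * β) * (1# - 1# * (β * 1#)) ≈ (α * 1# - Q * 1# * (β * (β * 1#))) - Q * (1# - 1# * (β * 1#))
      v-start = begin
        (α + Q * β) * (1# - 1# * (β * 1#))
          ≈⟨ solve 3 (λ q a b → (a :+ q :* b) :* (con ℤ.1ℤ :- con ℤ.1ℤ :* (b :* con ℤ.1ℤ)) := a :- a :* b :+ q :* b :- q :* b :* b) refl Q α β ⟩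
        α - α * β + Q * β - Q * β * β
          ≈⟨ +-congʳ (+-congʳ (+-congˡ (-‿cong αβ≈Q))) ⟩
        α - Q + Q * β - Q * β * β
          ≈⟨ solve 3 (λ q a b → a :- q :+ q :* b :- q :* b :* b := (a :* con ℤ.1ℤ :- q :* con ℤ.1ℤ :* (b :* (b :* con ℤ.1ℤ))) :- q :* (con ℤ.1ℤ :- con ℤ.1ℤ :* (b :* con ℤ.1ℤ))) refl Q α β ⟩
        (α * 1# - Q * 1# * (β * (β * 1#))) - Q * (1# - 1# * (β * 1#)) ∎

      v-step : ∀ k → (α + Q * β) * (α * α ^ k - Q * Q ^ k * (β * (β * β ^ k)))
        ≈ (α * (α * α ^ k) - Q * (Q * Q ^ k) * (β * (β * (β * β ^ k)))) + Q * Q * (α ^ k - Q ^ k * (β * β ^ k))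
      v-step k = begin
        (α + Q * β) * (α * a - Q * p * (β * (β * b)))
          ≈⟨ solve 6 (λ q α β a b p → (α :+ q :* β) :* (α :* a :- q :* p :* (β :* (β :* b)))
               := (α :* (α :* a) :- q :* (q :* p) :* (β :* (β :* (β :* b)))) :+ (α :* β) :* q :* (a :- p :* (β :* b))) refl Q α β a b p ⟩
        (α * (α * a) - Q * (Q * p) * (β * (β * (β * b)))) + α * β * Q * (a - p * (β * b))
          ≈⟨ +-congˡ (*-congʳ (*-congʳ αβ≈Q)) ⟩
        (α * (α * a) - Q * (Q * p) * (β * (β * (β * b)))) + Q * Q * (a - p * (β * b)) ∎
        where
        a = α ^ k
        b = β ^ k
        p = Q ^ k

    -- The degenerate choice κ = 2Q makes each `jacobiFactor` the square (1 - Q^(i+1))², which gives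
    -- two of the three factors E(Q).
    Jacobi-cube : ∑∞ (λ k → sgn k * Q ^ tri k * (Q ^ k * odd k)) ≈ E Q * E Q * E Q
    Jacobi-cube = begin
      ∑∞ (λ k → sgn k * Q ^ tri k * (Q ^ k * odd k))
        ≈⟨ Jacobi (λ k → Q ^ k * odd k) (Q + Q) (order-+ order-Q order-Q) (λ k → order-*ˡ _ (order-^ order-Q k))
             (solve 1 (λ q → let o = con ℤ.1ℤ in (q :+ q) :* (o :* o) := q :* o :* (o :+ (o :+ o)) :- q :* (o :* o)) refl Q)
             (λ k → solve 3 (λ q p n → let o = con ℤ.1ℤ in (q :+ q) :* (q :* p :* (n :+ (o :+ o)))
               := q :* (q :* p) :* ((n :+ (o :+ o)) :+ (o :+ o)) :+ q :* q :* (p :* n)) refl Q (Q ^ k) (odd k)) ⟩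
      ∏∞ (jacobiFactor (Q + Q)) * (1# * 1#) * E Q
        ≈⟨ *-congʳ (*-cong (trans (∏∞-cong (λ i → solve 2 (λ q p → con ℤ.1ℤ :+ p :* p :* q :* q :- (q :+ q) :* p
             := (con ℤ.1ℤ :- q :* p) :* (con ℤ.1ℤ :- q :* p)) refl Q (Q ^ i)))
             (∏∞-* (E-multipliable order-Q) (E-multipliable order-Q))) (*-identityˡ 1#)) ⟩
      E Q * E Q * 1# * E Q ≈⟨ *-congʳ (*-identityʳ _) ⟩
      E Q * E Q * E Q ∎

-- Durfee's identity and Appell sums

module AppellSums (R : CommutativeRing 0ℓ 0ℓ) where
  open PowerSeries R
  open CommutativeRing FPS
  open Exp commutativeSemiring using (_^_; ^-homo-*; ^-congʳ)
  open IntegerSolver FPS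
  open FiniteSums FPS
  open Limits R
  open EulerProducts R
  open import Relation.Binary.Reasoning.Setoid setoid

  module Durfee {Q : PS} (order-Q : Q ≈[ 1 ] 0#) where
    open Base order-Q

    private
      term : ℕ → ℕ → PS
      term m j = Q ^ (j ℕ.* (j ℕ.+ m)) * r j * r (j ℕ.+ m)

      j≤j² : ∀ j m → j ℕ.≤ j ℕ.* (j ℕ.+ m)
      j≤j² zero m = z≤n
      j≤j² (suc j) m = ℕ.m≤m*n (suc j) (suc j ℕ.+ m)

      term-summable : ∀ m → Summable (term m)
      term-summable m j = order-*ˡ _ (order-*ˡ _ ([]-weaken (j≤j² j m) (order-^ order-Q _)))

    -- The generating function of partitions cut by Durfee rectangles of size j by j+m, hence 1 /
    -- (Q;Q)_∞ for every m.
    durfee : ℕ → PS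
    durfee m = ∑∞ (term m)

    private
      Δ : ℕ → PS
      Δ m = durfee m - durfee (suc m)

      ∑∞-sub : ∀ f g → ∑∞ (λ k → f k - g k) ≈ ∑∞ f - ∑∞ g
      ∑∞-sub f g = trans (∑∞-+ f (λ k → - g k)) (+-congˡ (∑∞-neg g))

      -- Iterating this raises the order of Δ m beyond every bound.
      Δ-recurrence : ∀ m → Δ m ≈ - (Q ^ suc m * Δ (suc m))
      Δ-recurrence m = begin
        durfee m - durfee (suc m)                          ≈⟨ ∑∞-sub (term m) (term (suc m)) ⟨
        ∑∞ (λ j → term m j - term (suc m) j)               ≈⟨ ∑∞-cong first ⟩
        ∑∞ (λ j → u j - t j)                               ≈⟨ ∑∞-sub u t ⟩
        ∑∞ u - ∑∞ t                                        ≈⟨ +-congʳ (trans (∑∞-head u-summable) (trans (+-congʳ u₀) (+-identityˡ _))) ⟩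
        ∑∞ (u ∘ suc) - ∑∞ t                                ≈⟨ ∑∞-sub (u ∘ suc) t ⟨
        ∑∞ (λ j → u (suc j) - t j)                         ≈⟨ ∑∞-cong second ⟩
        ∑∞ (λ j → - (Q ^ suc m * (term (suc m) j - term (suc (suc m)) j)))   ≈⟨ ∑∞-neg _ ⟩
        - ∑∞ (λ j → Q ^ suc m * (term (suc m) j - term (suc (suc m)) j))
          ≈⟨ -‿cong (*-∑∞ (Q ^ suc m) (λ j → order-+ (term-summable (suc m) j) (order-neg (term-summable (suc (suc m)) j)))) ⟨
        - (Q ^ suc m * ∑∞ (λ j → term (suc m) j - term (suc (suc m)) j))
          ≈⟨ -‿cong (*-congˡ (∑∞-sub (term (suc m)) (term (suc (suc m))))) ⟩
        - (Q ^ suc m * Δ (suc m)) ∎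
        where
        -- The difference of the two terms is split so that, after the shift j → j+1 in `u`, its
        -- factor 1 - Q^j cancels the newest factor of the inverse product `r`.
        u t : ℕ → PS
        u j = Q ^ (j ℕ.* (j ℕ.+ m)) * r j * r (suc (j ℕ.+ m)) * (1# - Q ^ j)
        t j = Q ^ (j ℕ.* (j ℕ.+ m)) * r j * r (suc (j ℕ.+ m)) * Q ^ suc (j ℕ.+ m)

        u-summable : Summable u
        u-summable j = order-*ˡ _ (order-*ˡ _ (order-*ˡ _ ([]-weaken (j≤j² j m) (order-^ order-Q _))))

        u₀ : u 0 ≈ 0#
        u₀ = trans (*-congˡ (-‿inverseʳ 1#)) (zeroʳ _)

        Q^-split : ∀ {e} a b → e ≡ a ℕ.+ b → Q ^ e ≈ Q ^ a * Q ^ b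
        Q^-split a b eq = trans (^-congʳ Q eq) (^-homo-* Q a b)

        first : ∀ j → term m j - term (suc m) j ≈ u j - t j
        first j = begin
          P * r j * r (j ℕ.+ m) - Q ^ (j ℕ.* (j ℕ.+ suc m)) * r j * r (j ℕ.+ suc m)
            ≈⟨ +-cong (*-congˡ (r-step q⁻¹-inverse (j ℕ.+ m))) (-‿cong (*-cong (*-congʳ
                 (Q^-split (j ℕ.* (j ℕ.+ m)) j (e₁ j m))) (reflexive (≡.cong r (ℕ.+-suc j m))))) ⟩
          P * r j * ((1# - Q ^ suc (j ℕ.+ m)) * ρ) - P * Q ^ j * r j * ρ
            ≈⟨ solve 5 (λ p a x y z → p :* a :* ((con ℤ.1ℤ :- x) :* y) :- p :* z :* a :* y
                 := p :* a :* y :* (con ℤ.1ℤ :- z) :- p :* a :* y :* x) refl P (r j) _ ρ (Q ^ j) ⟩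
          u j - t j ∎
          where
          P = Q ^ (j ℕ.* (j ℕ.+ m))
          ρ = r (suc (j ℕ.+ m))
          e₁ : ∀ j m → j ℕ.* (j ℕ.+ suc m) ≡ j ℕ.* (j ℕ.+ m) ℕ.+ j
          e₁ = solve-∀

        second : ∀ j → u (suc j) - t j ≈ - (Q ^ suc m * (term (suc m) j - term (suc (suc m)) j))
        second j = begin
          Q ^ (suc j ℕ.* (suc j ℕ.+ m)) * (r j * q⁻¹ j) * r (suc (suc (j ℕ.+ m))) * (1# - Q ^ suc j)
            - Q ^ (j ℕ.* (j ℕ.+ m)) * r j * r (suc (j ℕ.+ m)) * Q ^ suc (j ℕ.+ m)
            ≈⟨ +-cong (*-congʳ (*-congʳ (*-congʳ (trans (Q^-split (j ℕ.* (j ℕ.+ suc m)) (suc (j ℕ.+ m)) (e₂ j m))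
                   (*-congˡ (Q^-split j (suc m) (≡.sym (ℕ.+-suc j m)))))))) (-‿cong (begin
                 Q ^ (j ℕ.* (j ℕ.+ m)) * r j * r (suc (j ℕ.+ m)) * Q ^ suc (j ℕ.+ m)
                   ≈⟨ *-cong (*-congˡ (r-step q⁻¹-inverse (suc (j ℕ.+ m)))) (Q^-split j (suc m) (≡.sym (ℕ.+-suc j m))) ⟩
                 Q ^ (j ℕ.* (j ℕ.+ m)) * r j * ((1# - Q ^ suc (suc (j ℕ.+ m))) * ρ) * (q * M)
                   ≈⟨ solve 6 (λ p a x ρ q M → p :* a :* (x :* ρ) :* (q :* M) := (p :* q) :* a :* (x :* ρ) :* M) refl _ _ _ _ _ _ ⟩
                 (Q ^ (j ℕ.* (j ℕ.+ m)) * q) * r j * ((1# - Q ^ suc (suc (j ℕ.+ m))) * ρ) * M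
                   ≈⟨ *-congʳ (*-congʳ (*-congʳ (sym (Q^-split (j ℕ.* (j ℕ.+ m)) j (e₁ j m))))) ⟩
                 P * r j * ((1# - Q ^ suc (suc (j ℕ.+ m))) * ρ) * M ∎)) ⟩
          P * (q * M) * (r j * q⁻¹ j) * ρ * (1# - Q ^ suc j) - P * r j * ((1# - Q ^ suc (suc (j ℕ.+ m))) * ρ) * M
            ≈⟨ solve 8 (λ P q M a i ρ y x → P :* (q :* M) :* (a :* i) :* ρ :* y :- P :* a :* (x :* ρ) :* M
                 := P :* (q :* M) :* a :* ρ :* (i :* y) :- P :* a :* (x :* ρ) :* M) refl P q M _ _ ρ _ _ ⟩
          P * (q * M) * r j * ρ * (q⁻¹ j * (1# - Q ^ suc j)) - P * r j * ((1# - Q ^ suc (suc (j ℕ.+ m))) * ρ) * M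
            ≈⟨ +-congʳ (*-congˡ (q⁻¹-inverse j)) ⟩
          P * (q * M) * r j * ρ * 1# - P * r j * ((1# - Q ^ suc (suc (j ℕ.+ m))) * ρ) * M
            ≈⟨ solve 6 (λ P q M a ρ x → P :* (q :* M) :* a :* ρ :* con ℤ.1ℤ :- P :* a :* (x :* ρ) :* M
                 := :- (M :* (P :* a :* (x :* ρ) :- (P :* q) :* a :* ρ))) refl P q M _ ρ _ ⟩
          - (M * (P * r j * ((1# - Q ^ suc (suc (j ℕ.+ m))) * ρ) - P * q * r j * ρ))
            ≈⟨ -‿cong (*-congˡ (+-cong (*-congˡ (trans (sym (r-step q⁻¹-inverse (suc (j ℕ.+ m)))) (reflexive (≡.cong r (≡.sym (ℕ.+-suc j m))))))
                 (-‿cong (*-cong (*-congʳ (sym (Q^-split (j ℕ.* (j ℕ.+ suc m)) j (e₁ j (suc m)))))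
                   (reflexive (≡.cong r (e₃ j m))))))) ⟩
          - (M * (term (suc m) j - term (suc (suc m)) j)) ∎
          where
          P = Q ^ (j ℕ.* (j ℕ.+ suc m))
          q = Q ^ j
          M = Q ^ suc m
          ρ = r (suc (suc (j ℕ.+ m)))
          e₁ : ∀ j m → j ℕ.* (j ℕ.+ suc m) ≡ j ℕ.* (j ℕ.+ m) ℕ.+ j
          e₁ = solve-∀
          e₂ : ∀ j m → suc j ℕ.* (suc j ℕ.+ m) ≡ j ℕ.* (j ℕ.+ suc m) ℕ.+ suc (j ℕ.+ m)
          e₂ = solve-∀
          e₃ : ∀ j m → suc (suc (j ℕ.+ m)) ≡ j ℕ.+ suc (suc m)
          e₃ = solve-∀

      Δ-order : ∀ n m → Δ m ≈[ n ] 0#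
      Δ-order zero m = below λ _ ()
      Δ-order (suc n) m = []-trans (≈⇒≈[] (Δ-recurrence m)) (order-neg
        (order-* ([]-weaken (s≤s z≤n) (order-^ order-Q (suc m))) (Δ-order n (suc m))))

      durfee-0 : ∀ m → durfee m ≈ durfee 0
      durfee-0 zero = refl
      durfee-0 (suc m) = trans (sym ([]-limit λ N → []-unsub (Δ-order N m))) (durfee-0 m)

      durfee-order : ∀ m → durfee m * E Q ≈[ m ] 1#
      durfee-order m = []-trans ([]-* ([]-trans (≈⇒≈[] (∑∞-head (term-summable m)))
          ([]-trans ([]-+ (≈⇒≈[] (trans (*-congʳ (*-identityˡ 1#)) (*-identityˡ _)))
            ([]-trans ([]-sym (∑∞-truncate (λ j → Summable-suc (term-summable m) j) m)) (order-∑ m λ j _ →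
              order-*ˡ _ (order-*ˡ _ ([]-weaken (m≤ j) (order-^ order-Q _))))))
            (≈⇒≈[] (+-identityʳ _)))) (≈⇒≈[] refl))
        ([]-weaken (ℕ.n≤1+n m) (r-limit m))
        where
        m≤ : ∀ j → m ℕ.≤ suc j ℕ.* (suc j ℕ.+ m)
        m≤ j = ℕ.≤-trans (ℕ.m≤n+m m (suc j)) (ℕ.m≤m+n _ _)

    -- The value does not depend on m because all Δ vanish; for large m only the term j = 0 counts
    -- to order m, and it tends to 1 / E(Q).
    durfee-E : ∀ m → durfee m * E Q ≈ 1#
    durfee-E m = []-limit λ N → []-trans (≈⇒≈[] (*-congʳ (trans (durfee-0 m) (sym (durfee-0 N))))) (durfee-order N)

  module Appell {Q α β : PS} (order-Q : Q ≈[ 1 ] 0#) (order-α : α ≈[ 1 ] 0#) (order-β : β ≈[ 1 ] 0#)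
    (αβ≈Q : α * β ≈ Q) where
    open Base order-Q
    open Durfee order-Q

    D⁻¹ : ℕ → PS
    D⁻¹ k = geometric (α * Q ^ k) * geometric (β * Q ^ k)

    -- The terms of the partial fraction expansion without their weights, that is, in the limit up
    -- to the factor E(Q)².
    c : ℕ → PS
    c k = sgn k * Q ^ tri k * Q ^ k * (1# - Q ^ k * Q ^ k * Q) * D⁻¹ k

    private
      D-factor : ∀ k → D q⁻¹-inverse (α + β) D⁻¹ k ≈ (1# - α * Q ^ k) * (1# - β * Q ^ k)
      D-factor k = trans (+-congʳ (+-congˡ (*-congˡ (sym αβ≈Q))))
        (solve 3 (λ a b q → con ℤ.1ℤ :+ q :* q :* (a :* b) :- (a :+ b) :* q := (con ℤ.1ℤ :- a :* q) :* (con ℤ.1ℤ :- b :* q)) refl α β _)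

      D-inverse : ∀ k → D⁻¹ k * D q⁻¹-inverse (α + β) D⁻¹ k ≈ 1#
      D-inverse k = begin
        D⁻¹ k * D q⁻¹-inverse (α + β) D⁻¹ k    ≈⟨ *-congˡ (D-factor k) ⟩
        geometric a * geometric b * ((1# - a) * (1# - b))
          ≈⟨ solve 4 (λ a b c d → a :* b :* (c :* d) := (a :* c) :* (b :* d)) refl _ _ _ _ ⟩
        geometric a * (1# - a) * (geometric b * (1# - b))
          ≈⟨ *-cong (geometric-inverse ([]-weaken (s≤s z≤n) (order-*^ order-α order-Q k)))
               (geometric-inverse ([]-weaken (s≤s z≤n) (order-*^ order-β order-Q k))) ⟩
        1# * 1#                                ≈⟨ *-identityˡ 1# ⟩
        1#                                     ∎
        where
        a = α * Q ^ k
        b = β * Q ^ k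

      c-summable : Summable c
      c-summable k = order-*ˡ _ (order-*ˡ _ (order-*ʳ _ (order-^ order-Q k)))

      P : ℕ → PS
      P = partialFractions q⁻¹-inverse (α + β) D⁻¹

      P-def : ∀ N → P N ≈ ∑ (suc N) (λ k → c k * w N k)
      P-def N = ∑-cong (suc N) λ k _ → solve 6 (λ a b c d e f → a :* b :* c :* d :* e :* f := a :* b :* c :* d :* f :* e) refl _ _ _ _ _ _

    appell : PS
    appell = ∑∞ c

    -- The limit of `partialFractions-product`: the reciprocal of a product of theta type as an
    -- Appell sum.
    appell-product : poch α Q * poch β Q * appell ≈ E Q * E Q
    appell-product = begin
      poch α Q * poch β Q * appell
        ≈⟨ *-congʳ (∏∞-* (poch-multipliable order-α order-Q) (poch-multipliable order-β order-Q)) ⟨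
      ∏∞ d * appell
        ≈⟨ []-limit (λ N → []-trans ([]-* ([]-weaken (ℕ.≤-trans (ℕ.n≤1+n N) (ℕ.n≤1+n _)) ([]-sym (∏∞-truncate
             (Multipliable-* (poch-multipliable order-α order-Q) (poch-multipliable order-β order-Q)) (suc N))))
             ([]-sym (weighted-limit c-summable N))) (≈⇒≈[] (product N))) ⟩
      E Q * E Q ∎
      where
      d : ℕ → PS
      d k = (1# - α * Q ^ k) * (1# - β * Q ^ k)

      product : ∀ N → ∏ (suc N) d * (∑ (suc N) (λ k → c k * w N k) * (E Q * E Q)) ≈ E Q * E Q
      product N = begin
        ∏ (suc N) d * (∑ (suc N) (λ k → c k * w N k) * (E Q * E Q))
          ≈⟨ *-cong (∏-cong (suc N) D-factor) (*-congʳ (P-def N)) ⟨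
        ∏ (suc N) (D q⁻¹-inverse (α + β) D⁻¹) * (P N * (E Q * E Q))
          ≈⟨ *-assoc _ _ _ ⟨
        ∏ (suc N) (D q⁻¹-inverse (α + β) D⁻¹) * P N * (E Q * E Q)
          ≈⟨ *-congʳ (partialFractions-product q⁻¹-inverse (α + β) D⁻¹ D-inverse N) ⟩
        1# * (E Q * E Q) ≈⟨ *-identityˡ _ ⟩
        E Q * E Q ∎

    -- Each p N is expanded in partial fractions and the sums are exchanged. Terms with N < k
    -- vanish, and with N = k + j the sum over j is the Durfee series for m = 2k+1, which E(Q)
    -- cancels.
    mock-appell : ∀ (p : ℕ → PS) →
      (∀ N → ∏ (suc N) (λ k → (1# - α * Q ^ k) * (1# - β * Q ^ k)) * p N ≈ 1#) →
      E Q * ∑∞ (λ N → Q ^ (N ℕ.* suc N) * p N) ≈ ∑∞ (λ k → Q ^ (k ℕ.* suc k) * c k)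
    mock-appell p p-inverse = begin
      E Q * ∑∞ (λ N → Q ^ (N ℕ.* suc N) * p N)
        ≈⟨ *-congˡ (∑∞-cong λ N → *-congˡ (trans (p≈P N) (P-sum N))) ⟩
      E Q * ∑∞ (λ N → Q ^ (N ℕ.* suc N) * ∑∞ (λ k → c k * w N k))
        ≈⟨ *-congˡ (∑∞-cong λ N → *-∑∞ _ (λ k → order-*ˡ _ (c-summable k))) ⟩
      E Q * ∑∞ (λ N → ∑∞ (λ k → Q ^ (N ℕ.* suc N) * (c k * w N k)))
        ≈⟨ *-congˡ (∑∞-swap _) ⟩
      E Q * ∑∞ (λ k → ∑∞ (λ N → Q ^ (N ℕ.* suc N) * (c k * w N k)))
        ≈⟨ *-congˡ (∑∞-cong inner) ⟩
      E Q * ∑∞ (λ k → Q ^ (k ℕ.* suc k) * c k * durfee (suc (k ℕ.+ k)))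
        ≈⟨ *-∑∞ (E Q) (λ k → order-*ˡ _ (order-*ʳ _ (c-summable k))) ⟩
      ∑∞ (λ k → E Q * (Q ^ (k ℕ.* suc k) * c k * durfee (suc (k ℕ.+ k))))
        ≈⟨ ∑∞-cong (λ k → trans (trans (*-comm _ _) (*-assoc _ _ _))
             (trans (*-congˡ (durfee-E (suc (k ℕ.+ k)))) (*-identityʳ _))) ⟩
      ∑∞ (λ k → Q ^ (k ℕ.* suc k) * c k) ∎
      where
      p≈P : ∀ N → p N ≈ P N
      p≈P N = begin
        p N                                       ≈⟨ *-identityʳ _ ⟨
        p N * 1#                                  ≈⟨ *-congˡ (partialFractions-product q⁻¹-inverse (α + β) D⁻¹ D-inverse N) ⟨
        p N * (∏ (suc N) (D q⁻¹-inverse (α + β) D⁻¹) * P N)   ≈⟨ *-congˡ (*-congʳ (∏-cong (suc N) D-factor)) ⟩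
        p N * (∏ (suc N) _ * P N)                 ≈⟨ solve 3 (λ a b c → a :* (b :* c) := (b :* a) :* c) refl _ _ _ ⟩
        ∏ (suc N) _ * p N * P N                   ≈⟨ *-congʳ (p-inverse N) ⟩
        1# * P N                                  ≈⟨ *-identityˡ _ ⟩
        P N                                       ∎

      w-zero : ∀ N k → N ℕ.< k → w N k ≈ 0#
      w-zero N k N<k = trans (reflexive (≡.cong (w N) (≡.trans (≡.sym (ℕ.m+[n∸m]≡n N<k)) ≡.refl))) (w-above N (k ∸ suc N))

      P-sum : ∀ N → P N ≈ ∑∞ (λ k → c k * w N k)
      P-sum N = trans (P-def N) (∑∞-finite (suc N) (λ k → order-*ˡ _ (c-summable k))
        λ k N<k → trans (*-congˡ (w-zero N k N<k)) (zeroʳ _))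

      N≤N² : ∀ N → N ℕ.≤ N ℕ.* suc N
      N≤N² N = ℕ.m≤m*n N (suc N)

      inner : ∀ k → ∑∞ (λ N → Q ^ (N ℕ.* suc N) * (c k * w N k))
        ≈ Q ^ (k ℕ.* suc k) * c k * durfee (suc (k ℕ.+ k))
      inner k = begin
        ∑∞ (λ N → Q ^ (N ℕ.* suc N) * (c k * w N k))
          ≈⟨ ∑∞-drop k (λ N → order-*ˡ _ ([]-weaken (N≤N² N) (order-^ order-Q _)))
               (λ N N<k → trans (*-congˡ (trans (*-congˡ (w-zero N k N<k)) (zeroʳ _))) (zeroʳ _)) ⟩
        ∑∞ (λ j → Q ^ ((k ℕ.+ j) ℕ.* suc (k ℕ.+ j)) * (c k * w (k ℕ.+ j) k))
          ≈⟨ ∑∞-cong term ⟩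
        ∑∞ (λ j → Q ^ (k ℕ.* suc k) * c k * (Q ^ (j ℕ.* (j ℕ.+ suc (k ℕ.+ k))) * r j * r (j ℕ.+ suc (k ℕ.+ k))))
          ≈⟨ *-∑∞ _ (λ j → order-*ˡ _ (order-*ˡ _ ([]-weaken (ℕ.≤-trans (N≤N² j) (ℕ.*-monoʳ-≤ j (suc≤ j)))
               (order-^ order-Q _)))) ⟨
        Q ^ (k ℕ.* suc k) * c k * durfee (suc (k ℕ.+ k)) ∎
        where
        suc≤ : ∀ j → suc j ℕ.≤ j ℕ.+ suc (k ℕ.+ k)
        suc≤ j = ≡.subst (suc j ℕ.≤_) (≡.sym (ℕ.+-suc j (k ℕ.+ k))) (s≤s (ℕ.m≤m+n j (k ℕ.+ k)))

        e₁ : ∀ k j → (k ℕ.+ j) ℕ.* suc (k ℕ.+ j) ≡ k ℕ.* suc k ℕ.+ j ℕ.* (j ℕ.+ suc (k ℕ.+ k))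
        e₁ = solve-∀

        e₂ : ∀ k j → suc (k ℕ.+ j ℕ.+ k) ≡ j ℕ.+ suc (k ℕ.+ k)
        e₂ = solve-∀

        term : ∀ j → Q ^ ((k ℕ.+ j) ℕ.* suc (k ℕ.+ j)) * (c k * w (k ℕ.+ j) k)
          ≈ Q ^ (k ℕ.* suc k) * c k * (Q ^ (j ℕ.* (j ℕ.+ suc (k ℕ.+ k))) * r j * r (j ℕ.+ suc (k ℕ.+ k)))
        term j = trans (*-cong (trans (^-congʳ Q (e₁ k j)) (^-homo-* Q (k ℕ.* suc k) _))
            (*-congˡ (*-cong (reflexive (≡.trans (r∸-def (k ℕ.+ j) k (ℕ.m≤m+n k j)) (≡.cong r (ℕ.m+n∸m≡n k j))))
              (reflexive (≡.cong r (e₂ k j))))))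
          (solve 5 (λ a b c d e → (a :* b) :* (c :* (d :* e)) := a :* c :* (b :* d :* e)) refl _ _ _ _ _)

-- Lower bounds for quadratic exponents, which ensure summability over the integers

≤-witness : ∀ {a e} w → ℤ.0ℤ ℤ.≤ w → e ≡ a ℤ.+ w → a ℤ.≤ e
≤-witness {a} w 0≤w ≡.refl = ℤ.≤-trans (ℤ.≤-reflexive (≡.sym (ℤ.+-identityʳ a))) (ℤ.+-monoʳ-≤ a 0≤w)

0≤pos : ∀ {n} → ℤ.0ℤ ℤ.≤ pos n
0≤pos = ℤ.+≤+ z≤n

0≤+ : ∀ {a b} → ℤ.0ℤ ℤ.≤ a → ℤ.0ℤ ℤ.≤ b → ℤ.0ℤ ℤ.≤ a ℤ.+ b
0≤+ = ℤ.+-mono-≤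

0≤* : ∀ {a b} → ℤ.0ℤ ℤ.≤ a → ℤ.0ℤ ℤ.≤ b → ℤ.0ℤ ℤ.≤ a ℤ.* b
0≤* {pos m} {pos n} _ _ = ≡.subst (ℤ.0ℤ ℤ.≤_) (ℤ.pos-* m n) (0≤pos {m ℕ.* n})

module QuadraticBounds where
  open import Data.Integer.Base using (_+_; _*_; _-_; _≤_; -_)

  private
    0≤quadratic : ∀ a b c {M} → pos 0 ≤ M → pos 0 ≤ pos a * (M * M) + pos b * M + pos c
    0≤quadratic a b c 0≤M = 0≤+ (0≤+ (0≤* (0≤pos {a}) (0≤* 0≤M 0≤M)) (0≤* (0≤pos {b}) 0≤M)) (0≤pos {c})

    -- Writing a nonzero u as 1+M or -(1+M) removes the absolute value; the excess of the exponent
    -- is then a polynomial in M with nonnegative coefficients.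
    by-cases : (P : ℤ → ℤ → Set) → P (pos 0) (pos 0) →
      (∀ M → pos 0 ≤ M → P (pos 1 + M) (pos 1 + M)) → (∀ M → pos 0 ≤ M → P (- (pos 1 + M)) (pos 1 + M)) →
      ∀ u → P u (pos ∣ u ∣)
    by-cases P p₀ p₊ p₋ (pos zero) = p₀
    by-cases P p₀ p₊ p₋ (pos (suc m)) = p₊ (pos m) 0≤pos
    by-cases P p₀ p₊ p₋ -[1+ m ] = p₋ (pos m) 0≤pos

  ∣∣≤3u²-u : ∀ u → pos ∣ u ∣ ≤ pos 3 * (u * u) - u
  ∣∣≤3u²-u = by-cases (λ u v → v ≤ pos 3 * (u * u) - u) ℤ.≤-refl
    (λ M 0≤M → ≤-witness _ (0≤quadratic 3 4 1 0≤M) (eq₊ M))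
    (λ M 0≤M → ≤-witness _ (0≤quadratic 3 6 3 0≤M) (eq₋ M))
    where
    eq₊ : ∀ M → pos 3 * ((pos 1 + M) * (pos 1 + M)) - (pos 1 + M) ≡ (pos 1 + M) + (pos 3 * (M * M) + pos 4 * M + pos 1)
    eq₊ = ℤ-solve-∀
    eq₋ : ∀ M → pos 3 * ((- (pos 1 + M)) * (- (pos 1 + M))) - (- (pos 1 + M)) ≡ (pos 1 + M) + (pos 3 * (M * M) + pos 6 * M + pos 3)
    eq₋ = ℤ-solve-∀

  ∣∣≤3u²+u : ∀ u → pos ∣ u ∣ ≤ pos 3 * (u * u) + u
  ∣∣≤3u²+u u = ℤ.≤-trans (ℤ.≤-reflexive (≡.cong pos (≡.sym (ℤ.∣-i∣≡∣i∣ u))))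
    (ℤ.≤-trans (∣∣≤3u²-u (- u)) (ℤ.≤-reflexive (eq u)))
    where
    eq : ∀ u → pos 3 * (- u * - u) - - u ≡ pos 3 * (u * u) + u
    eq = ℤ-solve-∀

  ∣∣≤3u²-2u : ∀ u → pos ∣ u ∣ ≤ pos 3 * (u * u) - pos 2 * u
  ∣∣≤3u²-2u = by-cases (λ u v → v ≤ pos 3 * (u * u) - pos 2 * u) ℤ.≤-refl
    (λ M 0≤M → ≤-witness _ (0≤quadratic 3 3 0 0≤M) (eq₊ M))
    (λ M 0≤M → ≤-witness _ (0≤quadratic 3 7 4 0≤M) (eq₋ M))
    where
    eq₊ : ∀ M → pos 3 * ((pos 1 + M) * (pos 1 + M)) - pos 2 * (pos 1 + M) ≡ (pos 1 + M) + (pos 3 * (M * M) + pos 3 * M + pos 0)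
    eq₊ = ℤ-solve-∀
    eq₋ : ∀ M → pos 3 * ((- (pos 1 + M)) * (- (pos 1 + M))) - pos 2 * (- (pos 1 + M)) ≡ (pos 1 + M) + (pos 3 * (M * M) + pos 7 * M + pos 4)
    eq₋ = ℤ-solve-∀

  ∣∣≤3u²+3u+1 : ∀ u → pos ∣ u ∣ ≤ pos 3 * (u * u) + pos 3 * u + pos 1
  ∣∣≤3u²+3u+1 = by-cases (λ u v → v ≤ pos 3 * (u * u) + pos 3 * u + pos 1) (ℤ.+≤+ z≤n)
    (λ M 0≤M → ≤-witness _ (0≤quadratic 3 8 6 0≤M) (eq₊ M))
    (λ M 0≤M → ≤-witness _ (0≤quadratic 3 2 0 0≤M) (eq₋ M))
    where
    eq₊ : ∀ M → pos 3 * ((pos 1 + M) * (pos 1 + M)) + pos 3 * (pos 1 + M) + pos 1 ≡ (pos 1 + M) + (pos 3 * (M * M) + pos 8 * M + pos 6)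
    eq₊ = ℤ-solve-∀
    eq₋ : ∀ M → pos 3 * ((- (pos 1 + M)) * (- (pos 1 + M))) + pos 3 * (- (pos 1 + M)) + pos 1 ≡ (pos 1 + M) + (pos 3 * (M * M) + pos 2 * M + pos 0)
    eq₋ = ℤ-solve-∀

  ∣∣≤3u²-3u+1 : ∀ u → pos ∣ u ∣ ≤ pos 3 * (u * u) - pos 3 * u + pos 1
  ∣∣≤3u²-3u+1 u = ℤ.≤-trans (ℤ.≤-reflexive (≡.cong pos (≡.sym (ℤ.∣-i∣≡∣i∣ u))))
    (ℤ.≤-trans (∣∣≤3u²+3u+1 (- u)) (ℤ.≤-reflexive (eq u)))
    where
    eq : ∀ u → pos 3 * (- u * - u) + pos 3 * - u + pos 1 ≡ pos 3 * (u * u) - pos 3 * u + pos 1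
    eq = ℤ-solve-∀

  ∣∣≤3u² : ∀ u → pos ∣ u ∣ ≤ pos 3 * (u * u)
  ∣∣≤3u² = by-cases (λ u v → v ≤ pos 3 * (u * u)) ℤ.≤-refl
    (λ M 0≤M → ≤-witness _ (0≤quadratic 3 5 2 0≤M) (eq₊ M))
    (λ M 0≤M → ≤-witness _ (0≤quadratic 3 5 2 0≤M) (eq₋ M))
    where
    eq₊ : ∀ M → pos 3 * ((pos 1 + M) * (pos 1 + M)) ≡ (pos 1 + M) + (pos 3 * (M * M) + pos 5 * M + pos 2)
    eq₊ = ℤ-solve-∀
    eq₋ : ∀ M → pos 3 * ((- (pos 1 + M)) * (- (pos 1 + M))) ≡ (pos 1 + M) + (pos 3 * (M * M) + pos 5 * M + pos 2)
    eq₋ = ℤ-solve-∀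

  -- The triangle inequality for i = (j + i) - j: a bound at the shifted index survives the shift if
  -- the exponent has c to spare.
  shifted-bound : ∀ {i j n c q} → pos ∣ j + i ∣ ≤ q → ∣ j ∣ ℕ.≤ ∣ n ∣ → pos ∣ n ∣ ≤ c → pos ∣ i ∣ ≤ q + c
  shifted-bound {i} {j} bound j≤n n≤c = ℤ.≤-trans
    (ℤ.+≤+ (≡.subst (λ k → ∣ k ∣ ℕ.≤ ∣ j + i ∣ ℕ.+ ∣ j ∣) (eq i j) (ℤ.∣i-j∣≤∣i∣+∣j∣ (j + i) j)))
    (ℤ.+-mono-≤ bound (ℤ.≤-trans (ℤ.+≤+ j≤n) n≤c))
    where
    eq : ∀ i j → (j + i) - j ≡ i
    eq = ℤ-solve-∀

-- Shifts of bilateral sums, signs, and the quotients of Lambert series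

module Bilateral (R : CommutativeRing 0ℓ 0ℓ) where
  open PowerSeries R
  open CommutativeRing FPS
  open Exp commutativeSemiring using (_^_; ^-homo-*)
  open IntegerSolver FPS
  open FiniteSums FPS
  open Limits R
  open RingProperties ring using (-‿involutive; -‿distribˡ-*)
  open import Relation.Binary.Reasoning.Setoid setoid

  ∑ℤ-shiftℤ : ∀ n {f} → (∀ j → ∣ j ∣ ℕ.≤ ∣ n ∣ → Summableℤ (λ i → f (j ℤ.+ i))) →
    ∑ℤ (λ i → f (n ℤ.+ i)) ≈ ∑ℤ f
  ∑ℤ-shiftℤ (pos n) {f} s = ∑ℤ-shift n {f} λ j j≤n → s (pos j) j≤n
  ∑ℤ-shiftℤ -[1+ m ] {f} s = sym (begin
    ∑ℤ f
      ≈⟨ ∑ℤ-cong (λ i → reflexive (≡.cong f (≡.sym (cancel i)))) ⟩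
    ∑ℤ (λ i → g (pos (suc m) ℤ.+ i))
      ≈⟨ ∑ℤ-shift (suc m) {g} (λ j j≤ i → ≡.subst (λ k → f k ≈[ ∣ i ∣ ] 0#) (ℤ.+-assoc -[1+ m ] (pos j) i)
           (s (-[1+ m ] ℤ.+ pos j) (bound j j≤) i)) ⟩
    ∑ℤ g ∎)
    where
    g : ℤ → PS
    g i = f (-[1+ m ] ℤ.+ i)

    cancel : ∀ i → -[1+ m ] ℤ.+ (pos (suc m) ℤ.+ i) ≡ i
    cancel i = ≡.trans (≡.sym (ℤ.+-assoc -[1+ m ] (pos (suc m)) i))
      (≡.trans (≡.cong (ℤ._+ i) (ℤ.+-inverseˡ (pos (suc m)))) (ℤ.+-identityˡ i))

    bound : ∀ j → j ℕ.≤ suc m → ∣ -[1+ m ] ℤ.+ pos j ∣ ℕ.≤ suc m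
    bound j j≤ = ℕ.≤-trans (ℕ.≤-reflexive (≡.trans (ℤ.∣m⊖n∣≡∣n⊖m∣ j (suc m))
      (≡.cong ∣_∣ (ℤ.⊖-≥ j≤)))) (ℕ.m∸n≤m (suc m) j)

  sgnℤ : ℤ → PS
  sgnℤ i = sgn ∣ i ∣

  sgnℤ-suc : ∀ i → sgnℤ (ℤ.suc i) ≈ - sgnℤ i
  sgnℤ-suc (pos n) = refl
  sgnℤ-suc -[1+ zero ] = sym (-‿involutive 1#)
  sgnℤ-suc -[1+ suc m ] = sym (-‿involutive _)

  sgnℤ-+ : ∀ i j → sgnℤ (i ℤ.+ j) ≈ sgnℤ i * sgnℤ j
  sgnℤ-+ (pos m) j = go m
    where
    go : ∀ m → sgnℤ (pos m ℤ.+ j) ≈ sgn m * sgnℤ j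
    go zero = trans (reflexive (≡.cong sgnℤ (ℤ.+-identityˡ j))) (sym (*-identityˡ _))
    go (suc m) = begin
      sgnℤ (pos (suc m) ℤ.+ j)         ≡⟨ ≡.cong sgnℤ (ℤ.+-assoc (pos 1) (pos m) j) ⟩
      sgnℤ (ℤ.suc (pos m ℤ.+ j))       ≈⟨ sgnℤ-suc (pos m ℤ.+ j) ⟩
      - sgnℤ (pos m ℤ.+ j)             ≈⟨ -‿cong (go m) ⟩
      - (sgn m * sgnℤ j)               ≈⟨ -‿distribˡ-* _ _ ⟩
      - sgn m * sgnℤ j                 ∎
  sgnℤ-+ -[1+ m ] j = begin
    sgnℤ (-[1+ m ] ℤ.+ j)                    ≡⟨ ≡.cong sgn (ℤ.∣-i∣≡∣i∣ (-[1+ m ] ℤ.+ j)) ⟨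
    sgnℤ (ℤ.- (-[1+ m ] ℤ.+ j))              ≡⟨ ≡.cong sgnℤ (ℤ.neg-distrib-+ -[1+ m ] j) ⟩
    sgnℤ (pos (suc m) ℤ.+ ℤ.- j)             ≈⟨ sgnℤ-+ (pos (suc m)) (ℤ.- j) ⟩
    sgn (suc m) * sgnℤ (ℤ.- j)               ≡⟨ ≡.cong (λ k → sgn (suc m) * sgn k) (ℤ.∣-i∣≡∣i∣ j) ⟩
    sgn (suc m) * sgnℤ j                     ∎

  sgnℤ² : ∀ i → sgnℤ i * sgnℤ i ≈ 1#
  sgnℤ² i = go ∣ i ∣
    where
    go : ∀ n → sgn n * sgn n ≈ 1#
    go zero = *-identityˡ 1#
    go (suc n) = trans (solve 1 (λ a → (:- a) :* (:- a) := a :* a) refl _) (go n)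

  sgnℤ-neg : ∀ i → sgnℤ (ℤ.- i) ≈ sgnℤ i
  sgnℤ-neg i = reflexive (≡.cong sgn (ℤ.∣-i∣≡∣i∣ i))

  module Lambert {x : PS} (order-x : x ≈[ 1 ] 0#) where

    -- x^e for e ≥ 0; a junk value for e < 0.
    X : ℤ → PS
    X e = x ^ ∣ e ∣

    X-+ : ∀ {a b} → ℤ.0ℤ ℤ.≤ a → ℤ.0ℤ ℤ.≤ b → X (a ℤ.+ b) ≈ X a * X b
    X-+ {pos m} {pos n} _ _ = ^-homo-* x m n

    order-X : ∀ {k e} → pos k ℤ.≤ e → X e ≈[ k ] 0#
    order-X {k} {pos n} (ℤ.+≤+ k≤n) = []-weaken k≤n (order-^ order-x n)

    -- 6m+1 is the value of 6n+1 at n = m, and 6m+5 is minus its value at n = -1-m.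
    y⁺ y⁻ : ℕ → ℕ
    y⁺ m = 6 ℕ.* m ℕ.+ 1
    y⁻ m = 6 ℕ.* m ℕ.+ 5

    I J : ℕ → PS
    I m = geometric (x ^ y⁺ m)
    J m = geometric (x ^ y⁻ m)

    I-inverse : ∀ m → I m * (1# - x ^ y⁺ m) ≈ 1#
    I-inverse m = geometric-inverse ([]-weaken (ℕ.m≤n+m 1 (6 ℕ.* m)) (order-^ order-x (y⁺ m)))

    J-inverse : ∀ m → J m * (1# - x ^ y⁻ m) ≈ 1#
    J-inverse m = geometric-inverse ([]-weaken (ℕ.≤-trans (s≤s z≤n) (ℕ.m≤n+m 5 (6 ℕ.* m))) (order-^ order-x (y⁻ m)))

    -- quotient e n is x^e / (1 - x^(6n+1)), rewritten for n < 0 by multiplying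
    -- numerator and denominator by -x^(-6n-1); val e n is the exponent of the numerator.
    val : ℤ → ℤ → ℤ
    val e (pos m) = e
    val e -[1+ m ] = e ℤ.+ pos (y⁻ m)

    quotient : ℤ → ℤ → PS
    quotient e (pos m) = X e * I m
    quotient e -[1+ m ] = - (X (e ℤ.+ pos (y⁻ m)) * J m)

    y : ℤ → ℤ
    y n = pos 6 ℤ.* n ℤ.+ pos 1

    private
      y⁺≡ : ∀ m → y (pos m) ≡ pos (y⁺ m)
      y⁺≡ m = ≡.cong (ℤ._+ pos 1) (≡.sym (ℤ.pos-* 6 m))

      y⁻≡ : ∀ m → pos (y⁻ m) ≡ pos 6 ℤ.* pos m ℤ.+ pos 5
      y⁻≡ m = ≡.cong (ℤ._+ pos 5) (ℤ.pos-* 6 m)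

      y+y⁻ : ∀ e m → (e ℤ.+ y -[1+ m ]) ℤ.+ pos (y⁻ m) ≡ e
      y+y⁻ e m = ≡.trans (≡.cong (λ k → (e ℤ.+ y -[1+ m ]) ℤ.+ k) (y⁻≡ m)) (eq e (pos m))
        where
        eq : ∀ e M → (e ℤ.+ (pos 6 ℤ.* ℤ.- (pos 1 ℤ.+ M) ℤ.+ pos 1)) ℤ.+ (pos 6 ℤ.* M ℤ.+ pos 5) ≡ e
        eq = ℤ-solve-∀

    val-+ : ∀ a b n → val (a ℤ.+ b) n ≡ a ℤ.+ val b n
    val-+ a b (pos m) = ≡.refl
    val-+ a b -[1+ m ] = ℤ.+-assoc a b _

    quotient-* : ∀ {f e} n → ℤ.0ℤ ℤ.≤ f → ℤ.0ℤ ℤ.≤ val e n → X f * quotient e n ≈ quotient (f ℤ.+ e) n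
    quotient-* (pos m) 0≤f 0≤e = trans (sym (*-assoc _ _ _)) (*-congʳ (sym (X-+ 0≤f 0≤e)))
    quotient-* {f} {e} -[1+ m ] 0≤f 0≤e = begin
      X f * - (X (e ℤ.+ pos (y⁻ m)) * J m)     ≈⟨ solve 3 (λ a b c → a :* :- (b :* c) := :- (a :* b :* c)) refl _ _ _ ⟩
      - (X f * X (e ℤ.+ pos (y⁻ m)) * J m)     ≈⟨ -‿cong (*-congʳ (X-+ 0≤f 0≤e)) ⟨
      - (X (f ℤ.+ (e ℤ.+ pos (y⁻ m))) * J m)   ≡⟨ ≡.cong (λ k → - (X k * J m)) (ℤ.+-assoc f e _) ⟨
      - (X ((f ℤ.+ e) ℤ.+ pos (y⁻ m)) * J m)   ∎

    -- x^e / (1 - y) - x^e y / (1 - y) = x^e with y = x^(6n+1). In this way differences of Appell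
    -- sums lose their denominators and become theta series.
    quotient-step : ∀ {e} n → ℤ.0ℤ ℤ.≤ e → quotient e n - quotient (e ℤ.+ y n) n ≈ X e
    quotient-step {e} (pos m) 0≤e = begin
      X e * I m - X (e ℤ.+ y (pos m)) * I m     ≡⟨ ≡.cong (λ k → X e * I m - X (e ℤ.+ k) * I m) (y⁺≡ m) ⟩
      X e * I m - X (e ℤ.+ pos (y⁺ m)) * I m    ≈⟨ +-congˡ (-‿cong (*-congʳ (X-+ {e} {pos (y⁺ m)} 0≤e 0≤pos))) ⟩
      X e * I m - X e * x ^ y⁺ m * I m          ≈⟨ solve 3 (λ a i y → a :* i :- a :* y :* i := a :* (i :* (con ℤ.1ℤ :- y))) refl _ _ _ ⟩
      X e * (I m * (1# - x ^ y⁺ m))             ≈⟨ trans (*-congˡ (I-inverse m)) (*-identityʳ _) ⟩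
      X e                                       ∎
    quotient-step {e} -[1+ m ] 0≤e = begin
      - (X (e ℤ.+ pos (y⁻ m)) * J m) - - (X ((e ℤ.+ y -[1+ m ]) ℤ.+ pos (y⁻ m)) * J m)
        ≡⟨ ≡.cong (λ k → - (X (e ℤ.+ pos (y⁻ m)) * J m) - - (X k * J m)) (y+y⁻ e m) ⟩
      - (X (e ℤ.+ pos (y⁻ m)) * J m) - - (X e * J m)
        ≈⟨ +-congʳ (-‿cong (*-congʳ (X-+ {e} {pos (y⁻ m)} 0≤e 0≤pos))) ⟩
      - (X e * x ^ y⁻ m * J m) - - (X e * J m)
        ≈⟨ solve 3 (λ a i y → :- (a :* y :* i) :- :- (a :* i) := a :* (i :* (con ℤ.1ℤ :- y))) refl _ _ _ ⟩
      X e * (J m * (1# - x ^ y⁻ m))             ≈⟨ trans (*-congˡ (J-inverse m)) (*-identityʳ _) ⟩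
      X e                                       ∎

    order-quotient : ∀ {k e} n → pos k ℤ.≤ val e n → quotient e n ≈[ k ] 0#
    order-quotient (pos m) k≤ = order-*ˡ _ (order-X k≤)
    order-quotient -[1+ m ] k≤ = order-neg (order-*ˡ _ (order-X k≤))

    ∣∣≤val-2n : ∀ n → pos ∣ n ∣ ℤ.≤ val (pos 2 ℤ.* n) n
    ∣∣≤val-2n (pos m) = ≤-witness (pos m) 0≤pos (eq (pos m))
      where
      eq : ∀ M → pos 2 ℤ.* M ≡ M ℤ.+ M
      eq = ℤ-solve-∀
    ∣∣≤val-2n -[1+ m ] = ≡.subst (λ k → pos (suc m) ℤ.≤ pos 2 ℤ.* -[1+ m ] ℤ.+ k) (≡.sym (y⁻≡ m))
      (≤-witness (pos 3 ℤ.* pos m ℤ.+ pos 2) (0≤+ (0≤* (0≤pos {3}) (0≤pos {m})) (0≤pos {2})) (eq (pos m)))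
      where
      eq : ∀ M → pos 2 ℤ.* ℤ.- (pos 1 ℤ.+ M) ℤ.+ (pos 6 ℤ.* M ℤ.+ pos 5) ≡ (pos 1 ℤ.+ M) ℤ.+ (pos 3 ℤ.* M ℤ.+ pos 2)
      eq = ℤ-solve-∀

    -- The surplus of 1 is lent to 3u² - 3u, which falls short of the absolute value of u at u = 1.
    ∣∣<val-4n+1 : ∀ n → pos 1 ℤ.+ pos ∣ n ∣ ℤ.≤ val (pos 4 ℤ.* n ℤ.+ pos 1) n
    ∣∣<val-4n+1 (pos m) = ≤-witness (pos 3 ℤ.* pos m) (0≤* (0≤pos {3}) (0≤pos {m})) (eq (pos m))
      where
      eq : ∀ M → pos 4 ℤ.* M ℤ.+ pos 1 ≡ (pos 1 ℤ.+ M) ℤ.+ pos 3 ℤ.* M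
      eq = ℤ-solve-∀
    ∣∣<val-4n+1 -[1+ m ] = ≡.subst (λ k → pos 1 ℤ.+ pos (suc m) ℤ.≤ (pos 4 ℤ.* -[1+ m ] ℤ.+ pos 1) ℤ.+ k) (≡.sym (y⁻≡ m))
      (≤-witness (pos m) 0≤pos (eq (pos m)))
      where
      eq : ∀ M → (pos 4 ℤ.* ℤ.- (pos 1 ℤ.+ M) ℤ.+ pos 1) ℤ.+ (pos 6 ℤ.* M ℤ.+ pos 5) ≡ (pos 1 ℤ.+ (pos 1 ℤ.+ M)) ℤ.+ M
      eq = ℤ-solve-∀

-- Two rearrangements of double series through the Lambert series

module AppellIdentities (R : CommutativeRing 0ℓ 0ℓ) where
  open PowerSeries R
  open CommutativeRing FPS

  open IntegerSolver FPS
  open FiniteSums FPS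
  open Limits R
  open Bilateral R
  open QuadraticBounds
  open import Relation.Binary.Reasoning.Setoid setoid

  module Identities {x : PS} (order-x : x ≈[ 1 ] 0#) where
    open Lambert order-x

    private
      scaled-shift : ∀ c n f → (∀ j → ∣ j ∣ ℕ.≤ ∣ n ∣ → Summableℤ (λ i → f (j ℤ.+ i))) →
        ∑ℤ (λ i → c * f (n ℤ.+ i)) ≈ c * ∑ℤ f
      scaled-shift c n f s = trans (sym (*-∑ℤ c (s n ℕ.≤-refl))) (*-congˡ (∑ℤ-shiftℤ n {f} s))

      ∑ℤ-sub : ∀ f g → ∑ℤ (λ i → f i - g i) ≈ ∑ℤ f - ∑ℤ g
      ∑ℤ-sub f g = trans (∑ℤ-+ f (λ i → - g i)) (+-congˡ (∑ℤ-neg g))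

      x-y≈0⇒x≈y : ∀ {f g} → f - g ≈ 0# → f ≈ g
      x-y≈0⇒x≈y {f} {g} p = trans (solve 2 (λ a b → a := (a :- b) :+ b) refl f g) (trans (+-congʳ p) (+-identityˡ g))

      0≤∣∣ : ∀ u {e} → pos ∣ u ∣ ℤ.≤ e → ℤ.0ℤ ℤ.≤ e
      0≤∣∣ u = ℤ.≤-trans (0≤pos {∣ u ∣})

      sgn-shift : ∀ s n → sgnℤ n ≈ sgnℤ s * sgnℤ (ℤ.- s ℤ.+ n)
      sgn-shift s n = trans (reflexive (≡.cong sgnℤ (eq s n))) (sgnℤ-+ s (ℤ.- s ℤ.+ n))
        where
        eq : ∀ s n → n ≡ s ℤ.+ (ℤ.- s ℤ.+ n)
        eq = ℤ-solve-∀

      sgn-shift′ : ∀ s n → sgnℤ n ≈ sgnℤ s * sgnℤ (s ℤ.+ n)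
      sgn-shift′ s n = begin
        sgnℤ n                                    ≈⟨ sgn-shift (ℤ.- s) n ⟩
        sgnℤ (ℤ.- s) * sgnℤ (ℤ.- ℤ.- s ℤ.+ n)     ≈⟨ *-cong (sgnℤ-neg s) (reflexive (≡.cong (λ k → sgnℤ (k ℤ.+ n)) (ℤ.neg-involutive s))) ⟩
        sgnℤ s * sgnℤ (s ℤ.+ n)                   ∎

      order-quotient-+ : ∀ {k} q b n → pos k ℤ.≤ q ℤ.+ val b n → quotient (q ℤ.+ b) n ≈[ k ] 0#
      order-quotient-+ q b n k≤ = order-quotient n (ℤ.≤-trans k≤ (ℤ.≤-reflexive (≡.sym (val-+ q b n))))

      ∣n∣≤ : ∀ {u v q e} → pos ∣ u ∣ ℤ.≤ q → pos ∣ v ∣ ℤ.≤ e → pos ∣ v ∣ ℤ.≤ q ℤ.+ e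
      ∣n∣≤ {u} {v} p r = ℤ.≤-trans (ℤ.≤-reflexive (≡.sym (ℤ.+-identityˡ (pos ∣ v ∣)))) (ℤ.+-mono-≤ (0≤∣∣ u p) r)

      -- A first-order recurrence solved from 0 in both directions. The downward step expresses the
      -- smaller index through the larger one, so that only nonnegative powers of x occur.
      iterate : (F : ℤ → PS) (h : ℤ → ℤ) (u d : ℕ → ℤ) → (∀ k → ℤ.0ℤ ℤ.≤ h k) →
        (∀ m → ℤ.0ℤ ℤ.≤ u m) → (∀ m → ℤ.0ℤ ℤ.≤ d m) → h (pos 0) ≡ ℤ.0ℤ →
        (∀ m → h (pos (suc m)) ≡ u m ℤ.+ h (pos m)) → (∀ m → h (ℤ.- pos (suc m)) ≡ d m ℤ.+ h (ℤ.- pos m)) →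
        (∀ m → F (pos m ℤ.+ pos 1) ≈ X (u m) * F (pos m)) →
        (∀ m → F (ℤ.- pos (suc m)) ≈ X (d m) * F (ℤ.- pos (suc m) ℤ.+ pos 1)) →
        ∀ k → F k ≈ X (h k) * F (pos 0)
      iterate F h u d 0≤h 0≤u 0≤d h₀ hu hd up down = all
        where
        base : F (pos 0) ≈ X (h (pos 0)) * F (pos 0)
        base = sym (trans (*-congʳ (reflexive (≡.cong X h₀))) (*-identityˡ _))

        step : ∀ {k k′ δ} → ℤ.0ℤ ℤ.≤ δ → h k′ ≡ δ ℤ.+ h k → F k′ ≈ X δ * F k →
          F k ≈ X (h k) * F (pos 0) → F k′ ≈ X (h k′) * F (pos 0)
        step {k} {k′} {δ} 0≤δ h≡ F≈ ih = begin
          F k′                               ≈⟨ F≈ ⟩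
          X δ * F k                          ≈⟨ *-congˡ ih ⟩
          X δ * (X (h k) * F (pos 0))        ≈⟨ *-assoc _ _ _ ⟨
          X δ * X (h k) * F (pos 0)          ≈⟨ *-congʳ (X-+ 0≤δ (0≤h k)) ⟨
          X (δ ℤ.+ h k) * F (pos 0)          ≡⟨ ≡.cong (λ e → X e * F (pos 0)) h≡ ⟨
          X (h k′) * F (pos 0)               ∎

        ups : ∀ m → F (pos m) ≈ X (h (pos m)) * F (pos 0)
        ups zero = base
        ups (suc m) = step (0≤u m) (hu m)
          (trans (reflexive (≡.cong F (ℤ.+-comm (pos 1) (pos m)))) (up m)) (ups m)

        downs : ∀ m → F (ℤ.- pos m) ≈ X (h (ℤ.- pos m)) * F (pos 0)
        downs zero = base
        downs (suc m) = step (0≤d m) (hd m)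
          (trans (down m) (*-congˡ (reflexive (≡.cong F (eq (pos m)))))) (downs m)
          where
          eq : ∀ M → ℤ.- (pos 1 ℤ.+ M) ℤ.+ pos 1 ≡ ℤ.- M
          eq = ℤ-solve-∀

        all : ∀ k → F k ≈ X (h k) * F (pos 0)
        all (pos m) = ups m
        all -[1+ m ] = downs (suc m)

    -- Euler's pentagonal series in x².
    θ₂ : PS
    θ₂ = ∑ℤ (λ k → sgnℤ k * X (pos 3 ℤ.* (k ℤ.* k) ℤ.- k))

    L : PS
    L = ∑ℤ (λ n → quotient (pos 2 ℤ.* n) n)

    private
      θ₂-summable : Summableℤ (λ k → sgnℤ k * X (pos 3 ℤ.* (k ℤ.* k) ℤ.- k))
      θ₂-summable k = order-*ʳ (sgnℤ k) (order-X (∣∣≤3u²-u k))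

      -- Shifting k by s separates the exponent into 3k² - k and 2n, so the inner sum becomes a
      -- multiple of `θ₂`. The first rearrangement needs s = -n, the second s = n.
      θ₂-shift : ∀ n s → (∀ k → ∣ s ∣ ≡ ∣ n ∣ → sgnℤ k * sgnℤ n ≈ sgnℤ (s ℤ.+ k)) → ∣ s ∣ ≡ ∣ n ∣ →
        ∑ℤ (λ k → sgnℤ k * (sgnℤ n * quotient (pos 3 ℤ.* ((s ℤ.+ k) ℤ.* (s ℤ.+ k)) ℤ.- (s ℤ.+ k) ℤ.+ pos 2 ℤ.* n) n))
          ≈ θ₂ * quotient (pos 2 ℤ.* n) n
      θ₂-shift n s sgn-s s≡n = begin
        ∑ℤ (λ k → sgnℤ k * (sgnℤ n * quotient (p (s ℤ.+ k) ℤ.+ pos 2 ℤ.* n) n))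
          ≈⟨ ∑ℤ-cong (λ k → trans (sym (*-assoc _ _ _)) (*-congʳ (sgn-s k s≡n))) ⟩
        ∑ℤ (λ k → f (s ℤ.+ k))
          ≈⟨ ∑ℤ-shiftℤ s {f} (λ j j≤s k → order-*ʳ (sgnℤ (j ℤ.+ k)) (order-quotient-+ (p (j ℤ.+ k)) (pos 2 ℤ.* n) n
               (shifted-bound {k} {j} {n} (∣∣≤3u²-u (j ℤ.+ k)) (≡.subst (∣ j ∣ ℕ.≤_) s≡n j≤s) (∣∣≤val-2n n)))) ⟩
        ∑ℤ f
          ≈⟨ ∑ℤ-cong (λ k → trans (*-congˡ (sym (quotient-* n (0≤∣∣ k (∣∣≤3u²-u k)) (0≤∣∣ n (∣∣≤val-2n n)))))
               (trans (sym (*-assoc _ _ _)) (*-comm _ _))) ⟩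
        ∑ℤ (λ k → quotient (pos 2 ℤ.* n) n * (sgnℤ k * X (p k)))
          ≈⟨ *-∑ℤ _ θ₂-summable ⟨
        quotient (pos 2 ℤ.* n) n * θ₂
          ≈⟨ *-comm _ _ ⟩
        θ₂ * quotient (pos 2 ℤ.* n) n ∎
        where
        p : ℤ → ℤ
        p k = pos 3 ℤ.* (k ℤ.* k) ℤ.- k
        f : ℤ → PS
        f k = sgnℤ k * quotient (p k ℤ.+ pos 2 ℤ.* n) n

      θ₂·L : ∑ℤ (λ n → θ₂ * quotient (pos 2 ℤ.* n) n) ≈ θ₂ * L
      θ₂·L = sym (*-∑ℤ θ₂ λ n → order-quotient n (∣∣≤val-2n n))

    -- With y n = x^(6n+1), M k is the sum of (-1)^n x^(3k²+3n²+3n) y(n)^(-k) / (1 - y n). Up to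
    -- a power of x, M (k+1) - M k is a theta series that vanishes by antisymmetry.
    module First where
      -- 3k² + 3n² + 3n - k(6n+1) with the square completed: as a sum of two parts, each with its
      -- own lower bound, and ready for the shift of k by n.
      C : ℤ → ℤ → ℤ
      C k n = pos 3 ℤ.* ((k ℤ.- n) ℤ.* (k ℤ.- n)) ℤ.- (k ℤ.- n) ℤ.+ pos 2 ℤ.* n

      M : ℤ → PS
      M k = ∑ℤ (λ n → sgnℤ n * quotient (C k n) n)

      0≤val : ∀ k n → pos ∣ n ∣ ℤ.≤ val (C k n) n
      0≤val k n = ℤ.≤-trans (∣n∣≤ {k ℤ.- n} {n} (∣∣≤3u²-u (k ℤ.- n)) (∣∣≤val-2n n))
        (ℤ.≤-reflexive (≡.sym (val-+ (pos 3 ℤ.* ((k ℤ.- n) ℤ.* (k ℤ.- n)) ℤ.- (k ℤ.- n)) (pos 2 ℤ.* n) n)))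

      scale : ∀ {a} k → ℤ.0ℤ ℤ.≤ a → X a * M k ≈ ∑ℤ (λ n → sgnℤ n * quotient (a ℤ.+ C k n) n)
      scale {a} k 0≤a = trans (*-∑ℤ (X a) λ n → order-*ʳ (sgnℤ n) (order-quotient n (0≤val k n)))
        (∑ℤ-cong λ n → trans (solve 3 (λ a b c → a :* (b :* c) := b :* (a :* c)) refl _ _ _)
          (*-congˡ (quotient-* n 0≤a (0≤∣∣ n (0≤val k n)))))

      -- The exponent 3i² + 3i is invariant under i → -1-i while the sign changes.
      antisymmetric : ∀ c → ∑ℤ (λ i → sgnℤ i * X (c ℤ.+ (pos 3 ℤ.* (i ℤ.* i) ℤ.+ pos 3 ℤ.* i))) ≈ 0#
      antisymmetric c = trans (∑ℤ-def _) (∑∞-0 λ m → trans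
        (+-congˡ (*-congˡ (reflexive (≡.cong X (eq c (pos m))))))
        (solve 2 (λ a b → a :* b :+ (:- a) :* b := con ℤ.0ℤ) refl _ _))
        where
        eq : ∀ c M → c ℤ.+ (pos 3 ℤ.* (ℤ.- (pos 1 ℤ.+ M) ℤ.* ℤ.- (pos 1 ℤ.+ M)) ℤ.+ pos 3 ℤ.* ℤ.- (pos 1 ℤ.+ M))
          ≡ c ℤ.+ (pos 3 ℤ.* (M ℤ.* M) ℤ.+ pos 3 ℤ.* M)
        eq = ℤ-solve-∀

      -- The offset a keeps exponents nonnegative: upward it is 0, downward it is chosen to cancel
      -- 6k+3. The exponent of the resulting theta series contains 1+c; the 1 secures the bound for
      -- 3i² + 3i + 1, and c pays for the shift by k+1.
      step : ∀ k a c → ℤ.0ℤ ℤ.≤ a → ℤ.0ℤ ℤ.≤ a ℤ.+ (pos 6 ℤ.* k ℤ.+ pos 3) →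
        a ℤ.+ pos 2 ℤ.* (k ℤ.+ pos 1) ≡ pos 1 ℤ.+ c → pos ∣ k ℤ.+ pos 1 ∣ ℤ.≤ c →
        X a * M (k ℤ.+ pos 1) ≈ X (a ℤ.+ (pos 6 ℤ.* k ℤ.+ pos 3)) * M k
      step k a c 0≤a 0≤b c≡ k′≤c = x-y≈0⇒x≈y (begin
        X a * M k′ - X b * M k
          ≈⟨ +-cong (scale k′ 0≤a) (-‿cong (scale k 0≤b)) ⟩
        ∑ℤ (λ n → sgnℤ n * quotient (a ℤ.+ C k′ n) n) - ∑ℤ (λ n → sgnℤ n * quotient (b ℤ.+ C k n) n)
          ≈⟨ ∑ℤ-sub _ _ ⟨
        ∑ℤ (λ n → sgnℤ n * quotient (a ℤ.+ C k′ n) n - sgnℤ n * quotient (b ℤ.+ C k n) n)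
          ≈⟨ ∑ℤ-cong term ⟩
        ∑ℤ (λ n → sgnℤ k′ * f (ℤ.- k′ ℤ.+ n))
          ≈⟨ scaled-shift (sgnℤ k′) (ℤ.- k′) f (λ j j≤ i → order-*ʳ (sgnℤ (j ℤ.+ i)) (order-X (bound j i j≤))) ⟩
        sgnℤ k′ * ∑ℤ f
          ≈⟨ trans (*-congˡ (antisymmetric (pos 1 ℤ.+ c))) (zeroʳ _) ⟩
        0# ∎)
        where
        k′ b : ℤ
        k′ = k ℤ.+ pos 1
        b = a ℤ.+ (pos 6 ℤ.* k ℤ.+ pos 3)

        e : ℤ → ℤ
        e i = (pos 1 ℤ.+ c) ℤ.+ (pos 3 ℤ.* (i ℤ.* i) ℤ.+ pos 3 ℤ.* i)

        f : ℤ → PS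
        f i = sgnℤ i * X (e i)

        bound : ∀ j i → ∣ j ∣ ℕ.≤ ∣ ℤ.- k′ ∣ → pos ∣ i ∣ ℤ.≤ e (j ℤ.+ i)
        bound j i j≤ = ℤ.≤-trans (shifted-bound {i} {j} {ℤ.- k′} (∣∣≤3u²+3u+1 (j ℤ.+ i)) j≤
          (ℤ.≤-trans (ℤ.≤-reflexive (≡.cong pos (ℤ.∣-i∣≡∣i∣ k′))) k′≤c)) (ℤ.≤-reflexive (eq (j ℤ.+ i) c))
          where
          eq : ∀ u c → (pos 3 ℤ.* (u ℤ.* u) ℤ.+ pos 3 ℤ.* u ℤ.+ pos 1) ℤ.+ c ≡ (pos 1 ℤ.+ c) ℤ.+ (pos 3 ℤ.* (u ℤ.* u) ℤ.+ pos 3 ℤ.* u)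
          eq = ℤ-solve-∀

        e≡ : ∀ n → a ℤ.+ C k′ n ≡ e (ℤ.- k′ ℤ.+ n)
        e≡ n = ≡.trans (eq a k′ n) (≡.cong (ℤ._+ (pos 3 ℤ.* ((ℤ.- k′ ℤ.+ n) ℤ.* (ℤ.- k′ ℤ.+ n)) ℤ.+ pos 3 ℤ.* (ℤ.- k′ ℤ.+ n))) c≡)
          where
          eq : ∀ a k n → a ℤ.+ (pos 3 ℤ.* ((k ℤ.- n) ℤ.* (k ℤ.- n)) ℤ.- (k ℤ.- n) ℤ.+ pos 2 ℤ.* n)
            ≡ (a ℤ.+ pos 2 ℤ.* k) ℤ.+ (pos 3 ℤ.* ((ℤ.- k ℤ.+ n) ℤ.* (ℤ.- k ℤ.+ n)) ℤ.+ pos 3 ℤ.* (ℤ.- k ℤ.+ n))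
          eq = ℤ-solve-∀

        e+y : ∀ n → b ℤ.+ C k n ≡ (a ℤ.+ C k′ n) ℤ.+ y n
        e+y n = eq a k n
          where
          eq : ∀ a k n → (a ℤ.+ (pos 6 ℤ.* k ℤ.+ pos 3)) ℤ.+ (pos 3 ℤ.* ((k ℤ.- n) ℤ.* (k ℤ.- n)) ℤ.- (k ℤ.- n) ℤ.+ pos 2 ℤ.* n)
            ≡ (a ℤ.+ (pos 3 ℤ.* (((k ℤ.+ pos 1) ℤ.- n) ℤ.* ((k ℤ.+ pos 1) ℤ.- n)) ℤ.- ((k ℤ.+ pos 1) ℤ.- n) ℤ.+ pos 2 ℤ.* n)) ℤ.+ (pos 6 ℤ.* n ℤ.+ pos 1)
          eq = ℤ-solve-∀

        0≤e : ∀ n → ℤ.0ℤ ℤ.≤ a ℤ.+ C k′ n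
        0≤e n = ℤ.≤-trans (0≤∣∣ n (bound (ℤ.- k′) n ℕ.≤-refl)) (ℤ.≤-reflexive (≡.sym (e≡ n)))

        term : ∀ n → sgnℤ n * quotient (a ℤ.+ C k′ n) n - sgnℤ n * quotient (b ℤ.+ C k n) n ≈ sgnℤ k′ * f (ℤ.- k′ ℤ.+ n)
        term n = begin
          sgnℤ n * quotient (a ℤ.+ C k′ n) n - sgnℤ n * quotient (b ℤ.+ C k n) n
            ≡⟨ ≡.cong (λ t → sgnℤ n * quotient (a ℤ.+ C k′ n) n - sgnℤ n * quotient t n) (e+y n) ⟩
          sgnℤ n * quotient (a ℤ.+ C k′ n) n - sgnℤ n * quotient ((a ℤ.+ C k′ n) ℤ.+ y n) n
            ≈⟨ solve 3 (λ a b c → a :* b :- a :* c := a :* (b :- c)) refl _ _ _ ⟩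
          sgnℤ n * (quotient (a ℤ.+ C k′ n) n - quotient ((a ℤ.+ C k′ n) ℤ.+ y n) n)
            ≈⟨ *-cong (sgn-shift k′ n) (trans (quotient-step n (0≤e n)) (reflexive (≡.cong X (e≡ n)))) ⟩
          sgnℤ k′ * sgnℤ (ℤ.- k′ ℤ.+ n) * X (e (ℤ.- k′ ℤ.+ n))
            ≈⟨ *-assoc _ _ _ ⟩
          sgnℤ k′ * f (ℤ.- k′ ℤ.+ n) ∎

      M-all : ∀ k → M k ≈ X (pos 3 ℤ.* (k ℤ.* k)) * M (pos 0)
      M-all = iterate M (λ k → pos 3 ℤ.* (k ℤ.* k)) (λ m → pos 0 ℤ.+ (pos 6 ℤ.* pos m ℤ.+ pos 3)) (λ m → pos 6 ℤ.* pos m ℤ.+ pos 3)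
        (λ k → 0≤∣∣ k (∣∣≤3u² k)) (λ m → 0≤+ (0≤pos {0}) (0≤d m)) 0≤d ≡.refl (λ m → hu (pos m)) (λ m → hd (pos m)) up down
        where
        0≤d : ∀ m → ℤ.0ℤ ℤ.≤ pos 6 ℤ.* pos m ℤ.+ pos 3
        0≤d m = 0≤+ (0≤* (0≤pos {6}) (0≤pos {m})) (0≤pos {3})

        hu : ∀ M → pos 3 ℤ.* ((pos 1 ℤ.+ M) ℤ.* (pos 1 ℤ.+ M)) ≡ (pos 0 ℤ.+ (pos 6 ℤ.* M ℤ.+ pos 3)) ℤ.+ pos 3 ℤ.* (M ℤ.* M)
        hu = ℤ-solve-∀

        hd : ∀ M → pos 3 ℤ.* (ℤ.- (pos 1 ℤ.+ M) ℤ.* ℤ.- (pos 1 ℤ.+ M)) ≡ (pos 6 ℤ.* M ℤ.+ pos 3) ℤ.+ pos 3 ℤ.* (ℤ.- M ℤ.* ℤ.- M)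
        hd = ℤ-solve-∀

        up : ∀ m → M (pos m ℤ.+ pos 1) ≈ X (pos 0 ℤ.+ (pos 6 ℤ.* pos m ℤ.+ pos 3)) * M (pos m)
        up m = trans (sym (*-identityˡ _)) (step (pos m) (pos 0) (pos 2 ℤ.* pos m ℤ.+ pos 1)
          (0≤pos {0}) (0≤+ (0≤pos {0}) (0≤d m)) (eq (pos m))
          (≤-witness (pos m) (0≤pos {m}) (eq′ (pos m))))
          where
          eq : ∀ M → pos 0 ℤ.+ pos 2 ℤ.* (M ℤ.+ pos 1) ≡ pos 1 ℤ.+ (pos 2 ℤ.* M ℤ.+ pos 1)
          eq = ℤ-solve-∀
          eq′ : ∀ M → pos 2 ℤ.* M ℤ.+ pos 1 ≡ (M ℤ.+ pos 1) ℤ.+ M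
          eq′ = ℤ-solve-∀

        down : ∀ m → M (ℤ.- pos (suc m)) ≈ X (pos 6 ℤ.* pos m ℤ.+ pos 3) * M (ℤ.- pos (suc m) ℤ.+ pos 1)
        down m = sym (begin
          X a * M (k ℤ.+ pos 1)
            ≈⟨ step k a (pos 4 ℤ.* pos m ℤ.+ pos 2) (0≤d m) (ℤ.≤-reflexive (≡.sym (b≡0 (pos m)))) (eq (pos m))
                 (≡.subst (λ t → pos t ℤ.≤ pos 4 ℤ.* pos m ℤ.+ pos 2) (≡.sym ∣k+1∣)
                   (≤-witness (pos 3 ℤ.* pos m ℤ.+ pos 2) (0≤+ (0≤* (0≤pos {3}) (0≤pos {m})) (0≤pos {2})) (eq′ (pos m)))) ⟩
          X (a ℤ.+ (pos 6 ℤ.* k ℤ.+ pos 3)) * M k   ≡⟨ ≡.cong (λ t → X t * M k) (b≡0 (pos m)) ⟩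
          X (pos 0) * M k                           ≈⟨ *-identityˡ _ ⟩
          M k                                       ∎)
          where
          a k : ℤ
          a = pos 6 ℤ.* pos m ℤ.+ pos 3
          k = ℤ.- pos (suc m)

          b≡0 : ∀ M → (pos 6 ℤ.* M ℤ.+ pos 3) ℤ.+ (pos 6 ℤ.* ℤ.- (pos 1 ℤ.+ M) ℤ.+ pos 3) ≡ pos 0
          b≡0 = ℤ-solve-∀

          eq : ∀ M → (pos 6 ℤ.* M ℤ.+ pos 3) ℤ.+ pos 2 ℤ.* (ℤ.- (pos 1 ℤ.+ M) ℤ.+ pos 1) ≡ pos 1 ℤ.+ (pos 4 ℤ.* M ℤ.+ pos 2)
          eq = ℤ-solve-∀

          eq′ : ∀ M → pos 4 ℤ.* M ℤ.+ pos 2 ≡ M ℤ.+ (pos 3 ℤ.* M ℤ.+ pos 2)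
          eq′ = ℤ-solve-∀

          ∣k+1∣ : ∣ k ℤ.+ pos 1 ∣ ≡ m
          ∣k+1∣ = ≡.trans (≡.cong ∣_∣ (eq″ (pos m))) (ℤ.∣-i∣≡∣i∣ (pos m))
            where
            eq″ : ∀ M → ℤ.- (pos 1 ℤ.+ M) ℤ.+ pos 1 ≡ ℤ.- M
            eq″ = ℤ-solve-∀

    θ₀ : PS
    θ₀ = ∑ℤ (λ k → sgnℤ k * X (pos 3 ℤ.* (k ℤ.* k)))

    -- The alternating sum of all M k is computed twice: by `M-all` it is a multiple of M 0, and
    -- with the order of summation exchanged the inner sums give `θ₂`.
    θ₀·M≈θ₂·L : θ₀ * First.M (pos 0) ≈ θ₂ * L
    θ₀·M≈θ₂·L = begin
      θ₀ * M (pos 0)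
        ≈⟨ trans (*-comm _ _) (*-∑ℤ _ λ k → order-*ʳ (sgnℤ k) (order-X (∣∣≤3u² k))) ⟩
      ∑ℤ (λ k → M (pos 0) * (sgnℤ k * X (pos 3 ℤ.* (k ℤ.* k))))
        ≈⟨ ∑ℤ-cong (λ k → trans (solve 3 (λ a b c → a :* (b :* c) := b :* (c :* a)) refl _ _ _) (*-congˡ (sym (M-all k)))) ⟩
      ∑ℤ (λ k → sgnℤ k * M k)
        ≈⟨ ∑ℤ-cong (λ k → *-∑ℤ (sgnℤ k) λ n → order-*ʳ (sgnℤ n) (order-quotient n (0≤val k n))) ⟩
      ∑ℤ (λ k → ∑ℤ (λ n → sgnℤ k * (sgnℤ n * quotient (C k n) n)))
        ≈⟨ ∑ℤ-swap _ ⟩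
      ∑ℤ (λ n → ∑ℤ (λ k → sgnℤ k * (sgnℤ n * quotient (C k n) n)))
        ≈⟨ ∑ℤ-cong (λ n → ∑ℤ-cong λ k → reflexive (≡.cong (λ e → sgnℤ k * (sgnℤ n * quotient e n)) (eq k n))) ⟩
      ∑ℤ (λ n → ∑ℤ (λ k → sgnℤ k * (sgnℤ n * quotient (pos 3 ℤ.* ((ℤ.- n ℤ.+ k) ℤ.* (ℤ.- n ℤ.+ k)) ℤ.- (ℤ.- n ℤ.+ k) ℤ.+ pos 2 ℤ.* n) n)))
        ≈⟨ ∑ℤ-cong (λ n → θ₂-shift n (ℤ.- n) (λ k _ → trans (*-comm _ _) (trans (*-congʳ (sym (sgnℤ-neg n))) (sym (sgnℤ-+ (ℤ.- n) k)))) (ℤ.∣-i∣≡∣i∣ n)) ⟩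
      ∑ℤ (λ n → θ₂ * quotient (pos 2 ℤ.* n) n)
        ≈⟨ θ₂·L ⟩
      θ₂ * L ∎
      where
      open First
      eq : ∀ k n → pos 3 ℤ.* ((k ℤ.- n) ℤ.* (k ℤ.- n)) ℤ.- (k ℤ.- n) ℤ.+ pos 2 ℤ.* n
        ≡ pos 3 ℤ.* ((ℤ.- n ℤ.+ k) ℤ.* (ℤ.- n ℤ.+ k)) ℤ.- (ℤ.- n ℤ.+ k) ℤ.+ pos 2 ℤ.* n
      eq = ℤ-solve-∀

    -- Θ s is the sum of (-1)^n x^(3s²-2s+3n²+n) (y(n)^s + y(n)^(1-s)) / (1 - y n). Up to a power
    -- of x, Θ (s+1) - Θ s is the difference of two shifts of the same theta series.
    module Second where
      A B : ℤ → ℤ → ℤ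
      A s n = pos 3 ℤ.* ((s ℤ.+ n) ℤ.* (s ℤ.+ n)) ℤ.- (s ℤ.+ n) ℤ.+ pos 2 ℤ.* n
      B s n = pos 3 ℤ.* ((s ℤ.- n) ℤ.* (s ℤ.- n)) ℤ.- pos 3 ℤ.* (s ℤ.- n) ℤ.+ (pos 4 ℤ.* n ℤ.+ pos 1)

      Θ : ℤ → PS
      Θ s = ∑ℤ (λ n → sgnℤ n * (quotient (A s n) n + quotient (B s n) n))

      valA : ∀ s n → pos ∣ n ∣ ℤ.≤ val (A s n) n
      valA s n = ℤ.≤-trans (∣n∣≤ {s ℤ.+ n} {n} (∣∣≤3u²-u (s ℤ.+ n)) (∣∣≤val-2n n))
        (ℤ.≤-reflexive (≡.sym (val-+ (pos 3 ℤ.* ((s ℤ.+ n) ℤ.* (s ℤ.+ n)) ℤ.- (s ℤ.+ n)) (pos 2 ℤ.* n) n)))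

      regroup : ∀ q v → (q ℤ.+ pos 1) ℤ.+ (v ℤ.- pos 1) ≡ q ℤ.+ v
      regroup = ℤ-solve-∀

      ∣∣≤val-1 : ∀ n → pos ∣ n ∣ ℤ.≤ val (pos 4 ℤ.* n ℤ.+ pos 1) n ℤ.- pos 1
      ∣∣≤val-1 n = ℤ.≤-trans (ℤ.≤-reflexive (eq (pos ∣ n ∣))) (ℤ.+-monoˡ-≤ (ℤ.- pos 1) (∣∣<val-4n+1 n))
        where
        eq : ∀ v → v ≡ (pos 1 ℤ.+ v) ℤ.- pos 1
        eq = ℤ-solve-∀

      valB : ∀ s n → pos ∣ n ∣ ℤ.≤ val (B s n) n
      valB s n = ℤ.≤-trans (∣n∣≤ {s ℤ.- n} {n} (∣∣≤3u²-3u+1 (s ℤ.- n)) (∣∣≤val-1 n))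
        (ℤ.≤-reflexive (≡.trans (regroup q (val (pos 4 ℤ.* n ℤ.+ pos 1) n)) (≡.sym (val-+ q (pos 4 ℤ.* n ℤ.+ pos 1) n))))
        where
        q : ℤ
        q = pos 3 ℤ.* ((s ℤ.- n) ℤ.* (s ℤ.- n)) ℤ.- pos 3 ℤ.* (s ℤ.- n)

      scale : ∀ {a} s → ℤ.0ℤ ℤ.≤ a →
        X a * Θ s ≈ ∑ℤ (λ n → sgnℤ n * (quotient (a ℤ.+ A s n) n + quotient (a ℤ.+ B s n) n))
      scale {a} s 0≤a = trans (*-∑ℤ (X a) λ n → order-*ʳ (sgnℤ n) (order-+ (order-quotient n (valA s n)) (order-quotient n (valB s n))))
        (∑ℤ-cong λ n → trans (solve 4 (λ a b c d → a :* (b :* (c :+ d)) := b :* (a :* c :+ a :* d)) refl _ _ _ _)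
          (*-congˡ (+-cong (quotient-* n 0≤a (0≤∣∣ n (valA s n))) (quotient-* n 0≤a (0≤∣∣ n (valB s n))))))

      -- From s to s+1, relative to the prefactors, the terms with `A` gain a factor x^(6n+1) and
      -- those with `B` lose one. Both differences collapse to terms of one theta series, shifted by
      -- s and by -s, and their sums cancel.
      step : ∀ s a c → ℤ.0ℤ ℤ.≤ a → ℤ.0ℤ ℤ.≤ a ℤ.+ (pos 6 ℤ.* s ℤ.+ pos 1) →
        a ℤ.+ (pos 4 ℤ.* s ℤ.+ pos 1) ≡ c → pos ∣ s ∣ ℤ.≤ c →
        X a * Θ (s ℤ.+ pos 1) ≈ X (a ℤ.+ (pos 6 ℤ.* s ℤ.+ pos 1)) * Θ s
      step s a c 0≤a 0≤b ≡.refl s≤c = x-y≈0⇒x≈y (begin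
        X a * Θ s′ - X b * Θ s
          ≈⟨ +-cong (scale s′ 0≤a) (-‿cong (scale s 0≤b)) ⟩
        ∑ℤ (λ n → sgnℤ n * (quotient (a ℤ.+ A s′ n) n + quotient (a ℤ.+ B s′ n) n))
          - ∑ℤ (λ n → sgnℤ n * (quotient (b ℤ.+ A s n) n + quotient (b ℤ.+ B s n) n))
          ≈⟨ ∑ℤ-sub _ _ ⟨
        ∑ℤ (λ n → sgnℤ n * (quotient (a ℤ.+ A s′ n) n + quotient (a ℤ.+ B s′ n) n)
          - sgnℤ n * (quotient (b ℤ.+ A s n) n + quotient (b ℤ.+ B s n) n))
          ≈⟨ ∑ℤ-cong term ⟩
        ∑ℤ (λ n → sgnℤ s * f (ℤ.- s ℤ.+ n) - sgnℤ s * f (s ℤ.+ n))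
          ≈⟨ ∑ℤ-sub _ _ ⟩
        ∑ℤ (λ n → sgnℤ s * f (ℤ.- s ℤ.+ n)) - ∑ℤ (λ n → sgnℤ s * f (s ℤ.+ n))
          ≈⟨ +-cong (scaled-shift (sgnℤ s) (ℤ.- s) f (λ j j≤ i → order-*ʳ (sgnℤ (j ℤ.+ i)) (order-X
               (bound j i (ℕ.≤-trans j≤ (ℕ.≤-reflexive (ℤ.∣-i∣≡∣i∣ s)))))))
             (-‿cong (scaled-shift (sgnℤ s) s f (λ j j≤ i → order-*ʳ (sgnℤ (j ℤ.+ i)) (order-X (bound j i j≤))))) ⟩
        sgnℤ s * ∑ℤ f - sgnℤ s * ∑ℤ f
          ≈⟨ -‿inverseʳ _ ⟩
        0# ∎)
        where
        s′ b : ℤ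
        s′ = s ℤ.+ pos 1
        b = a ℤ.+ (pos 6 ℤ.* s ℤ.+ pos 1)

        e : ℤ → ℤ
        e i = (pos 3 ℤ.* (i ℤ.* i) ℤ.+ i) ℤ.+ c

        f : ℤ → PS
        f i = sgnℤ i * X (e i)

        bound : ∀ j i → ∣ j ∣ ℕ.≤ ∣ s ∣ → pos ∣ i ∣ ℤ.≤ e (j ℤ.+ i)
        bound j i j≤ = shifted-bound {i} {j} {s} (∣∣≤3u²+u (j ℤ.+ i)) j≤ s≤c

        e₁ : ∀ n → a ℤ.+ B s′ n ≡ e (ℤ.- s ℤ.+ n)
        e₁ n = eq a s n
          where
          eq : ∀ a s n → a ℤ.+ (pos 3 ℤ.* (((s ℤ.+ pos 1) ℤ.- n) ℤ.* ((s ℤ.+ pos 1) ℤ.- n)) ℤ.- pos 3 ℤ.* ((s ℤ.+ pos 1) ℤ.- n) ℤ.+ (pos 4 ℤ.* n ℤ.+ pos 1))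
            ≡ (pos 3 ℤ.* ((ℤ.- s ℤ.+ n) ℤ.* (ℤ.- s ℤ.+ n)) ℤ.+ (ℤ.- s ℤ.+ n)) ℤ.+ (a ℤ.+ (pos 4 ℤ.* s ℤ.+ pos 1))
          eq = ℤ-solve-∀

        e₂ : ∀ n → b ℤ.+ A s n ≡ e (s ℤ.+ n)
        e₂ n = eq a s n
          where
          eq : ∀ a s n → (a ℤ.+ (pos 6 ℤ.* s ℤ.+ pos 1)) ℤ.+ (pos 3 ℤ.* ((s ℤ.+ n) ℤ.* (s ℤ.+ n)) ℤ.- (s ℤ.+ n) ℤ.+ pos 2 ℤ.* n)
            ≡ (pos 3 ℤ.* ((s ℤ.+ n) ℤ.* (s ℤ.+ n)) ℤ.+ (s ℤ.+ n)) ℤ.+ (a ℤ.+ (pos 4 ℤ.* s ℤ.+ pos 1))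
          eq = ℤ-solve-∀

        B+y : ∀ n → b ℤ.+ B s n ≡ (a ℤ.+ B s′ n) ℤ.+ y n
        B+y n = eq a s n
          where
          eq : ∀ a s n → (a ℤ.+ (pos 6 ℤ.* s ℤ.+ pos 1)) ℤ.+ (pos 3 ℤ.* ((s ℤ.- n) ℤ.* (s ℤ.- n)) ℤ.- pos 3 ℤ.* (s ℤ.- n) ℤ.+ (pos 4 ℤ.* n ℤ.+ pos 1))
            ≡ (a ℤ.+ (pos 3 ℤ.* (((s ℤ.+ pos 1) ℤ.- n) ℤ.* ((s ℤ.+ pos 1) ℤ.- n)) ℤ.- pos 3 ℤ.* ((s ℤ.+ pos 1) ℤ.- n) ℤ.+ (pos 4 ℤ.* n ℤ.+ pos 1))) ℤ.+ (pos 6 ℤ.* n ℤ.+ pos 1)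
          eq = ℤ-solve-∀

        A+y : ∀ n → a ℤ.+ A s′ n ≡ (b ℤ.+ A s n) ℤ.+ y n
        A+y n = eq a s n
          where
          eq : ∀ a s n → a ℤ.+ (pos 3 ℤ.* (((s ℤ.+ pos 1) ℤ.+ n) ℤ.* ((s ℤ.+ pos 1) ℤ.+ n)) ℤ.- ((s ℤ.+ pos 1) ℤ.+ n) ℤ.+ pos 2 ℤ.* n)
            ≡ ((a ℤ.+ (pos 6 ℤ.* s ℤ.+ pos 1)) ℤ.+ (pos 3 ℤ.* ((s ℤ.+ n) ℤ.* (s ℤ.+ n)) ℤ.- (s ℤ.+ n) ℤ.+ pos 2 ℤ.* n)) ℤ.+ (pos 6 ℤ.* n ℤ.+ pos 1)
          eq = ℤ-solve-∀

        term : ∀ n → sgnℤ n * (quotient (a ℤ.+ A s′ n) n + quotient (a ℤ.+ B s′ n) n)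
          - sgnℤ n * (quotient (b ℤ.+ A s n) n + quotient (b ℤ.+ B s n) n)
          ≈ sgnℤ s * f (ℤ.- s ℤ.+ n) - sgnℤ s * f (s ℤ.+ n)
        term n = begin
          sgnℤ n * (quotient (a ℤ.+ A s′ n) n + quotient (a ℤ.+ B s′ n) n)
            - sgnℤ n * (quotient (b ℤ.+ A s n) n + quotient (b ℤ.+ B s n) n)
            ≡⟨ ≡.cong₂ (λ t u → sgnℤ n * (quotient t n + quotient (a ℤ.+ B s′ n) n) - sgnℤ n * (quotient (b ℤ.+ A s n) n + quotient u n)) (A+y n) (B+y n) ⟩
          sgnℤ n * (quotient ((b ℤ.+ A s n) ℤ.+ y n) n + quotient (a ℤ.+ B s′ n) n)
            - sgnℤ n * (quotient (b ℤ.+ A s n) n + quotient ((a ℤ.+ B s′ n) ℤ.+ y n) n)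
            ≈⟨ solve 5 (λ g p q r t → g :* (p :+ q) :- g :* (r :+ t) := g :* (q :- t) :- g :* (r :- p)) refl _ _ _ _ _ ⟩
          sgnℤ n * (quotient (a ℤ.+ B s′ n) n - quotient ((a ℤ.+ B s′ n) ℤ.+ y n) n)
            - sgnℤ n * (quotient (b ℤ.+ A s n) n - quotient ((b ℤ.+ A s n) ℤ.+ y n) n)
            ≈⟨ +-cong (*-cong (sgn-shift s n) (trans (quotient-step n 0≤e₁) (reflexive (≡.cong X (e₁ n)))))
                 (-‿cong (*-cong (sgn-shift′ s n) (trans (quotient-step n 0≤e₂) (reflexive (≡.cong X (e₂ n)))))) ⟩
          sgnℤ s * sgnℤ (ℤ.- s ℤ.+ n) * X (e (ℤ.- s ℤ.+ n)) - sgnℤ s * sgnℤ (s ℤ.+ n) * X (e (s ℤ.+ n))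
            ≈⟨ +-cong (*-assoc _ _ _) (-‿cong (*-assoc _ _ _)) ⟩
          sgnℤ s * f (ℤ.- s ℤ.+ n) - sgnℤ s * f (s ℤ.+ n) ∎
          where
          0≤e₁ : ℤ.0ℤ ℤ.≤ a ℤ.+ B s′ n
          0≤e₁ = ℤ.≤-trans (0≤∣∣ n (bound (ℤ.- s) n (ℕ.≤-reflexive (ℤ.∣-i∣≡∣i∣ s)))) (ℤ.≤-reflexive (≡.sym (e₁ n)))
          0≤e₂ : ℤ.0ℤ ℤ.≤ b ℤ.+ A s n
          0≤e₂ = ℤ.≤-trans (0≤∣∣ n (bound s n ℕ.≤-refl)) (ℤ.≤-reflexive (≡.sym (e₂ n)))

      Θ-all : ∀ s → Θ s ≈ X (pos 3 ℤ.* (s ℤ.* s) ℤ.- pos 2 ℤ.* s) * Θ (pos 0)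
      Θ-all = iterate Θ (λ s → pos 3 ℤ.* (s ℤ.* s) ℤ.- pos 2 ℤ.* s) (λ m → pos 0 ℤ.+ (pos 6 ℤ.* pos m ℤ.+ pos 1)) (λ m → pos 6 ℤ.* pos m ℤ.+ pos 5)
        (λ s → 0≤∣∣ s (∣∣≤3u²-2u s)) (λ m → 0≤+ (0≤pos {0}) (0≤u m)) 0≤d ≡.refl (λ m → hu (pos m)) (λ m → hd (pos m)) up down
        where
        0≤u : ∀ m → ℤ.0ℤ ℤ.≤ pos 6 ℤ.* pos m ℤ.+ pos 1
        0≤u m = 0≤+ (0≤* (0≤pos {6}) (0≤pos {m})) (0≤pos {1})

        0≤d : ∀ m → ℤ.0ℤ ℤ.≤ pos 6 ℤ.* pos m ℤ.+ pos 5
        0≤d m = 0≤+ (0≤* (0≤pos {6}) (0≤pos {m})) (0≤pos {5})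

        hu : ∀ M → pos 3 ℤ.* ((pos 1 ℤ.+ M) ℤ.* (pos 1 ℤ.+ M)) ℤ.- pos 2 ℤ.* (pos 1 ℤ.+ M)
          ≡ (pos 0 ℤ.+ (pos 6 ℤ.* M ℤ.+ pos 1)) ℤ.+ (pos 3 ℤ.* (M ℤ.* M) ℤ.- pos 2 ℤ.* M)
        hu = ℤ-solve-∀

        hd : ∀ M → pos 3 ℤ.* (ℤ.- (pos 1 ℤ.+ M) ℤ.* ℤ.- (pos 1 ℤ.+ M)) ℤ.- pos 2 ℤ.* ℤ.- (pos 1 ℤ.+ M)
          ≡ (pos 6 ℤ.* M ℤ.+ pos 5) ℤ.+ (pos 3 ℤ.* (ℤ.- M ℤ.* ℤ.- M) ℤ.- pos 2 ℤ.* ℤ.- M)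
        hd = ℤ-solve-∀

        up : ∀ m → Θ (pos m ℤ.+ pos 1) ≈ X (pos 0 ℤ.+ (pos 6 ℤ.* pos m ℤ.+ pos 1)) * Θ (pos m)
        up m = trans (sym (*-identityˡ _)) (step (pos m) (pos 0) (pos 0 ℤ.+ (pos 4 ℤ.* pos m ℤ.+ pos 1))
          (0≤pos {0}) (0≤+ (0≤pos {0}) (0≤u m)) ≡.refl
          (≤-witness (pos 3 ℤ.* pos m ℤ.+ pos 1) (0≤+ (0≤* (0≤pos {3}) (0≤pos {m})) (0≤pos {1})) (eq (pos m))))
          where
          eq : ∀ M → pos 0 ℤ.+ (pos 4 ℤ.* M ℤ.+ pos 1) ≡ M ℤ.+ (pos 3 ℤ.* M ℤ.+ pos 1)
          eq = ℤ-solve-∀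

        down : ∀ m → Θ (ℤ.- pos (suc m)) ≈ X (pos 6 ℤ.* pos m ℤ.+ pos 5) * Θ (ℤ.- pos (suc m) ℤ.+ pos 1)
        down m = sym (begin
          X a * Θ (s ℤ.+ pos 1)
            ≈⟨ step s a (a ℤ.+ (pos 4 ℤ.* s ℤ.+ pos 1)) (0≤d m) (ℤ.≤-reflexive (≡.sym (b≡0 (pos m)))) ≡.refl
                 (≤-witness (pos m ℤ.+ pos 1) (0≤+ (0≤pos {m}) (0≤pos {1})) (eq (pos m))) ⟩
          X (a ℤ.+ (pos 6 ℤ.* s ℤ.+ pos 1)) * Θ s   ≡⟨ ≡.cong (λ t → X t * Θ s) (b≡0 (pos m)) ⟩
          X (pos 0) * Θ s                           ≈⟨ *-identityˡ _ ⟩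
          Θ s                                       ∎)
          where
          a s : ℤ
          a = pos 6 ℤ.* pos m ℤ.+ pos 5
          s = ℤ.- pos (suc m)

          b≡0 : ∀ M → (pos 6 ℤ.* M ℤ.+ pos 5) ℤ.+ (pos 6 ℤ.* ℤ.- (pos 1 ℤ.+ M) ℤ.+ pos 1) ≡ pos 0
          b≡0 = ℤ-solve-∀

          eq : ∀ M → (pos 6 ℤ.* M ℤ.+ pos 5) ℤ.+ (pos 4 ℤ.* ℤ.- (pos 1 ℤ.+ M) ℤ.+ pos 1) ≡ (pos 1 ℤ.+ M) ℤ.+ (M ℤ.+ pos 1)
          eq = ℤ-solve-∀

    θ₁ : PS
    θ₁ = ∑ℤ (λ k → sgnℤ k * X (pos 3 ℤ.* (k ℤ.* k) ℤ.- pos 2 ℤ.* k))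

    -- Again an alternating sum computed twice. After the exchange the `A` part gives `θ₂` times the
    -- Lambert series, and the `B` part vanishes.
    θ₁·Θ≈θ₂·L : θ₁ * Second.Θ (pos 0) ≈ θ₂ * L
    θ₁·Θ≈θ₂·L = begin
      θ₁ * Θ (pos 0)
        ≈⟨ trans (*-comm _ _) (*-∑ℤ _ λ s → order-*ʳ (sgnℤ s) (order-X (∣∣≤3u²-2u s))) ⟩
      ∑ℤ (λ s → Θ (pos 0) * (sgnℤ s * X (pos 3 ℤ.* (s ℤ.* s) ℤ.- pos 2 ℤ.* s)))
        ≈⟨ ∑ℤ-cong (λ s → trans (solve 3 (λ a b c → a :* (b :* c) := b :* (c :* a)) refl _ _ _) (*-congˡ (sym (Θ-all s)))) ⟩
      ∑ℤ (λ s → sgnℤ s * Θ s)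
        ≈⟨ ∑ℤ-cong (λ s → *-∑ℤ (sgnℤ s) λ n → order-*ʳ (sgnℤ n) (order-+ (order-quotient n (valA s n)) (order-quotient n (valB s n)))) ⟩
      ∑ℤ (λ s → ∑ℤ (λ n → sgnℤ s * (sgnℤ n * (quotient (A s n) n + quotient (B s n) n))))
        ≈⟨ ∑ℤ-swap _ ⟩
      ∑ℤ (λ n → ∑ℤ (λ s → sgnℤ s * (sgnℤ n * (quotient (A s n) n + quotient (B s n) n))))
        ≈⟨ ∑ℤ-cong (λ n → trans (∑ℤ-cong λ s → solve 4 (λ a b c d → a :* (b :* (c :+ d)) := a :* (b :* c) :+ a :* (b :* d)) refl _ _ _ _)
             (∑ℤ-+ _ _)) ⟩
      ∑ℤ (λ n → ∑ℤ (λ s → sgnℤ s * (sgnℤ n * quotient (A s n) n)) + ∑ℤ (λ s → sgnℤ s * (sgnℤ n * quotient (B s n) n)))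
        ≈⟨ ∑ℤ-cong (λ n → +-cong (sumA n) (sumB n)) ⟩
      ∑ℤ (λ n → θ₂ * quotient (pos 2 ℤ.* n) n + 0#)
        ≈⟨ ∑ℤ-cong (λ n → +-identityʳ _) ⟩
      ∑ℤ (λ n → θ₂ * quotient (pos 2 ℤ.* n) n)
        ≈⟨ θ₂·L ⟩
      θ₂ * L ∎
      where
      open Second

      sumA : ∀ n → ∑ℤ (λ s → sgnℤ s * (sgnℤ n * quotient (A s n) n)) ≈ θ₂ * quotient (pos 2 ℤ.* n) n
      sumA n = trans
        (∑ℤ-cong λ s → reflexive (≡.cong (λ u → sgnℤ s * (sgnℤ n * quotient (pos 3 ℤ.* (u ℤ.* u) ℤ.- u ℤ.+ pos 2 ℤ.* n) n)) (ℤ.+-comm s n)))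
        (θ₂-shift n n (λ k _ → trans (*-comm _ _) (sym (sgnℤ-+ n k))) ≡.refl)

      -- 3u² - 3u is invariant under u → 1-u, which reverses the sign. A shift by one turns this
      -- reflection into the pairing of m with -1-m built into `∑ℤ`.
      sumB : ∀ n → ∑ℤ (λ s → sgnℤ s * (sgnℤ n * quotient (B s n) n)) ≈ 0#
      sumB n = begin
        ∑ℤ (λ s → sgnℤ s * (sgnℤ n * quotient (B s n) n))
          ≈⟨ ∑ℤ-cong (λ s → trans (sym (*-assoc _ _ _)) (*-cong
               (trans (*-comm _ _) (trans (*-congʳ (sym (sgnℤ-neg n))) (sym (sgnℤ-+ (ℤ.- n) s))))
               (reflexive (≡.cong (λ u → quotient (q u ℤ.+ c) n) (ℤ.+-comm s (ℤ.- n)))))) ⟩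
        ∑ℤ (λ s → f (ℤ.- n ℤ.+ s))
          ≈⟨ ∑ℤ-shiftℤ (ℤ.- n) {f} (λ j j≤ i → order-*ʳ (sgnℤ (j ℤ.+ i)) (order-quotient-+ (q (j ℤ.+ i)) c n (bound j i
               (ℕ.≤-trans j≤ (ℕ.≤-reflexive (ℤ.∣-i∣≡∣i∣ n)))))) ⟩
        ∑ℤ f
          ≈⟨ ∑ℤ-suc {f} (λ i → order-*ʳ (sgnℤ i) (order-quotient-+ (q i) c n
               (≡.subst (λ k → pos ∣ i ∣ ℤ.≤ q k ℤ.+ val c n) (ℤ.+-identityˡ i) (bound (pos 0) i z≤n)))) ⟨
        ∑ℤ (f ∘ ℤ.suc)
          ≈⟨ trans (∑ℤ-def _) (∑∞-0 vanish) ⟩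
        0# ∎
        where
        c : ℤ
        c = pos 4 ℤ.* n ℤ.+ pos 1

        q : ℤ → ℤ
        q u = pos 3 ℤ.* (u ℤ.* u) ℤ.- pos 3 ℤ.* u

        f : ℤ → PS
        f k = sgnℤ k * quotient (q k ℤ.+ c) n

        bound : ∀ j i → ∣ j ∣ ℕ.≤ ∣ n ∣ → pos ∣ i ∣ ℤ.≤ q (j ℤ.+ i) ℤ.+ val c n
        bound j i j≤ = ℤ.≤-trans (shifted-bound {i} {j} {n} (∣∣≤3u²-3u+1 (j ℤ.+ i)) j≤ (∣∣≤val-1 n))
          (ℤ.≤-reflexive (regroup (q (j ℤ.+ i)) (val c n)))

        q-symmetric : ∀ m → q (ℤ.suc -[1+ m ]) ≡ q (ℤ.suc (pos m))
        q-symmetric m = eq (pos m)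
          where
          eq : ∀ M → pos 3 ℤ.* ((pos 1 ℤ.+ ℤ.- (pos 1 ℤ.+ M)) ℤ.* (pos 1 ℤ.+ ℤ.- (pos 1 ℤ.+ M))) ℤ.- pos 3 ℤ.* (pos 1 ℤ.+ ℤ.- (pos 1 ℤ.+ M))
            ≡ pos 3 ℤ.* ((pos 1 ℤ.+ M) ℤ.* (pos 1 ℤ.+ M)) ℤ.- pos 3 ℤ.* (pos 1 ℤ.+ M)
          eq = ℤ-solve-∀

        vanish : ∀ m → f (ℤ.suc (pos m)) + f (ℤ.suc -[1+ m ]) ≈ 0#
        vanish m = begin
          sgnℤ (ℤ.suc (pos m)) * quotient (q (ℤ.suc (pos m)) ℤ.+ c) n + sgnℤ (ℤ.suc -[1+ m ]) * quotient (q (ℤ.suc -[1+ m ]) ℤ.+ c) n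
            ≈⟨ +-cong (*-congʳ (sgnℤ-suc (pos m))) (*-cong (sgnℤ-suc -[1+ m ]) (reflexive (≡.cong (λ t → quotient (t ℤ.+ c) n) (q-symmetric m)))) ⟩
          - sgn m * quotient (q (ℤ.suc (pos m)) ℤ.+ c) n + - - sgn m * quotient (q (ℤ.suc (pos m)) ℤ.+ c) n
            ≈⟨ solve 2 (λ a b → (:- a) :* b :+ (:- (:- a)) :* b := con ℤ.0ℤ) refl _ _ ⟩
          0# ∎

-- Product formulas for the theta series and the equation for F

module ThetaProducts (R : CommutativeRing 0ℓ 0ℓ) where
  open PowerSeries R
  open CommutativeRing FPS
  open Exp commutativeSemiring using (_^_; ^-homo-*; ^-assocʳ; ^-congʳ; ^-congˡ)
  open IntegerSolver FPS
  open FiniteSums FPS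
  open Limits R
  open EulerProducts R
  open AppellSums R
  open Bilateral R
  open AppellIdentities R
  open import Relation.Binary.Reasoning.Setoid setoid

  tri-square : ∀ k → tri k ℕ.+ tri k ℕ.+ k ≡ k ℕ.* k
  tri-square zero = ≡.refl
  tri-square (suc k) = ≡.trans (eq (tri k) k) (≡.trans (≡.cong (λ s → s ℕ.+ (k ℕ.+ k ℕ.+ 1)) (tri-square k)) (eq′ k))
    where
    eq : ∀ t k → (t ℕ.+ k) ℕ.+ (t ℕ.+ k) ℕ.+ suc k ≡ t ℕ.+ t ℕ.+ k ℕ.+ (k ℕ.+ k ℕ.+ 1)
    eq = solve-∀
    eq′ : ∀ k → k ℕ.* k ℕ.+ (k ℕ.+ k ℕ.+ 1) ≡ suc k ℕ.* suc k
    eq′ = solve-∀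

  order-^₊ : ∀ {y} → y ≈[ 1 ] 0# → ∀ n → 1 ℕ.≤ n → y ^ n ≈[ 1 ] 0#
  order-^₊ p n 1≤n = []-weaken 1≤n (order-^ p n)

  φ : PS → PS
  φ y = ∑ℤ (λ k → sgnℤ k * y ^ (∣ k ∣ ℕ.* ∣ k ∣))

  φ-product : ∀ {y} → y ≈[ 1 ] 0# → φ y ≈ poch y (y ^ 2) * poch y (y ^ 2) * E (y ^ 2)
  φ-product {y} order-y = begin
    φ y                                                                ≈⟨ trans (∑ℤ-def _) (∑∞-cong term) ⟩
    ∑∞ (λ k → sgn k * Q ^ tri k * (y ^ k - Q ^ k * y ^ suc k))         ≈⟨ Base.triple-product order-Q order-y order-y (solve 1 (λ y → y :* y := y :* (y :* con ℤ.1ℤ)) refl y) ⟩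
    poch y Q * poch y Q * E Q                                          ∎
    where
    Q : PS
    Q = y ^ 2

    order-Q : Q ≈[ 1 ] 0#
    order-Q = order-^₊ order-y 2 (s≤s z≤n)

    term : ∀ k → sgn k * y ^ (k ℕ.* k) + - sgn k * y ^ (suc k ℕ.* suc k) ≈ sgn k * Q ^ tri k * (y ^ k - Q ^ k * y ^ suc k)
    term k = begin
      sgn k * y ^ (k ℕ.* k) + - sgn k * y ^ (suc k ℕ.* suc k)
        ≡⟨ ≡.cong₂ (λ a b → sgn k * y ^ a + - sgn k * y ^ b) (≡.trans (≡.sym (tri-square k)) (eq₁ (tri k) k))
             (≡.trans (eq₂ k) (≡.trans (≡.cong (λ t → t ℕ.+ (k ℕ.+ k ℕ.+ 1)) (≡.sym (tri-square k))) (eq₃ (tri k) k))) ⟩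
      sgn k * y ^ (2 ℕ.* tri k ℕ.+ k) + - sgn k * y ^ (2 ℕ.* tri k ℕ.+ 2 ℕ.* k ℕ.+ suc k)
        ≈⟨ +-cong (*-congˡ (trans (^-homo-* y (2 ℕ.* tri k) k) (*-congʳ (sym (^-assocʳ y 2 (tri k))))))
             (*-congˡ (trans (^-homo-* y (2 ℕ.* tri k ℕ.+ 2 ℕ.* k) (suc k)) (*-congʳ (trans (^-homo-* y (2 ℕ.* tri k) (2 ℕ.* k))
               (*-cong (sym (^-assocʳ y 2 (tri k))) (sym (^-assocʳ y 2 k))))))) ⟩
      sgn k * (Q ^ tri k * y ^ k) + - sgn k * (Q ^ tri k * Q ^ k * y ^ suc k)
        ≈⟨ solve 5 (λ s t a b c → s :* (t :* a) :+ (:- s) :* (t :* b :* c) := s :* t :* (a :- b :* c)) refl _ _ _ _ _ ⟩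
      sgn k * Q ^ tri k * (y ^ k - Q ^ k * y ^ suc k) ∎
      where
      eq₁ : ∀ t k → t ℕ.+ t ℕ.+ k ≡ 2 ℕ.* t ℕ.+ k
      eq₁ = solve-∀
      eq₂ : ∀ k → suc k ℕ.* suc k ≡ k ℕ.* k ℕ.+ (k ℕ.+ k ℕ.+ 1)
      eq₂ = solve-∀
      eq₃ : ∀ t k → t ℕ.+ t ℕ.+ k ℕ.+ (k ℕ.+ k ℕ.+ 1) ≡ 2 ℕ.* t ℕ.+ 2 ℕ.* k ℕ.+ suc k
      eq₃ = solve-∀

  ∏∞-*₃ : ∀ {f g h} → Multipliable f → Multipliable g → Multipliable h →
    ∏∞ (λ k → 1# * f k * g k * h k) ≈ ∏∞ f * ∏∞ g * ∏∞ h
  ∏∞-*₃ {f} {g} {h} s t u = begin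
    ∏∞ (λ k → 1# * f k * g k * h k)    ≈⟨ ∏∞-cong (λ k → *-congʳ (*-congʳ (*-identityˡ _))) ⟩
    ∏∞ (λ k → f k * g k * h k)         ≈⟨ ∏∞-* (Multipliable-* s t) u ⟩
    ∏∞ (λ k → f k * g k) * ∏∞ h        ≈⟨ *-congʳ (∏∞-* s t) ⟩
    ∏∞ f * ∏∞ g * ∏∞ h                 ∎

  private
    ^-factor : ∀ y a q k n → n ≡ a ℕ.+ q ℕ.* k → 1# - y ^ n ≈ 1# - y ^ a * (y ^ q) ^ k
    ^-factor y a q k n eq = +-congˡ (-‿cong (trans (^-congʳ y eq)
      (trans (^-homo-* y a (q ℕ.* k)) (*-congˡ (sym (^-assocʳ y q k))))))

    ^-power : ∀ y q k n → n ≡ q ℕ.* suc k → 1# - y ^ n ≈ 1# - (y ^ q) ^ suc k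
    ^-power y q k n eq = +-congˡ (-‿cong (trans (^-congʳ y eq) (sym (^-assocʳ y q (suc k)))))

  E-split₂ : ∀ {y} → y ≈[ 1 ] 0# → E y ≈ poch y (y ^ 2) * E (y ^ 2)
  E-split₂ {y} o = begin
    E y ≈⟨ ∏∞-split 1 (E-multipliable o) ⟩
    ∏∞ (λ k → 1# * (1# - y ^ suc (k ℕ.* 2)) * (1# - y ^ suc (1 ℕ.+ k ℕ.* 2)))
      ≈⟨ ∏∞-cong (λ k → *-cong (trans (*-identityˡ _) (trans (^-factor y 1 2 k _ (e₁ k)) (+-congˡ (-‿cong (*-congʳ (*-identityʳ y))))))
           (^-power y 2 k _ (e₂ k))) ⟩
    ∏∞ (λ k → (1# - y * (y ^ 2) ^ k) * (1# - (y ^ 2) ^ suc k))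
      ≈⟨ ∏∞-* (poch-multipliable o o₂) (E-multipliable o₂) ⟩
    poch y (y ^ 2) * E (y ^ 2) ∎
    where
    o₂ = order-^₊ o 2 (s≤s z≤n)
    e₁ : ∀ k → suc (k ℕ.* 2) ≡ 1 ℕ.+ 2 ℕ.* k
    e₁ = solve-∀
    e₂ : ∀ k → suc (1 ℕ.+ k ℕ.* 2) ≡ 2 ℕ.* suc k
    e₂ = solve-∀

  E-split₃ : ∀ {y} → y ≈[ 1 ] 0# → E y ≈ poch y (y ^ 3) * poch (y ^ 2) (y ^ 3) * E (y ^ 3)
  E-split₃ {y} o = begin
    E y ≈⟨ ∏∞-split 2 (E-multipliable o) ⟩
    ∏∞ (λ k → 1# * (1# - y ^ suc (k ℕ.* 3)) * (1# - y ^ suc (1 ℕ.+ k ℕ.* 3)) * (1# - y ^ suc (2 ℕ.+ k ℕ.* 3)))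
      ≈⟨ ∏∞-cong (λ k → *-cong (*-cong (*-congˡ (trans (^-factor y 1 3 k _ (e₁ k)) (+-congˡ (-‿cong (*-congʳ (*-identityʳ y))))))
           (^-factor y 2 3 k _ (e₂ k))) (^-power y 3 k _ (e₃ k))) ⟩
    ∏∞ (λ k → 1# * (1# - y * (y ^ 3) ^ k) * (1# - y ^ 2 * (y ^ 3) ^ k) * (1# - (y ^ 3) ^ suc k))
      ≈⟨ ∏∞-*₃ (poch-multipliable o o₃) (poch-multipliable (order-^₊ o 2 (s≤s z≤n)) o₃) (E-multipliable o₃) ⟩
    poch y (y ^ 3) * poch (y ^ 2) (y ^ 3) * E (y ^ 3) ∎
    where
    o₃ = order-^₊ o 3 (s≤s z≤n)
    e₁ : ∀ k → suc (k ℕ.* 3) ≡ 1 ℕ.+ 3 ℕ.* k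
    e₁ = solve-∀
    e₂ : ∀ k → suc (1 ℕ.+ k ℕ.* 3) ≡ 2 ℕ.+ 3 ℕ.* k
    e₂ = solve-∀
    e₃ : ∀ k → suc (2 ℕ.+ k ℕ.* 3) ≡ 3 ℕ.* suc k
    e₃ = solve-∀

  poch-split₃ : ∀ {y} → y ≈[ 1 ] 0# → poch y (y ^ 2) ≈ poch y (y ^ 6) * poch (y ^ 3) (y ^ 6) * poch (y ^ 5) (y ^ 6)
  poch-split₃ {y} o = begin
    poch y (y ^ 2) ≈⟨ ∏∞-split 2 (poch-multipliable o (order-^₊ o 2 (s≤s z≤n))) ⟩
    ∏∞ (λ k → 1# * (1# - y * (y ^ 2) ^ (k ℕ.* 3)) * (1# - y * (y ^ 2) ^ (1 ℕ.+ k ℕ.* 3)) * (1# - y * (y ^ 2) ^ (2 ℕ.+ k ℕ.* 3)))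
      ≈⟨ ∏∞-cong (λ k → *-cong (*-cong (*-congˡ (trans (factor k (k ℕ.* 3) 1 (e₁ k)) (+-congˡ (-‿cong (*-congʳ (*-identityʳ y))))))
           (factor k (1 ℕ.+ k ℕ.* 3) 3 (e₂ k))) (factor k (2 ℕ.+ k ℕ.* 3) 5 (e₃ k))) ⟩
    ∏∞ (λ k → 1# * (1# - y * (y ^ 6) ^ k) * (1# - y ^ 3 * (y ^ 6) ^ k) * (1# - y ^ 5 * (y ^ 6) ^ k))
      ≈⟨ ∏∞-*₃ (poch-multipliable o o₆) (poch-multipliable (order-^₊ o 3 (s≤s z≤n)) o₆) (poch-multipliable (order-^₊ o 5 (s≤s z≤n)) o₆) ⟩
    poch y (y ^ 6) * poch (y ^ 3) (y ^ 6) * poch (y ^ 5) (y ^ 6) ∎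
    where
    o₆ = order-^₊ o 6 (s≤s z≤n)
    factor : ∀ k n a → suc (2 ℕ.* n) ≡ a ℕ.+ 6 ℕ.* k → 1# - y * (y ^ 2) ^ n ≈ 1# - y ^ a * (y ^ 6) ^ k
    factor k n a eq = trans (+-congˡ (-‿cong (*-congˡ (^-assocʳ y 2 n)))) (^-factor y a 6 k _ eq)
    e₁ : ∀ k → suc (2 ℕ.* (k ℕ.* 3)) ≡ 1 ℕ.+ 6 ℕ.* k
    e₁ = solve-∀
    e₂ : ∀ k → suc (2 ℕ.* (1 ℕ.+ k ℕ.* 3)) ≡ 3 ℕ.+ 6 ℕ.* k
    e₂ = solve-∀
    e₃ : ∀ k → suc (2 ℕ.* (2 ℕ.+ k ℕ.* 3)) ≡ 5 ℕ.+ 6 ℕ.* k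
    e₃ = solve-∀

  module Theta {x : PS} (order-x : x ≈[ 1 ] 0#) where
    open Lambert order-x
    open Identities order-x

    private
      o₆ : x ^ 6 ≈[ 1 ] 0#
      o₆ = order-^₊ order-x 6 (s≤s z≤n)

    -- Exponents are put in the form 6 k(k-1)/2 + v k + w of the triple product with base x^6.
    X-quadratic : ∀ k v w {e} → let K = pos k in
      e ≡ pos 3 ℤ.* (K ℤ.* K) ℤ.- pos 3 ℤ.* K ℤ.+ (pos v ℤ.* K ℤ.+ pos w) →
      X e ≈ (x ^ 6) ^ tri k * x ^ (v ℕ.* k ℕ.+ w)
    X-quadratic k v w {e} e≡ = begin
      X e                                          ≡⟨ ≡.cong X (≡.trans e≡ (≡.trans (≡.cong (λ s → pos 3 ℤ.* s ℤ.- pos 3 ℤ.* K ℤ.+ (pos v ℤ.* K ℤ.+ pos w)) K²)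
                                                        (≡.trans (eq (pos (tri k)) K (pos v) (pos w))
                                                          (≡.cong₂ ℤ._+_ (≡.sym (ℤ.pos-* 6 (tri k))) (≡.cong (ℤ._+ pos w) (≡.sym (ℤ.pos-* v k))))))) ⟩
      x ^ (6 ℕ.* tri k ℕ.+ (v ℕ.* k ℕ.+ w))        ≈⟨ trans (^-homo-* x (6 ℕ.* tri k) _) (*-congʳ (sym (^-assocʳ x 6 (tri k)))) ⟩
      (x ^ 6) ^ tri k * x ^ (v ℕ.* k ℕ.+ w)        ∎
      where
      K : ℤ
      K = pos k
      K² : K ℤ.* K ≡ pos (tri k) ℤ.+ pos (tri k) ℤ.+ K
      K² = ≡.trans (≡.sym (ℤ.pos-* k k)) (≡.cong pos (≡.sym (tri-square k)))
      eq : ∀ T K V W → pos 3 ℤ.* (T ℤ.+ T ℤ.+ K) ℤ.- pos 3 ℤ.* K ℤ.+ (V ℤ.* K ℤ.+ W) ≡ pos 6 ℤ.* T ℤ.+ (V ℤ.* K ℤ.+ W)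
      eq = ℤ-solve-∀

    θ-product : ∀ a b → 1 ℕ.≤ a → 1 ℕ.≤ b → a ℕ.+ b ≡ 6 → (e : ℤ → ℤ) →
      (∀ k → X (e (pos k)) ≈ (x ^ 6) ^ tri k * x ^ (a ℕ.* k ℕ.+ 0)) →
      (∀ k → X (e -[1+ k ]) ≈ (x ^ 6) ^ tri k * x ^ ((6 ℕ.+ b) ℕ.* k ℕ.+ b)) →
      ∑ℤ (λ k → sgnℤ k * X (e k)) ≈ poch (x ^ a) (x ^ 6) * poch (x ^ b) (x ^ 6) * E (x ^ 6)
    θ-product a b 1≤a 1≤b a+b≡6 e e⁺ e⁻ = begin
      ∑ℤ (λ k → sgnℤ k * X (e k))
        ≈⟨ trans (∑ℤ-def _) (∑∞-cong term) ⟩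
      ∑∞ (λ k → sgn k * (x ^ 6) ^ tri k * ((x ^ a) ^ k - (x ^ 6) ^ k * (x ^ b) ^ suc k))
        ≈⟨ Base.triple-product o₆ (order-^₊ order-x a 1≤a) (order-^₊ order-x b 1≤b)
             (trans (sym (^-homo-* x a b)) (^-congʳ x a+b≡6)) ⟩
      poch (x ^ a) (x ^ 6) * poch (x ^ b) (x ^ 6) * E (x ^ 6) ∎
      where
      term : ∀ k → sgn k * X (e (pos k)) + - sgn k * X (e -[1+ k ])
        ≈ sgn k * (x ^ 6) ^ tri k * ((x ^ a) ^ k - (x ^ 6) ^ k * (x ^ b) ^ suc k)
      term k = begin
        sgn k * X (e (pos k)) + - sgn k * X (e -[1+ k ])
          ≈⟨ +-cong (*-congˡ (e⁺ k)) (*-congˡ (e⁻ k)) ⟩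
        sgn k * (t * x ^ (a ℕ.* k ℕ.+ 0)) + - sgn k * (t * x ^ ((6 ℕ.+ b) ℕ.* k ℕ.+ b))
          ≈⟨ +-cong (*-congˡ (*-congˡ (trans (^-congʳ x (ℕ.+-identityʳ (a ℕ.* k))) (sym (^-assocʳ x a k)))))
               (*-congˡ (*-congˡ (trans (^-congʳ x (eq b k)) (trans (^-homo-* x (6 ℕ.* k) (b ℕ.* suc k))
                 (*-cong (sym (^-assocʳ x 6 k)) (sym (^-assocʳ x b (suc k)))))))) ⟩
        sgn k * (t * (x ^ a) ^ k) + - sgn k * (t * ((x ^ 6) ^ k * (x ^ b) ^ suc k))
          ≈⟨ solve 4 (λ s t a b → s :* (t :* a) :+ (:- s) :* (t :* b) := s :* t :* (a :- b)) refl _ _ _ _ ⟩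
        sgn k * t * ((x ^ a) ^ k - (x ^ 6) ^ k * (x ^ b) ^ suc k) ∎
        where
        t : PS
        t = (x ^ 6) ^ tri k
        eq : ∀ b k → (6 ℕ.+ b) ℕ.* k ℕ.+ b ≡ 6 ℕ.* k ℕ.+ b ℕ.* suc k
        eq = solve-∀

    θ₂-product : θ₂ ≈ poch (x ^ 2) (x ^ 6) * poch (x ^ 4) (x ^ 6) * E (x ^ 6)
    θ₂-product = θ-product 2 4 (s≤s z≤n) (s≤s z≤n) ≡.refl (λ k → pos 3 ℤ.* (k ℤ.* k) ℤ.- k)
      (λ k → X-quadratic k 2 0 (e⁺ (pos k))) (λ k → X-quadratic k 10 4 (e⁻ (pos k)))
      where
      e⁺ : ∀ K → pos 3 ℤ.* (K ℤ.* K) ℤ.- K ≡ pos 3 ℤ.* (K ℤ.* K) ℤ.- pos 3 ℤ.* K ℤ.+ (pos 2 ℤ.* K ℤ.+ pos 0)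
      e⁺ = ℤ-solve-∀
      e⁻ : ∀ K → pos 3 ℤ.* (ℤ.- (pos 1 ℤ.+ K) ℤ.* ℤ.- (pos 1 ℤ.+ K)) ℤ.- ℤ.- (pos 1 ℤ.+ K)
        ≡ pos 3 ℤ.* (K ℤ.* K) ℤ.- pos 3 ℤ.* K ℤ.+ (pos 10 ℤ.* K ℤ.+ pos 4)
      e⁻ = ℤ-solve-∀

    θ₂′ : PS
    θ₂′ = ∑ℤ (λ k → sgnℤ k * X (pos 3 ℤ.* (k ℤ.* k) ℤ.+ k))

    θ₂′⁺ : ∀ k → X (pos 3 ℤ.* (pos k ℤ.* pos k) ℤ.+ pos k) ≈ (x ^ 6) ^ tri k * x ^ (4 ℕ.* k ℕ.+ 0)
    θ₂′⁺ k = X-quadratic k 4 0 (eq (pos k))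
      where
      eq : ∀ K → pos 3 ℤ.* (K ℤ.* K) ℤ.+ K ≡ pos 3 ℤ.* (K ℤ.* K) ℤ.- pos 3 ℤ.* K ℤ.+ (pos 4 ℤ.* K ℤ.+ pos 0)
      eq = ℤ-solve-∀

    θ₂′⁻ : ∀ k → X (pos 3 ℤ.* (-[1+ k ] ℤ.* -[1+ k ]) ℤ.+ -[1+ k ]) ≈ (x ^ 6) ^ tri k * x ^ (8 ℕ.* k ℕ.+ 2)
    θ₂′⁻ k = X-quadratic k 8 2 (eq (pos k))
      where
      eq : ∀ K → pos 3 ℤ.* (ℤ.- (pos 1 ℤ.+ K) ℤ.* ℤ.- (pos 1 ℤ.+ K)) ℤ.+ ℤ.- (pos 1 ℤ.+ K)
        ≡ pos 3 ℤ.* (K ℤ.* K) ℤ.- pos 3 ℤ.* K ℤ.+ (pos 8 ℤ.* K ℤ.+ pos 2)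
      eq = ℤ-solve-∀

    θ₂′-product : θ₂′ ≈ poch (x ^ 4) (x ^ 6) * poch (x ^ 2) (x ^ 6) * E (x ^ 6)
    θ₂′-product = θ-product 4 2 (s≤s z≤n) (s≤s z≤n) ≡.refl (λ k → pos 3 ℤ.* (k ℤ.* k) ℤ.+ k) θ₂′⁺ θ₂′⁻

    θ₁-product : θ₁ ≈ poch (x ^ 1) (x ^ 6) * poch (x ^ 5) (x ^ 6) * E (x ^ 6)
    θ₁-product = θ-product 1 5 (s≤s z≤n) (s≤s z≤n) ≡.refl (λ k → pos 3 ℤ.* (k ℤ.* k) ℤ.- pos 2 ℤ.* k)
      (λ k → X-quadratic k 1 0 (e⁺ (pos k))) (λ k → X-quadratic k 11 5 (e⁻ (pos k)))
      where
      e⁺ : ∀ K → pos 3 ℤ.* (K ℤ.* K) ℤ.- pos 2 ℤ.* K ≡ pos 3 ℤ.* (K ℤ.* K) ℤ.- pos 3 ℤ.* K ℤ.+ (pos 1 ℤ.* K ℤ.+ pos 0)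
      e⁺ = ℤ-solve-∀
      e⁻ : ∀ K → pos 3 ℤ.* (ℤ.- (pos 1 ℤ.+ K) ℤ.* ℤ.- (pos 1 ℤ.+ K)) ℤ.- pos 2 ℤ.* ℤ.- (pos 1 ℤ.+ K)
        ≡ pos 3 ℤ.* (K ℤ.* K) ℤ.- pos 3 ℤ.* K ℤ.+ (pos 11 ℤ.* K ℤ.+ pos 5)
      e⁻ = ℤ-solve-∀

    θ₀-product : θ₀ ≈ poch (x ^ 3) (x ^ 6) * poch (x ^ 3) (x ^ 6) * E (x ^ 6)
    θ₀-product = θ-product 3 3 (s≤s z≤n) (s≤s z≤n) ≡.refl (λ k → pos 3 ℤ.* (k ℤ.* k))
      (λ k → X-quadratic k 3 0 (e⁺ (pos k))) (λ k → X-quadratic k 9 3 (e⁻ (pos k)))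
      where
      e⁺ : ∀ K → pos 3 ℤ.* (K ℤ.* K) ≡ pos 3 ℤ.* (K ℤ.* K) ℤ.- pos 3 ℤ.* K ℤ.+ (pos 3 ℤ.* K ℤ.+ pos 0)
      e⁺ = ℤ-solve-∀
      e⁻ : ∀ K → pos 3 ℤ.* (ℤ.- (pos 1 ℤ.+ K) ℤ.* ℤ.- (pos 1 ℤ.+ K))
        ≡ pos 3 ℤ.* (K ℤ.* K) ℤ.- pos 3 ℤ.* K ℤ.+ (pos 9 ℤ.* K ℤ.+ pos 3)
      e⁻ = ℤ-solve-∀

    private
      o₅ : x ^ 5 ≈[ 1 ] 0#
      o₅ = order-^₊ order-x 5 (s≤s z≤n)

    module A = Appell o₆ order-x o₅ refl

    -- (1 - uv) / ((1-u)(1-v)) = 1/(1-u) + v/(1-v) for u = x^(6k+1) and v = x^(6k+5): one term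
    -- splits into the bilateral terms k and -1-k.
    appell-term : ∀ k → A.c k ≈ sgn k * ((x ^ 6) ^ tri k * (x ^ 6) ^ k) * (I k + x ^ y⁻ k * J k)
    appell-term k = begin
      sgn k * t * P * (1# - P * P * x ^ 6) * (geometric (x * P) * geometric (x ^ 5 * P))
        ≈⟨ *-congˡ (*-cong (geometric-cong y≈) (geometric-cong z≈)) ⟩
      sgn k * t * P * (1# - P * P * x ^ 6) * (I k * J k)
        ≈⟨ solve 7 (λ s t P x x⁵ i j → s :* t :* P :* (con ℤ.1ℤ :- P :* P :* (x :* x⁵)) :* (i :* j)
             := s :* (t :* P) :* (i :* (j :* (con ℤ.1ℤ :- x⁵ :* P)) :+ x⁵ :* P :* j :* (i :* (con ℤ.1ℤ :- x :* P))))
             refl (sgn k) t P x (x ^ 5) (I k) (J k) ⟩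
      sgn k * (t * P) * (I k * (J k * (1# - x ^ 5 * P)) + x ^ 5 * P * J k * (I k * (1# - x * P)))
        ≈⟨ *-congˡ (+-cong (*-congˡ (trans (*-congˡ (+-congˡ (-‿cong z≈))) (J-inverse k)))
             (*-cong (*-congʳ z≈) (trans (*-congˡ (+-congˡ (-‿cong y≈))) (I-inverse k)))) ⟩
      sgn k * (t * P) * (I k * 1# + x ^ y⁻ k * J k * 1#)
        ≈⟨ *-congˡ (+-cong (*-identityʳ _) (*-identityʳ _)) ⟩
      sgn k * (t * P) * (I k + x ^ y⁻ k * J k) ∎
      where
      t P : PS
      t = (x ^ 6) ^ tri k
      P = (x ^ 6) ^ k
      y≈ : x * P ≈ x ^ y⁺ k
      y≈ = trans (*-congˡ (^-assocʳ x 6 k)) (^-congʳ x (ℕ.+-comm 1 (6 ℕ.* k)))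
      z≈ : x ^ 5 * P ≈ x ^ y⁻ k
      z≈ = trans (*-congˡ (^-assocʳ x 6 k)) (trans (sym (^-homo-* x 5 (6 ℕ.* k))) (^-congʳ x (ℕ.+-comm 5 (6 ℕ.* k))))

    y⁻-split : ∀ k → pos (y⁻ k) ≡ pos 6 ℤ.* pos k ℤ.+ pos 5
    y⁻-split k = ≡.cong (ℤ._+ pos 5) (ℤ.pos-* 6 k)

    M-appell : First.M (pos 0) ≈ A.appell
    M-appell = trans (∑ℤ-def _) (∑∞-cong λ k → begin
      sgn k * (X (First.C (pos 0) (pos k)) * I k) + - sgn k * - (X (First.C (pos 0) -[1+ k ] ℤ.+ pos (y⁻ k)) * J k)
        ≈⟨ +-cong (*-congˡ (*-congʳ (X-quadratic k 6 0 (e⁺ (pos k)))))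
             (*-congˡ (-‿cong (*-congʳ (X-quadratic k 12 5 (≡.trans (≡.cong (λ t → First.C (pos 0) -[1+ k ] ℤ.+ t) (y⁻-split k)) (e⁻ (pos k))))))) ⟩
      sgn k * (t k * x ^ (6 ℕ.* k ℕ.+ 0) * I k) + - sgn k * - (t k * x ^ (12 ℕ.* k ℕ.+ 5) * J k)
        ≈⟨ +-cong (*-congˡ (*-congʳ (*-congˡ (trans (^-congʳ x (ℕ.+-identityʳ (6 ℕ.* k))) (sym (^-assocʳ x 6 k))))))
             (*-congˡ (-‿cong (*-congʳ (*-congˡ (trans (^-congʳ x (eq k)) (trans (^-homo-* x (6 ℕ.* k) (y⁻ k)) (*-congʳ (sym (^-assocʳ x 6 k))))))))) ⟩
      sgn k * (t k * (x ^ 6) ^ k * I k) + - sgn k * - (t k * ((x ^ 6) ^ k * x ^ y⁻ k) * J k)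
        ≈⟨ solve 6 (λ s t P i z j → s :* (t :* P :* i) :+ (:- s) :* (:- (t :* (P :* z) :* j)) := s :* (t :* P) :* (i :+ z :* j)) refl _ _ _ _ _ _ ⟩
      sgn k * (t k * (x ^ 6) ^ k) * (I k + x ^ y⁻ k * J k)
        ≈⟨ appell-term k ⟨
      A.c k ∎)
      where
      t : ℕ → PS
      t k = (x ^ 6) ^ tri k
      eq : ∀ k → 12 ℕ.* k ℕ.+ 5 ≡ 6 ℕ.* k ℕ.+ (6 ℕ.* k ℕ.+ 5)
      eq = solve-∀
      e⁺ : ∀ K → pos 3 ℤ.* ((pos 0 ℤ.- K) ℤ.* (pos 0 ℤ.- K)) ℤ.- (pos 0 ℤ.- K) ℤ.+ pos 2 ℤ.* K
        ≡ pos 3 ℤ.* (K ℤ.* K) ℤ.- pos 3 ℤ.* K ℤ.+ (pos 6 ℤ.* K ℤ.+ pos 0)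
      e⁺ = ℤ-solve-∀
      e⁻ : ∀ K → pos 3 ℤ.* ((pos 0 ℤ.- ℤ.- (pos 1 ℤ.+ K)) ℤ.* (pos 0 ℤ.- ℤ.- (pos 1 ℤ.+ K))) ℤ.- (pos 0 ℤ.- ℤ.- (pos 1 ℤ.+ K)) ℤ.+ pos 2 ℤ.* ℤ.- (pos 1 ℤ.+ K)
        ℤ.+ (pos 6 ℤ.* K ℤ.+ pos 5) ≡ pos 3 ℤ.* (K ℤ.* K) ℤ.- pos 3 ℤ.* K ℤ.+ (pos 12 ℤ.* K ℤ.+ pos 5)
      e⁻ = ℤ-solve-∀

    -- For n ≥ 0, (1+y)/(1-y) = 1 + 2y/(1-y); for n < 0, with z the inverse of y, (1+z)/(1-z) = -1 +
    -- 2/(1-z). The constants add up to `θ₂′`, and the rest is twice the series found in the class 0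
    -- mod 3.
    Θ-terms : Second.Θ (pos 0) ≈ θ₂′ + (∑∞ (λ k → sgn k * ((x ^ 6) ^ tri k * (x ^ 6) ^ k) * (x ^ (4 ℕ.* k ℕ.+ 1) * I k + x ^ (2 ℕ.* k ℕ.+ 2) * J k))
      + ∑∞ (λ k → sgn k * ((x ^ 6) ^ tri k * (x ^ 6) ^ k) * (x ^ (4 ℕ.* k ℕ.+ 1) * I k + x ^ (2 ℕ.* k ℕ.+ 2) * J k)))
    Θ-terms = begin
      Second.Θ (pos 0)        ≈⟨ trans (∑ℤ-def _) (∑∞-cong term) ⟩
      ∑∞ (λ k → u k + (v k + v k))          ≈⟨ trans (∑∞-+ _ _) (+-cong (sym (∑ℤ-def _)) (∑∞-+ _ _)) ⟩
      θ₂′ + (∑∞ v + ∑∞ v)     ∎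
      where
      t u v : ℕ → PS
      t k = (x ^ 6) ^ tri k
      u k = sgnℤ (pos k) * X (pos 3 ℤ.* (pos k ℤ.* pos k) ℤ.+ pos k) + sgnℤ -[1+ k ] * X (pos 3 ℤ.* (-[1+ k ] ℤ.* -[1+ k ]) ℤ.+ -[1+ k ])
      v k = sgn k * (t k * (x ^ 6) ^ k) * (x ^ (4 ℕ.* k ℕ.+ 1) * I k + x ^ (2 ℕ.* k ℕ.+ 2) * J k)

      A⁺ : ∀ K → pos 3 ℤ.* ((pos 0 ℤ.+ K) ℤ.* (pos 0 ℤ.+ K)) ℤ.- (pos 0 ℤ.+ K) ℤ.+ pos 2 ℤ.* K
        ≡ pos 3 ℤ.* (K ℤ.* K) ℤ.- pos 3 ℤ.* K ℤ.+ (pos 4 ℤ.* K ℤ.+ pos 0)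
      A⁺ = ℤ-solve-∀
      B⁺ : ∀ K → pos 3 ℤ.* ((pos 0 ℤ.- K) ℤ.* (pos 0 ℤ.- K)) ℤ.- pos 3 ℤ.* (pos 0 ℤ.- K) ℤ.+ (pos 4 ℤ.* K ℤ.+ pos 1)
        ≡ pos 3 ℤ.* (K ℤ.* K) ℤ.- pos 3 ℤ.* K ℤ.+ (pos 10 ℤ.* K ℤ.+ pos 1)
      B⁺ = ℤ-solve-∀
      A⁻ : ∀ K → pos 3 ℤ.* ((pos 0 ℤ.+ ℤ.- (pos 1 ℤ.+ K)) ℤ.* (pos 0 ℤ.+ ℤ.- (pos 1 ℤ.+ K))) ℤ.- (pos 0 ℤ.+ ℤ.- (pos 1 ℤ.+ K)) ℤ.+ pos 2 ℤ.* ℤ.- (pos 1 ℤ.+ K)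
        ℤ.+ (pos 6 ℤ.* K ℤ.+ pos 5) ≡ pos 3 ℤ.* (K ℤ.* K) ℤ.- pos 3 ℤ.* K ℤ.+ (pos 14 ℤ.* K ℤ.+ pos 7)
      A⁻ = ℤ-solve-∀
      B⁻ : ∀ K → pos 3 ℤ.* ((pos 0 ℤ.- ℤ.- (pos 1 ℤ.+ K)) ℤ.* (pos 0 ℤ.- ℤ.- (pos 1 ℤ.+ K))) ℤ.- pos 3 ℤ.* (pos 0 ℤ.- ℤ.- (pos 1 ℤ.+ K)) ℤ.+ (pos 4 ℤ.* ℤ.- (pos 1 ℤ.+ K) ℤ.+ pos 1)
        ℤ.+ (pos 6 ℤ.* K ℤ.+ pos 5) ≡ pos 3 ℤ.* (K ℤ.* K) ℤ.- pos 3 ℤ.* K ℤ.+ (pos 8 ℤ.* K ℤ.+ pos 2)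
      B⁻ = ℤ-solve-∀

      e₁ : ∀ k → 10 ℕ.* k ℕ.+ 1 ≡ 6 ℕ.* k ℕ.+ (4 ℕ.* k ℕ.+ 1)
      e₁ = solve-∀
      e₂ : ∀ k → 8 ℕ.* k ℕ.+ 2 ≡ 6 ℕ.* k ℕ.+ (2 ℕ.* k ℕ.+ 2)
      e₂ = solve-∀
      e₃ : ∀ k → 10 ℕ.* k ℕ.+ 1 ≡ (4 ℕ.* k ℕ.+ 0) ℕ.+ (6 ℕ.* k ℕ.+ 1)
      e₃ = solve-∀
      e₄ : ∀ k → 14 ℕ.* k ℕ.+ 7 ≡ (8 ℕ.* k ℕ.+ 2) ℕ.+ (6 ℕ.* k ℕ.+ 5)
      e₄ = solve-∀

      x₆ : ∀ k {n} m → n ≡ 6 ℕ.* k ℕ.+ m → x ^ n ≈ (x ^ 6) ^ k * x ^ m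
      x₆ k m eq = trans (^-congʳ x eq) (trans (^-homo-* x (6 ℕ.* k) m) (*-congʳ (sym (^-assocʳ x 6 k))))

      term : ∀ k → sgnℤ (pos k) * (X (Second.A (pos 0) (pos k)) * I k + X (Second.B (pos 0) (pos k)) * I k)
        + sgnℤ -[1+ k ] * (- (X (Second.A (pos 0) -[1+ k ] ℤ.+ pos (y⁻ k)) * J k) + - (X (Second.B (pos 0) -[1+ k ] ℤ.+ pos (y⁻ k)) * J k))
        ≈ u k + (v k + v k)
      term k = begin
        _ ≈⟨ +-cong (*-congˡ (+-cong (*-congʳ (X-quadratic k 4 0 (A⁺ (pos k)))) (*-congʳ (X-quadratic k 10 1 (B⁺ (pos k))))))
               (*-congˡ (+-cong
                 (-‿cong (*-congʳ (X-quadratic k 14 7 (≡.trans (≡.cong (λ t → Second.A (pos 0) -[1+ k ] ℤ.+ t) (y⁻-split k)) (A⁻ (pos k))))))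
                 (-‿cong (*-congʳ (X-quadratic k 8 2 (≡.trans (≡.cong (λ t → Second.B (pos 0) -[1+ k ] ℤ.+ t) (y⁻-split k)) (B⁻ (pos k)))))))) ⟩
        sgn k * (t k * x⁴ᵏ * I k + t k * x ^ (10 ℕ.* k ℕ.+ 1) * I k)
          + - sgn k * (- (t k * x ^ (14 ℕ.* k ℕ.+ 7) * J k) + - (t k * x⁸ᵏ * J k))
          ≈⟨ +-cong (*-congˡ (+-congˡ (*-congʳ (*-congˡ (trans (^-congʳ x (e₃ k)) (^-homo-* x (4 ℕ.* k ℕ.+ 0) (y⁺ k)))))))
               (*-congˡ (+-congʳ (-‿cong (*-congʳ (*-congˡ (trans (^-congʳ x (e₄ k)) (^-homo-* x (8 ℕ.* k ℕ.+ 2) (y⁻ k)))))))) ⟩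
        sgn k * (t k * x⁴ᵏ * I k + t k * (x⁴ᵏ * Y) * I k) + - sgn k * (- (t k * (x⁸ᵏ * Z) * J k) + - (t k * x⁸ᵏ * J k))
          ≈⟨ solve 8 (λ s t a b Y Z i j →
               s :* (t :* a :* i :+ t :* (a :* Y) :* i) :+ (:- s) :* (:- (t :* (b :* Z) :* j) :+ :- (t :* b :* j))
               := (s :* (t :* (a :* (i :* (con ℤ.1ℤ :- Y)))) :+ (:- s) :* (t :* (b :* (j :* (con ℤ.1ℤ :- Z)))))
                  :+ (s :* t :* ((a :* Y) :* i :+ b :* j) :+ s :* t :* ((a :* Y) :* i :+ b :* j)))
               refl (sgn k) (t k) x⁴ᵏ x⁸ᵏ Y Z (I k) (J k) ⟩
        (sgn k * (t k * (x⁴ᵏ * (I k * (1# - Y)))) + - sgn k * (t k * (x⁸ᵏ * (J k * (1# - Z)))))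
          + (sgn k * t k * ((x⁴ᵏ * Y) * I k + x⁸ᵏ * J k) + sgn k * t k * ((x⁴ᵏ * Y) * I k + x⁸ᵏ * J k))
          ≈⟨ +-cong (+-cong (*-congˡ (trans (*-congˡ (trans (*-congˡ (I-inverse k)) (*-identityʳ _))) (sym (θ₂′⁺ k))))
                 (*-congˡ (trans (*-congˡ (trans (*-congˡ (J-inverse k)) (*-identityʳ _))) (sym (θ₂′⁻ k)))))
               (+-cong v≈ v≈) ⟩
        u k + (v k + v k) ∎
        where
        Y Z x⁴ᵏ x⁸ᵏ : PS
        Y = x ^ y⁺ k
        Z = x ^ y⁻ k
        x⁴ᵏ = x ^ (4 ℕ.* k ℕ.+ 0)
        x⁸ᵏ = x ^ (8 ℕ.* k ℕ.+ 2)
        v≈ : sgn k * t k * ((x⁴ᵏ * Y) * I k + x⁸ᵏ * J k) ≈ v k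
        v≈ = trans (*-congˡ (+-cong (*-congʳ (trans (sym (^-homo-* x (4 ℕ.* k ℕ.+ 0) (y⁺ k)))
              (trans (^-congʳ x (≡.sym (e₃ k))) (x₆ k (4 ℕ.* k ℕ.+ 1) (e₁ k)))))
              (*-congʳ (x₆ k (2 ℕ.* k ℕ.+ 2) (e₂ k)))))
          (solve 7 (λ s t P a i b j → s :* t :* (P :* a :* i :+ P :* b :* j) := s :* (t :* P) :* (a :* i :+ b :* j)) refl _ _ _ _ _ _ _)

  ^-cong : ∀ {f g} → f ≈ g → ∀ n → f ^ n ≈ g ^ n
  ^-cong f≈g n = ^-congˡ n f≈g

  poch-cong : ∀ {α α′ Q Q′} → α ≈ α′ → Q ≈ Q′ → poch α Q ≈ poch α′ Q′
  poch-cong α≈ Q≈ = ∏∞-cong λ k → +-congˡ (-‿cong (*-cong α≈ (^-cong Q≈ k)))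

  E-cong : ∀ {y y′} → y ≈ y′ → E y ≈ E y′
  E-cong y≈ = ∏∞-cong λ k → +-congˡ (-‿cong (^-cong y≈ (suc k)))

  φ-cong : ∀ {y y′} → y ≈ y′ → φ y ≈ φ y′
  φ-cong y≈ = ∑ℤ-cong λ k → *-congˡ (^-cong y≈ (∣ k ∣ ℕ.* ∣ k ∣))

  E-even : ∀ {x} → x ≈[ 1 ] 0# → E (x ^ 2) ≈ poch (x ^ 2) (x ^ 6) * poch (x ^ 4) (x ^ 6) * E (x ^ 6)
  E-even {x} o = trans (E-split₃ (order-^₊ o 2 (s≤s z≤n)))
    (*-cong (*-cong (poch-cong refl (^-assocʳ x 2 3)) (poch-cong (^-assocʳ x 2 2) (^-assocʳ x 2 3))) (E-cong (^-assocʳ x 2 3)))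

  -- F is the residue class 0 mod 3 of ξ, with x = q³.
  φ-equation : ∀ {x} (o : x ≈[ 1 ] 0#) F →
    E (x ^ 2) * F ≈ AppellIdentities.Identities.Second.Θ R o (pos 0) → F * φ x ≈ φ (x ^ 3) * φ (x ^ 3)
  φ-equation {x} o F E·F≈Θ = begin
    F * φ x
      ≈⟨ *-congˡ (trans (φ-product o) (*-congʳ (*-cong x-odd x-odd))) ⟩
    F * (p₁ * p₃ * p₅ * (p₁ * p₃ * p₅) * E₂)
      ≈⟨ solve 5 (λ F a b c e → F :* (a :* b :* c :* (a :* b :* c) :* e) := b :* b :* (e :* F :* (a :* c) :* (a :* c))) refl F p₁ p₃ p₅ E₂ ⟩
    p₃ * p₃ * (E₂ * F * (p₁ * p₅) * (p₁ * p₅))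
      ≈⟨ *-congˡ reduced ⟩
    p₃ * p₃ * (E₆ * θ₀)
      ≈⟨ *-assoc _ _ _ ⟨
    p₃ * p₃ * E₆ * θ₀
      ≈⟨ *-cong (trans (sym θ₀-product) θ₀≈φ) θ₀≈φ ⟩
    φ (x ^ 3) * φ (x ^ 3) ∎
    where
    open Identities o
    open Theta o
    p₁ p₃ p₅ E₂ E₆ : PS
    p₁ = poch x (x ^ 6)
    p₃ = poch (x ^ 3) (x ^ 6)
    p₅ = poch (x ^ 5) (x ^ 6)
    E₂ = E (x ^ 2)
    E₆ = E (x ^ 6)

    o₆ : x ^ 6 ≈[ 1 ] 0#
    o₆ = order-^₊ o 6 (s≤s z≤n)

    x-odd : poch x (x ^ 2) ≈ p₁ * p₃ * p₅
    x-odd = poch-split₃ o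

    θ₀≈φ : θ₀ ≈ φ (x ^ 3)
    θ₀≈φ = ∑ℤ-cong λ k → *-congˡ (trans (^-congʳ x (≡.trans (ℤ.abs-* (pos 3) (k ℤ.* k)) (≡.cong (3 ℕ.*_) (ℤ.abs-* k k))))
      (sym (^-assocʳ x 3 (∣ k ∣ ℕ.* ∣ k ∣))))

    θ₁≈ : θ₁ ≈ p₁ * p₅ * E₆
    θ₁≈ = trans θ₁-product (*-congʳ (*-congʳ (poch-cong (*-identityʳ x) refl)))

    reduced : E₂ * F * (p₁ * p₅) * (p₁ * p₅) ≈ E₆ * θ₀
    reduced = *-cancelˡ-unit (E-unit o₆) (begin
      E₆ * (E₂ * F * (p₁ * p₅) * (p₁ * p₅))
        ≈⟨ solve 4 (λ e f p F → e :* (f :* F :* p :* p) := p :* e :* (f :* F) :* p) refl E₆ E₂ (p₁ * p₅) F ⟩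
      p₁ * p₅ * E₆ * (E₂ * F) * (p₁ * p₅)
        ≈⟨ *-congʳ (*-cong (sym θ₁≈) E·F≈Θ) ⟩
      θ₁ * Second.Θ (pos 0) * (p₁ * p₅)
        -- Both rearrangements end in `θ₂ * L`, which drops out here; `appell-product` then
        -- evaluates what is left.
        ≈⟨ *-congʳ (trans θ₁·Θ≈θ₂·L (sym θ₀·M≈θ₂·L)) ⟩
      θ₀ * First.M (pos 0) * (p₁ * p₅)
        ≈⟨ *-congʳ (*-congˡ M-appell) ⟩
      θ₀ * A.appell * (p₁ * p₅)
        ≈⟨ solve 3 (λ a b c → a :* b :* c := a :* (c :* b)) refl _ _ _ ⟩
      θ₀ * (p₁ * p₅ * A.appell)
        ≈⟨ *-congˡ A.appell-product ⟩
      θ₀ * (E₆ * E₆)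
        ≈⟨ solve 2 (λ a e → a :* (e :* e) := e :* (e :* a)) refl _ _ ⟩
      E₆ * (E₆ * θ₀) ∎)

-- Cubic dissection of φ, norms over a cube root of unity, and the equation for H

module CubicNorm (R : CommutativeRing 0ℓ 0ℓ) where
  open PowerSeries R
  open CommutativeRing FPS
  open Exp commutativeSemiring using (_^_; ^-assocʳ; ^-congʳ; ^-distrib-*)
  open IntegerSolver FPS
  open FiniteSums FPS
  open Limits R
  open EulerProducts R
  open Bilateral R
  open ThetaProducts R
  open QuadraticBounds
  open import Relation.Binary.Reasoning.Setoid setoid

  B : PS → PS
  B y = ∑ℤ (λ k → sgnℤ k * y ^ ∣ pos 3 ℤ.* (k ℤ.* k) ℤ.- pos 2 ℤ.* k ∣)

  -- The folded sum of 3N terms runs over the integers from -3N to 3N-1, which are exactly 3j, 3j+1,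
  -- 3j+2 for j from -N to N-1.
  ∑ℤ-split₃ : ∀ {f} → Summableℤ f →
    ∑ℤ f ≈ ∑ℤ (λ j → f (pos 3 ℤ.* j) + f (pos 3 ℤ.* j ℤ.+ pos 1) + f (pos 3 ℤ.* j ℤ.+ pos 2))
  ∑ℤ-split₃ {f} s = trans (∑ℤ-def f) (trans ([]-limit λ N → []-trans
    ([]-sym ([]-weaken (ℕ.m≤m*n N 3) (∑∞-truncate (fold-summable s) (N ℕ.* 3))))
    ([]-trans (≈⇒≈[] (go N)) (∑∞-truncate (fold-summable g-summable) N))) (sym (∑ℤ-def g)))
    where
    g : ℤ → PS
    g j = f (pos 3 ℤ.* j) + f (pos 3 ℤ.* j ℤ.+ pos 1) + f (pos 3 ℤ.* j ℤ.+ pos 2)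

    3·pos : ∀ n i → pos 3 ℤ.* pos n ℤ.+ pos i ≡ pos (i ℕ.+ n ℕ.* 3)
    3·pos n i = ≡.trans (≡.cong (ℤ._+ pos i) (≡.sym (ℤ.pos-* 3 n))) (≡.cong pos (eq n i))
      where
      eq : ∀ n i → 3 ℕ.* n ℕ.+ i ≡ i ℕ.+ n ℕ.* 3
      eq = solve-∀

    3·neg : ∀ n i j → i ℕ.+ j ≡ 2 → pos 3 ℤ.* -[1+ n ] ℤ.+ pos i ≡ -[1+ j ℕ.+ n ℕ.* 3 ]
    3·neg n i j i+j≡2 = ≡.trans (eq (pos n) (pos i) (pos j) (≡.cong pos i+j≡2))
      (≡.cong (λ t → ℤ.- (pos 1 ℤ.+ (pos j ℤ.+ t))) (≡.trans (≡.sym (ℤ.pos-* 3 n)) (≡.cong pos (ℕ.*-comm 3 n))))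
      where
      eq′ : ∀ N I J → pos 3 ℤ.* ℤ.- (pos 1 ℤ.+ N) ℤ.+ I ≡ ℤ.- (pos 3 ℤ.- (I ℤ.+ J) ℤ.+ (J ℤ.+ pos 3 ℤ.* N))
      eq′ = ℤ-solve-∀
      eq : ∀ N I J → I ℤ.+ J ≡ pos 2 → pos 3 ℤ.* ℤ.- (pos 1 ℤ.+ N) ℤ.+ I ≡ ℤ.- (pos 1 ℤ.+ (J ℤ.+ pos 3 ℤ.* N))
      eq N I J p = ≡.trans (eq′ N I J) (≡.cong (λ t → ℤ.- (pos 3 ℤ.- t ℤ.+ (J ℤ.+ pos 3 ℤ.* N))) p)

    f-order : ∀ {i j} → j ≡ i → ∀ {k} → k ℕ.≤ ∣ i ∣ → f j ≈[ k ] 0#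
    f-order ≡.refl k≤ = []-weaken k≤ (s _)

    n≤3n : ∀ n i → n ℕ.≤ i ℕ.+ n ℕ.* 3
    n≤3n n i = ℕ.≤-trans (ℕ.m≤m*n n 3) (ℕ.m≤n+m _ i)

    g-summable : Summableℤ g
    g-summable (pos n) = order-+ (order-+
      (f-order (≡.trans (≡.sym (ℤ.+-identityʳ _)) (3·pos n 0)) (n≤3n n 0)) (f-order (3·pos n 1) (n≤3n n 1))) (f-order (3·pos n 2) (n≤3n n 2))
    g-summable -[1+ n ] = order-+ (order-+
      (f-order (≡.trans (≡.sym (ℤ.+-identityʳ _)) (3·neg n 0 2 ≡.refl)) (s≤s (n≤3n n 2)))
      (f-order (3·neg n 1 1 ≡.refl) (s≤s (n≤3n n 1)))) (f-order (3·neg n 2 0 ≡.refl) (s≤s (n≤3n n 0)))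

    go : ∀ N → ∑ (N ℕ.* 3) (fold f) ≈ ∑ N (fold g)
    go zero = refl
    go (suc N) = begin
      ∑ (N ℕ.* 3) (fold f) + fold f (N ℕ.* 3) + fold f (suc (N ℕ.* 3)) + fold f (suc (suc (N ℕ.* 3)))
        ≈⟨ +-congʳ (+-congʳ (+-congʳ (go N))) ⟩
      ∑ N (fold g) + fold f (N ℕ.* 3) + fold f (suc (N ℕ.* 3)) + fold f (suc (suc (N ℕ.* 3)))
        ≈⟨ solve 7 (λ s a a′ b b′ c c′ → s :+ (a :+ a′) :+ (b :+ b′) :+ (c :+ c′) := s :+ ((a :+ b :+ c) :+ (c′ :+ b′ :+ a′))) refl _ _ _ _ _ _ _ ⟩
      ∑ N (fold g) + ((f (pos (N ℕ.* 3)) + f (pos (suc (N ℕ.* 3))) + f (pos (suc (suc (N ℕ.* 3)))))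
        + (f -[1+ suc (suc (N ℕ.* 3)) ] + f -[1+ suc (N ℕ.* 3) ] + f -[1+ N ℕ.* 3 ]))
        ≈⟨ +-congˡ (+-cong (+-cong (+-cong (f≡ (≡.trans (≡.sym (ℤ.+-identityʳ _)) (3·pos N 0))) (f≡ (3·pos N 1))) (f≡ (3·pos N 2)))
             (+-cong (+-cong (f≡ (≡.trans (≡.sym (ℤ.+-identityʳ _)) (3·neg N 0 2 ≡.refl))) (f≡ (3·neg N 1 1 ≡.refl))) (f≡ (3·neg N 2 0 ≡.refl)))) ⟨
      ∑ N (fold g) + fold g N ∎
      where
      f≡ : ∀ {i j} → i ≡ j → f i ≈ f j
      f≡ eq = reflexive (≡.cong f eq)

  -- Squares of multiples of 3 give φ(y^9). The other squares are 1 + 3(3j² ± 2j) with sign opposite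
  -- to that of j, and each of the two classes contributes -y B(y³).
  φ-dissection : ∀ {y} → y ≈[ 1 ] 0# → φ y ≈ φ (y ^ 9) - (y * B (y ^ 3) + y * B (y ^ 3))
  φ-dissection {y} o = begin
    φ y
      ≈⟨ ∑ℤ-split₃ f-summable ⟩
    ∑ℤ (λ j → f (pos 3 ℤ.* j) + f (pos 3 ℤ.* j ℤ.+ pos 1) + f (pos 3 ℤ.* j ℤ.+ pos 2))
      ≈⟨ trans (∑ℤ-+ _ _) (+-congʳ (∑ℤ-+ _ _)) ⟩
    ∑ℤ (λ j → f (pos 3 ℤ.* j)) + ∑ℤ (λ j → f (pos 3 ℤ.* j ℤ.+ pos 1)) + ∑ℤ (λ j → f (pos 3 ℤ.* j ℤ.+ pos 2))
      -- The class 3j+2 is read as 3(j+1) - 1, which is why its series appears shifted by one.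
      ≈⟨ +-cong (+-cong (∑ℤ-cong zeroth) (trans (∑ℤ-cong first) (∑ℤ-neg _))) (trans (∑ℤ-cong second) (∑ℤ-suc {h} h-summable)) ⟩
    φ (y ^ 9) + - ∑ℤ (λ j → y * (sgnℤ j * z ^ ∣ e′ j ∣)) + ∑ℤ h
      ≈⟨ +-cong (+-congˡ (-‿cong (trans (sym (*-∑ℤ y e′-summable)) (*-congˡ B′≈B))))
           (trans (∑ℤ-neg _) (-‿cong (sym (*-∑ℤ y e-summable)))) ⟩
    φ (y ^ 9) + - (y * B z) + - (y * B z)
      ≈⟨ solve 2 (λ a b → a :+ :- b :+ :- b := a :- (b :+ b)) refl _ _ ⟩
    φ (y ^ 9) - (y * B z + y * B z) ∎
    where
    z : PS
    z = y ^ 3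

    o₃ : z ≈[ 1 ] 0#
    o₃ = order-^₊ o 3 (s≤s z≤n)

    open Lambert o₃ using (X; order-X)

    open Theta o₃ using (θ-product; X-quadratic; θ₁-product)

    e e′ : ℤ → ℤ
    e j = pos 3 ℤ.* (j ℤ.* j) ℤ.- pos 2 ℤ.* j
    e′ j = pos 3 ℤ.* (j ℤ.* j) ℤ.+ pos 2 ℤ.* j

    ∣∣≤e′ : ∀ j → pos ∣ j ∣ ℤ.≤ e′ j
    ∣∣≤e′ j = ℤ.≤-trans (ℤ.≤-reflexive (≡.cong pos (≡.sym (ℤ.∣-i∣≡∣i∣ j))))
      (ℤ.≤-trans (∣∣≤3u²-2u (ℤ.- j)) (ℤ.≤-reflexive (eq j)))
      where
      eq : ∀ j → pos 3 ℤ.* (ℤ.- j ℤ.* ℤ.- j) ℤ.- pos 2 ℤ.* ℤ.- j ≡ pos 3 ℤ.* (j ℤ.* j) ℤ.+ pos 2 ℤ.* j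
      eq = ℤ-solve-∀

    e-summable : Summableℤ (λ j → sgnℤ j * z ^ ∣ e j ∣)
    e-summable j = order-*ʳ (sgnℤ j) (order-X (∣∣≤3u²-2u j))

    e′-summable : Summableℤ (λ j → sgnℤ j * z ^ ∣ e′ j ∣)
    e′-summable j = order-*ʳ (sgnℤ j) (order-X (∣∣≤e′ j))

    f h : ℤ → PS
    f k = sgnℤ k * y ^ (∣ k ∣ ℕ.* ∣ k ∣)
    h j = - (y * (sgnℤ j * z ^ ∣ e j ∣))

    h-summable : Summableℤ h
    h-summable j = order-neg (order-*ʳ y (e-summable j))

    f-summable : Summableℤ f
    f-summable k = order-*ʳ (sgnℤ k) ([]-weaken (n≤n² ∣ k ∣) (order-^ o _))
      where
      n≤n² : ∀ n → n ℕ.≤ n ℕ.* n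
      n≤n² zero = z≤n
      n≤n² (suc n) = ℕ.m≤m*n (suc n) (suc n)

    -- The two series differ by j → -j, which on the product side only exchanges the parameters z
    -- and z^5.
    B′≈B : ∑ℤ (λ j → sgnℤ j * z ^ ∣ e′ j ∣) ≈ B z
    B′≈B = trans (θ-product 5 1 (s≤s z≤n) (s≤s z≤n) ≡.refl e′
      (λ k → X-quadratic k 5 0 (e⁺ (pos k))) (λ k → X-quadratic k 7 1 (e⁻ (pos k))))
      (trans (*-congʳ (*-comm _ _)) (sym θ₁-product))
      where
      e⁺ : ∀ K → pos 3 ℤ.* (K ℤ.* K) ℤ.+ pos 2 ℤ.* K ≡ pos 3 ℤ.* (K ℤ.* K) ℤ.- pos 3 ℤ.* K ℤ.+ (pos 5 ℤ.* K ℤ.+ pos 0)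
      e⁺ = ℤ-solve-∀
      e⁻ : ∀ K → pos 3 ℤ.* (ℤ.- (pos 1 ℤ.+ K) ℤ.* ℤ.- (pos 1 ℤ.+ K)) ℤ.+ pos 2 ℤ.* ℤ.- (pos 1 ℤ.+ K)
        ≡ pos 3 ℤ.* (K ℤ.* K) ℤ.- pos 3 ℤ.* K ℤ.+ (pos 7 ℤ.* K ℤ.+ pos 1)
      e⁻ = ℤ-solve-∀

    sgn-3j : ∀ j → sgnℤ (pos 3 ℤ.* j) ≈ sgnℤ j
    sgn-3j j = begin
      sgnℤ (pos 3 ℤ.* j)            ≡⟨ ≡.cong sgnℤ (eq j) ⟩
      sgnℤ (j ℤ.+ (j ℤ.+ j))        ≈⟨ trans (sgnℤ-+ j (j ℤ.+ j)) (*-congˡ (trans (sgnℤ-+ j j) (sgnℤ² j))) ⟩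
      sgnℤ j * 1#                   ≈⟨ *-identityʳ _ ⟩
      sgnℤ j                        ∎
      where
      eq : ∀ j → pos 3 ℤ.* j ≡ j ℤ.+ (j ℤ.+ j)
      eq = ℤ-solve-∀

    sgn-suc : ∀ k → sgnℤ (k ℤ.+ pos 1) ≈ - sgnℤ k
    sgn-suc k = trans (reflexive (≡.cong sgnℤ (ℤ.+-comm k (pos 1)))) (sgnℤ-suc k)

    y^-square : ∀ k e → ℤ.0ℤ ℤ.≤ e → k ℤ.* k ≡ pos 1 ℤ.+ pos 3 ℤ.* e → y ^ (∣ k ∣ ℕ.* ∣ k ∣) ≈ y * z ^ ∣ e ∣
    y^-square k (pos n) _ eq = begin
      y ^ (∣ k ∣ ℕ.* ∣ k ∣)   ≡⟨ ≡.cong (y ^_) (≡.trans (≡.sym (ℤ.abs-* k k)) (≡.trans (≡.cong ∣_∣ eq) (≡.cong (λ t → ∣ pos 1 ℤ.+ t ∣) (≡.sym (ℤ.pos-* 3 n))))) ⟩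
      y * y ^ (3 ℕ.* n)       ≈⟨ *-congˡ (sym (^-assocʳ y 3 n)) ⟩
      y * z ^ n               ∎

    zeroth : ∀ j → f (pos 3 ℤ.* j) ≈ sgnℤ j * (y ^ 9) ^ (∣ j ∣ ℕ.* ∣ j ∣)
    zeroth j = *-cong (sgn-3j j) (trans (^-congʳ y (≡.trans (≡.cong₂ ℕ._*_ (ℤ.abs-* (pos 3) j) (ℤ.abs-* (pos 3) j)) (eq ∣ j ∣)))
      (sym (^-assocʳ y 9 (∣ j ∣ ℕ.* ∣ j ∣))))
      where
      eq : ∀ n → (3 ℕ.* n) ℕ.* (3 ℕ.* n) ≡ 9 ℕ.* (n ℕ.* n)
      eq = solve-∀

    first : ∀ j → f (pos 3 ℤ.* j ℤ.+ pos 1) ≈ - (y * (sgnℤ j * z ^ ∣ e′ j ∣))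
    first j = trans (*-cong (trans (sgn-suc (pos 3 ℤ.* j)) (-‿cong (sgn-3j j)))
        (y^-square (pos 3 ℤ.* j ℤ.+ pos 1) (e′ j) (ℤ.≤-trans (0≤pos {∣ j ∣}) (∣∣≤e′ j)) (eq j)))
      (solve 3 (λ s y t → (:- s) :* (y :* t) := :- (y :* (s :* t))) refl _ _ _)
      where
      eq : ∀ j → (pos 3 ℤ.* j ℤ.+ pos 1) ℤ.* (pos 3 ℤ.* j ℤ.+ pos 1) ≡ pos 1 ℤ.+ pos 3 ℤ.* (pos 3 ℤ.* (j ℤ.* j) ℤ.+ pos 2 ℤ.* j)
      eq = ℤ-solve-∀

    second : ∀ j → f (pos 3 ℤ.* j ℤ.+ pos 2) ≈ h (ℤ.suc j)
    second j = trans (*-cong sgn≈ (y^-square (pos 3 ℤ.* j ℤ.+ pos 2) (e (ℤ.suc j)) (ℤ.≤-trans (0≤pos {∣ ℤ.suc j ∣}) (∣∣≤3u²-2u (ℤ.suc j))) (eq j)))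
      (solve 3 (λ s y t → (:- s) :* (y :* t) := :- (y :* (s :* t))) refl _ _ _)
      where
      eq : ∀ j → (pos 3 ℤ.* j ℤ.+ pos 2) ℤ.* (pos 3 ℤ.* j ℤ.+ pos 2)
        ≡ pos 1 ℤ.+ pos 3 ℤ.* (pos 3 ℤ.* ((pos 1 ℤ.+ j) ℤ.* (pos 1 ℤ.+ j)) ℤ.- pos 2 ℤ.* (pos 1 ℤ.+ j))
      eq = ℤ-solve-∀
      assoc₂ : ∀ j → pos 3 ℤ.* j ℤ.+ pos 2 ≡ (pos 3 ℤ.* j ℤ.+ pos 1) ℤ.+ pos 1
      assoc₂ = ℤ-solve-∀
      sgn≈ : sgnℤ (pos 3 ℤ.* j ℤ.+ pos 2) ≈ - sgnℤ (ℤ.suc j)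
      sgn≈ = begin
        sgnℤ (pos 3 ℤ.* j ℤ.+ pos 2)                ≡⟨ ≡.cong sgnℤ (assoc₂ j) ⟩
        sgnℤ ((pos 3 ℤ.* j ℤ.+ pos 1) ℤ.+ pos 1)    ≈⟨ trans (sgn-suc (pos 3 ℤ.* j ℤ.+ pos 1)) (-‿cong (trans (sgn-suc (pos 3 ℤ.* j)) (-‿cong (sgn-3j j)))) ⟩
        - - sgnℤ j                                  ≈⟨ -‿cong (sgnℤ-suc j) ⟨
        - sgnℤ (ℤ.suc j)                            ∎

  four eight : PS
  four = (1# + 1#) * (1# + 1#)
  eight = (1# + 1#) * four

  B-cong : ∀ {y y′} → y ≈ y′ → B y ≈ B y′
  B-cong y≈ = ∑ℤ-cong λ k → *-congˡ (^-cong y≈ ∣ pos 3 ℤ.* (k ℤ.* k) ℤ.- pos 2 ℤ.* k ∣)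

  module CubeRoot (ω : PS) (ω-root : 1# + ω + ω * ω ≈ 0#) where
    ω² : PS
    ω² = ω * ω

    ω·ω² : ω * ω² ≈ 1#
    ω·ω² = begin
      ω * (ω * ω)                             ≈⟨ solve 1 (λ w → w :* (w :* w) := (w :- con ℤ.1ℤ) :* (con ℤ.1ℤ :+ w :+ w :* w) :+ con ℤ.1ℤ) refl ω ⟩
      (ω - 1#) * (1# + ω + ω * ω) + 1#        ≈⟨ +-congʳ (trans (*-congˡ ω-root) (zeroʳ _)) ⟩
      0# + 1#                                 ≈⟨ +-identityˡ 1# ⟩
      1#                                      ∎

    ω^3 : ω ^ 3 ≈ 1#
    ω^3 = trans (solve 1 (λ w → w :* (w :* (w :* con ℤ.1ℤ)) := w :* (w :* w)) refl ω) ω·ω²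

    ω²^3 : ω² ^ 3 ≈ 1#
    ω²^3 = trans (solve 1 (λ w → let v = w :* w in v :* (v :* (v :* con ℤ.1ℤ)) := (w :* (w :* w)) :* (w :* (w :* w))) refl ω)
      (trans (*-cong ω·ω² ω·ω²) (*-identityˡ 1#))

    1^ : ∀ n → 1# ^ n ≈ 1#
    1^ zero = refl
    1^ (suc n) = trans (*-identityˡ _) (1^ n)

    root-^3 : ∀ {w} → w ^ 3 ≈ 1# → ∀ y → (w * y) ^ 3 ≈ y ^ 3
    root-^3 w³ y = trans (^-distrib-* _ y 3) (trans (*-congʳ w³) (*-identityˡ _))

    root-^9 : ∀ {w} → w ^ 3 ≈ 1# → ∀ y → (w * y) ^ 9 ≈ y ^ 9
    root-^9 {w} w³ y = trans (^-distrib-* w y 9) (trans (*-congʳ (trans (sym (^-assocʳ w 3 3)) (trans (^-cong w³ 3) (1^ 3)))) (*-identityˡ _))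

    norm-linear : ∀ t → (1# - t) * (1# - ω * t) * (1# - ω² * t) ≈ 1# - t ^ 3
    norm-linear t = begin
      (1# - t) * (1# - ω * t) * (1# - ω * ω * t)
        ≈⟨ solve 2 (λ w t → let S = con ℤ.1ℤ :+ w :+ w :* w in
             (con ℤ.1ℤ :- t) :* (con ℤ.1ℤ :- w :* t) :* (con ℤ.1ℤ :- w :* w :* t)
             := (con ℤ.1ℤ :+ S :* (w :* t :* t :- t)) :- w :* (w :* w) :* (t :* (t :* (t :* con ℤ.1ℤ)))) refl ω t ⟩
      (1# + (1# + ω + ω * ω) * (ω * t * t - t)) - ω * (ω * ω) * t ^ 3
        ≈⟨ +-cong (+-congˡ (trans (*-congʳ ω-root) (zeroˡ _))) (-‿cong (trans (*-congʳ ω·ω²) (*-identityˡ _))) ⟩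
      (1# + 0#) - t ^ 3   ≈⟨ +-congʳ (+-identityʳ 1#) ⟩
      1# - t ^ 3          ∎

    order-ω : ∀ {y} w → y ≈[ 1 ] 0# → w * y ≈[ 1 ] 0#
    order-ω w = order-*ʳ w

    poch-norm : ∀ {α Q} → α ≈[ 1 ] 0# → Q ≈[ 1 ] 0# →
      poch α Q * poch (ω * α) Q * poch (ω² * α) Q ≈ poch (α ^ 3) (Q ^ 3)
    poch-norm {α} {Q} p q = begin
      poch α Q * poch (ω * α) Q * poch (ω² * α) Q
        ≈⟨ ∏∞-*₃ (poch-multipliable p q) (poch-multipliable (order-ω ω p) q) (poch-multipliable (order-ω ω² p) q) ⟨
      ∏∞ (λ k → 1# * (1# - α * Q ^ k) * (1# - ω * α * Q ^ k) * (1# - ω² * α * Q ^ k))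
        ≈⟨ ∏∞-cong (λ k → trans (*-cong (*-cong (*-identityˡ _) (+-congˡ (-‿cong (*-assoc _ _ _)))) (+-congˡ (-‿cong (*-assoc _ _ _))))
             (trans (norm-linear (α * Q ^ k)) (+-congˡ (-‿cong (trans (^-distrib-* α (Q ^ k) 3)
               (*-congˡ (trans (^-assocʳ Q k 3) (trans (^-congʳ Q (ℕ.*-comm k 3)) (sym (^-assocʳ Q 3 k)))))))))) ⟩
      poch (α ^ 3) (Q ^ 3) ∎

    -- Factors 1 - y^n with n divisible by 3 occur in all three products and give E(y³)³. For the
    -- other n the conjugates multiply to 1 - y^(3n), which together with E(y^9) gives one more
    -- E(y³). In the class 2 mod 3 the conjugates ω and ω² change places.
    E-norm : ∀ {y} → y ≈[ 1 ] 0# → E y * E (ω * y) * E (ω² * y) * E (y ^ 9) ≈ E (y ^ 3) * E (y ^ 3) * E (y ^ 3) * E (y ^ 3)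
    E-norm {y} o = begin
      E y * E (ω * y) * E (ω² * y) * E (y ^ 9)
        ≈⟨ *-congʳ (*-cong (*-cong (E-split₃ o) (split ω ω^3)) (split ω² ω²^3)) ⟩
      (poch y z * poch (y ^ 2) z * E z) * (poch (ω * y) z * poch ((ω * y) ^ 2) z * E z) * (poch (ω² * y) z * poch ((ω² * y) ^ 2) z * E z) * E (y ^ 9)
        ≈⟨ solve 8 (λ a b c d f g e n → (a :* b :* e) :* (c :* d :* e) :* (f :* g :* e) :* n
             := ((a :* c :* f) :* (b :* g :* d) :* n) :* e :* e :* e) refl _ _ _ _ _ _ (E z) (E (y ^ 9)) ⟩
      ((poch y z * poch (ω * y) z * poch (ω² * y) z) * (poch (y ^ 2) z * poch ((ω² * y) ^ 2) z * poch ((ω * y) ^ 2) z) * E (y ^ 9)) * E z * E z * E z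
        ≈⟨ *-congʳ (*-congʳ (*-congʳ (*-congʳ (*-cong (poch-norm o o₃)
             (trans (*-cong (*-congˡ (poch-cong ω⁴y² refl)) (poch-cong ω²y² refl)) (poch-norm o₂ o₃)))))) ⟩
      (poch (y ^ 3) (z ^ 3) * poch ((y ^ 2) ^ 3) (z ^ 3) * E (y ^ 9)) * E z * E z * E z
        ≈⟨ *-congʳ (*-congʳ (*-congʳ (trans (*-cong (*-congˡ (poch-cong (trans (^-assocʳ y 2 3) (sym (^-assocʳ y 3 2))) refl))
             (E-cong (sym (^-assocʳ y 3 3)))) (sym (E-split₃ o₃))))) ⟩
      E z * E z * E z * E z ∎
      where
      z : PS
      z = y ^ 3
      o₂ : y ^ 2 ≈[ 1 ] 0#
      o₂ = order-^₊ o 2 (s≤s z≤n)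
      o₃ : z ≈[ 1 ] 0#
      o₃ = order-^₊ o 3 (s≤s z≤n)

      split : ∀ w → w ^ 3 ≈ 1# → E (w * y) ≈ poch (w * y) z * poch ((w * y) ^ 2) z * E z
      split w w³ = trans (E-split₃ (order-ω w o))
        (*-cong (*-cong (poch-cong refl (root-^3 w³ y)) (poch-cong refl (root-^3 w³ y))) (E-cong (root-^3 w³ y)))

      ω²y² : (ω * y) ^ 2 ≈ ω² * y ^ 2
      ω²y² = solve 2 (λ w y → w :* y :* (w :* y :* con ℤ.1ℤ) := w :* w :* (y :* (y :* con ℤ.1ℤ))) refl ω y

      ω⁴y² : (ω² * y) ^ 2 ≈ ω * y ^ 2
      ω⁴y² = trans (solve 2 (λ w y → w :* w :* y :* (w :* w :* y :* con ℤ.1ℤ) := w :* (w :* w) :* (w :* (y :* (y :* con ℤ.1ℤ)))) refl ω y)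
        (trans (*-congʳ ω·ω²) (*-identityˡ _))

    module Norm {x : PS} (o : x ≈[ 1 ] 0#) where
      private
        A b a : PS
        A = φ (x ^ 9)
        b = B (x ^ 3)
        a = φ (x ^ 3)

      φω : ∀ w → w ^ 3 ≈ 1# → φ (w * x) ≈ A - (w * x * b + w * x * b)
      φω w w³ = trans (φ-dissection (order-ω w o)) (+-cong (φ-cong (root-^9 w³ x))
        (-‿cong (+-cong (*-congˡ (B-cong (root-^3 w³ x))) (*-congˡ (B-cong (root-^3 w³ x))))))

      N : PS
      N = φ x * (φ (ω * x) * φ (ω² * x))

      cofactor : φ (ω * x) * φ (ω² * x) ≈ A * A + (1# + 1#) * x * A * b + four * (x * x) * b * b
      cofactor = begin
        φ (ω * x) * φ (ω² * x) ≈⟨ *-cong (φω ω ω^3) (φω ω² ω²^3) ⟩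
        (A - (ω * x * b + ω * x * b)) * (A - (ω * ω * x * b + ω * ω * x * b))
          ≈⟨ solve 4 (λ w x A b → let one = con ℤ.1ℤ; two = one :+ one; S = one :+ w :+ w :* w in
               (A :- (w :* x :* b :+ w :* x :* b)) :* (A :- (w :* w :* x :* b :+ w :* w :* x :* b))
               := (A :* A :+ two :* x :* A :* b :- S :* (two :* x :* A :* b)) :+ w :* (w :* w) :* (two :* two :* (x :* x) :* b :* b)) refl ω x A b ⟩
        (A * A + (1# + 1#) * x * A * b - (1# + ω + ω * ω) * ((1# + 1#) * x * A * b)) + ω * (ω * ω) * (four * (x * x) * b * b)
          ≈⟨ +-cong (+-congˡ (-‿cong (trans (*-congʳ ω-root) (zeroˡ _)))) (trans (*-congʳ ω·ω²) (*-identityˡ _)) ⟩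
        (A * A + (1# + 1#) * x * A * b - 0#) + four * (x * x) * b * b
          ≈⟨ +-congʳ (solve 1 (λ a → a :- con ℤ.0ℤ := a) refl _) ⟩
        A * A + (1# + 1#) * x * A * b + four * (x * x) * b * b ∎

      -- A difference of cubes of A and 2xb: apart from A and b it contains only x³, so N is a
      -- series in x³.
      N-cubes : N ≈ A * A * A - eight * x ^ 3 * (b * b * b)
      N-cubes = trans (*-cong (φ-dissection o) cofactor)
        (solve 3 (λ x A b → let one = con ℤ.1ℤ; two = one :+ one in
           (A :- (x :* b :+ x :* b)) :* (A :* A :+ two :* x :* A :* b :+ two :* two :* (x :* x) :* b :* b)
           := A :* A :* A :- two :* (two :* two) :* (x :* (x :* (x :* one))) :* (b :* b :* b)) refl x A b)

      F·N : ∀ {F} → F * φ x ≈ a * a → F * N ≈ a * a * (A * A + (1# + 1#) * x * A * b + four * (x * x) * b * b)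
      F·N Fφ = trans (sym (*-assoc _ _ _)) (*-cong Fφ cofactor)

      φ-E : ∀ {y} → y ≈[ 1 ] 0# → φ y * E (y ^ 2) ≈ E y * E y
      φ-E {y} p = begin
        φ y * E (y ^ 2)                    ≈⟨ *-congʳ (φ-product p) ⟩
        poch y (y ^ 2) * poch y (y ^ 2) * E (y ^ 2) * E (y ^ 2)
          ≈⟨ solve 2 (λ a e → a :* a :* e :* e := a :* e :* (a :* e)) refl _ _ ⟩
        poch y (y ^ 2) * E (y ^ 2) * (poch y (y ^ 2) * E (y ^ 2))   ≈⟨ *-cong (E-split₂ p) (E-split₂ p) ⟨
        E y * E y                          ∎

      B-E : ∀ {y} → y ≈[ 1 ] 0# → B y * (E (y ^ 2) * E (y ^ 3)) ≈ E y * (E (y ^ 6) * E (y ^ 6))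
      B-E {y} p = begin
        B y * (E (y ^ 2) * E (y ^ 3))
          ≈⟨ *-cong (Theta.θ₁-product p) (*-congˡ (trans (E-split₂ (order-^₊ p 3 (s≤s z≤n)))
               (*-cong (poch-cong refl (^-assocʳ y 3 2)) (E-cong (^-assocʳ y 3 2))))) ⟩
        poch (y ^ 1) (y ^ 6) * p₅ * E₆ * (E (y ^ 2) * (p₃ * E₆))
          ≈⟨ *-congʳ (*-congʳ (*-congʳ (poch-cong (*-identityʳ y) refl))) ⟩
        p₁ * p₅ * E₆ * (E (y ^ 2) * (p₃ * E₆))
          ≈⟨ solve 5 (λ a b c e f → a :* c :* f :* (e :* (b :* f)) := a :* b :* c :* e :* (f :* f)) refl p₁ p₃ p₅ _ E₆ ⟩
        p₁ * p₃ * p₅ * E (y ^ 2) * (E₆ * E₆)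
          ≈⟨ *-congʳ (trans (E-split₂ p) (*-congʳ (poch-split₃ p))) ⟨
        E y * (E₆ * E₆) ∎
        where
        p₁ = poch y (y ^ 6)
        p₃ = poch (y ^ 3) (y ^ 6)
        p₅ = poch (y ^ 5) (y ^ 6)
        E₆ = E (y ^ 6)

      -- Put e_i = E(x^(3i)). Then N = e₁^8 e₆ / (e₂^4 e₃²), a = e₁² / e₂ and b = e₁ e₆² / (e₂ e₃),
      -- so a² b² / N = e₆³ / e₁². Multiplied out, the common factor to cancel is e₁^6 e₆.
      E³-equation : ∀ {H} → H * N ≈ four * (x * x) * (a * a) * (b * b) →
        H * (E (x ^ 3) * E (x ^ 3)) ≈ four * (x * x) * (E (x ^ 18) * E (x ^ 18) * E (x ^ 18))
      E³-equation {H} HN = *-cancelˡ-unit unit (begin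
        e₁ * e₁ * e₁ * e₁ * e₁ * e₁ * e₆ * (H * (e₁ * e₁))
          ≈⟨ solve 3 (λ e₁ e₆ H → e₁ :* e₁ :* e₁ :* e₁ :* e₁ :* e₁ :* e₆ :* (H :* (e₁ :* e₁))
               := H :* ((e₁ :* e₁ :* e₁ :* e₁) :* (e₁ :* e₁ :* e₁ :* e₁)) :* e₆) refl e₁ e₆ H ⟩
        H * ((e₁ * e₁ * e₁ * e₁) * (e₁ * e₁ * e₁ * e₁)) * e₆
          ≈⟨ *-congʳ (*-congˡ (*-cong (E-norm o) (E-norm o))) ⟨
        H * ((E x * E (ω * x) * E (ω² * x) * E (x ^ 9)) * (E x * E (ω * x) * E (ω² * x) * E (x ^ 9))) * e₆
          ≈⟨ *-congʳ (*-congˡ (solve 4 (λ a b c d → (a :* b :* c :* d) :* (a :* b :* c :* d) := (a :* a) :* ((b :* b) :* (c :* c)) :* (d :* d)) refl _ _ _ _)) ⟩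
        H * ((E x * E x) * ((E (ω * x) * E (ω * x)) * (E (ω² * x) * E (ω² * x))) * (E (x ^ 9) * E (x ^ 9))) * e₆
          ≈⟨ *-congʳ (*-congˡ (*-cong (*-cong (φ-E o) (*-cong (φ-E (order-ω ω o)) (φ-E (order-ω ω² o)))) (*-cong E₉≈ E₉≈))) ⟨
        H * ((φ x * E (x ^ 2)) * ((φ (ω * x) * E ((ω * x) ^ 2)) * (φ (ω² * x) * E ((ω² * x) ^ 2))) * (e₃ * e₃)) * e₆
          -- Squaring exchanges the two nontrivial conjugates, so the products in x² again form a
          -- full norm.
          ≈⟨ *-congʳ (*-congˡ (*-congʳ (*-congˡ (*-cong (*-congˡ (E-cong ω²x²)) (*-congˡ (E-cong ω⁴x²)))))) ⟩
        H * ((φ x * E (x ^ 2)) * ((φ (ω * x) * E (ω² * x ^ 2)) * (φ (ω² * x) * E (ω * x ^ 2))) * (e₃ * e₃)) * e₆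
          ≈⟨ solve 9 (λ H p₀ e₀ p₁ n₁ p₂ n₂ e₃ e₆ → H :* ((p₀ :* e₀) :* ((p₁ :* n₁) :* (p₂ :* n₂)) :* (e₃ :* e₃)) :* e₆
               := H :* (p₀ :* (p₁ :* p₂)) :* ((e₀ :* n₂ :* n₁) :* e₆) :* (e₃ :* e₃)) refl H _ _ _ _ _ _ e₃ e₆ ⟩
        H * N * ((E (x ^ 2) * E (ω * x ^ 2) * E (ω² * x ^ 2)) * e₆) * (e₃ * e₃)
          ≈⟨ *-congʳ (*-cong HN (trans (*-congˡ (E-cong x¹⁸)) (trans (E-norm (order-^₊ o 2 (s≤s z≤n)))
               (*-cong (*-cong (*-cong E₂≈ E₂≈) E₂≈) E₂≈)))) ⟩
        four * (x * x) * (a * a) * (b * b) * (e₂ * e₂ * e₂ * e₂) * (e₃ * e₃)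
          ≈⟨ solve 5 (λ c a b e₂ e₃ → c :* (a :* a) :* (b :* b) :* (e₂ :* e₂ :* e₂ :* e₂) :* (e₃ :* e₃)
               := c :* ((a :* e₂) :* (a :* e₂)) :* ((b :* (e₂ :* e₃)) :* (b :* (e₂ :* e₃)))) refl (four * (x * x)) a b e₂ e₃ ⟩
        four * (x * x) * ((a * e₂) * (a * e₂)) * ((b * (e₂ * e₃)) * (b * (e₂ * e₃)))
          ≈⟨ *-cong (*-congˡ (*-cong (φ-E o₃) (φ-E o₃))) (*-cong (B-E o₃) (B-E o₃)) ⟩
        four * (x * x) * ((e₁ * e₁) * (e₁ * e₁)) * ((e₁ * (e₆ * e₆)) * (e₁ * (e₆ * e₆)))
          ≈⟨ solve 3 (λ c e₁ e₆ → c :* ((e₁ :* e₁) :* (e₁ :* e₁)) :* ((e₁ :* (e₆ :* e₆)) :* (e₁ :* (e₆ :* e₆)))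
               := e₁ :* e₁ :* e₁ :* e₁ :* e₁ :* e₁ :* e₆ :* (c :* (e₆ :* e₆ :* e₆))) refl (four * (x * x)) e₁ e₆ ⟩
        e₁ * e₁ * e₁ * e₁ * e₁ * e₁ * e₆ * (four * (x * x) * (e₆ * e₆ * e₆))
          ≈⟨ *-congˡ (*-congˡ (*-cong (*-cong E₆≈ E₆≈) E₆≈)) ⟩
        e₁ * e₁ * e₁ * e₁ * e₁ * e₁ * e₆ * (four * (x * x) * (E (x ^ 18) * E (x ^ 18) * E (x ^ 18))) ∎)
        where
        X e₁ e₂ e₃ e₆ : PS
        X = x ^ 3
        e₁ = E X
        e₂ = E (X ^ 2)
        e₃ = E (X ^ 3)
        e₆ = E (X ^ 6)

        o₃ : X ≈[ 1 ] 0#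
        o₃ = order-^₊ o 3 (s≤s z≤n)

        u₁ : e₁ ≈[ 1 ] 1#
        u₁ = E-unit o₃

        unit-* : ∀ {f g} → f ≈[ 1 ] 1# → g ≈[ 1 ] 1# → f * g ≈[ 1 ] 1#
        unit-* p q = []-trans ([]-* p q) (≈⇒≈[] (*-identityˡ 1#))

        unit : e₁ * e₁ * e₁ * e₁ * e₁ * e₁ * e₆ ≈[ 1 ] 1#
        unit = unit-* (unit-* (unit-* (unit-* (unit-* (unit-* u₁ u₁) u₁) u₁) u₁) u₁) (E-unit (order-^₊ o₃ 6 (s≤s z≤n)))

        E₉≈ : e₃ ≈ E (x ^ 9)
        E₉≈ = E-cong (^-assocʳ x 3 3)

        E₂≈ : E ((x ^ 2) ^ 3) ≈ e₂
        E₂≈ = E-cong (trans (^-assocʳ x 2 3) (sym (^-assocʳ x 3 2)))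

        E₆≈ : e₆ ≈ E (x ^ 18)
        E₆≈ = E-cong (^-assocʳ x 3 6)

        x¹⁸ : X ^ 6 ≈ (x ^ 2) ^ 9
        x¹⁸ = trans (^-assocʳ x 3 6) (sym (^-assocʳ x 2 9))

        ω²x² : (ω * x) ^ 2 ≈ ω² * x ^ 2
        ω²x² = solve 2 (λ w y → w :* y :* (w :* y :* con ℤ.1ℤ) := w :* w :* (y :* (y :* con ℤ.1ℤ))) refl ω x

        ω⁴x² : (ω² * x) ^ 2 ≈ ω * x ^ 2
        ω⁴x² = trans (solve 2 (λ w y → w :* w :* y :* (w :* w :* y :* con ℤ.1ℤ) := w :* (w :* w) :* (w :* (y :* (y :* con ℤ.1ℤ)))) refl ω x)
          (trans (*-congʳ ω·ω²) (*-identityˡ _))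

-- Supports of power series and projections to residue classes of exponents

module Supports (R : CommutativeRing 0ℓ 0ℓ) where
  private
    module R where
      open CommutativeRing R public
      open FiniteSums R public
      open RingProperties ring public using (-0#≈0#)
  open PowerSeries R
  open CommutativeRing FPS
  open Exp commutativeSemiring using (_^_)
  open FiniteSums FPS
  open Limits R
  open EulerProducts R
  open ThetaProducts R
  open CubicNorm R
  open import Relation.Binary.Reasoning.Setoid setoid

  -- A disjunction carried as data, since equality of coefficients in `R` is not assumed to be
  -- decidable.
  Supp : (ℕ → Set) → PS → Set
  Supp P f = ∀ n → P n ⊎ f n R.≈ R.0#

  private
    variable
      P P′ P″ : ℕ → Set
      f g : PS

  Supp-cong : f ≈ g → Supp P f → Supp P g
  Supp-cong f≈g s n with s n
  ... | inj₁ p = inj₁ p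
  ... | inj₂ z = inj₂ (R.trans (R.sym (coeff f≈g n)) z)

  Supp-map : (∀ n → P n → P′ n) → Supp P f → Supp P′ f
  Supp-map h s n with s n
  ... | inj₁ p = inj₁ (h n p)
  ... | inj₂ z = inj₂ z

  Supp-0 : Supp P 0#
  Supp-0 n = inj₂ R.refl

  Supp-1 : P 0 → Supp P 1#
  Supp-1 p zero = inj₁ p
  Supp-1 p (suc n) = inj₂ R.refl

  Supp-+ : Supp P f → Supp P g → Supp P (f + g)
  Supp-+ s t n with s n | t n
  ... | inj₁ p | _ = inj₁ p
  ... | inj₂ _ | inj₁ p = inj₁ p
  ... | inj₂ z | inj₂ z′ = inj₂ (R.trans (R.+-cong z z′) (R.+-identityˡ R.0#))

  Supp-neg : Supp P f → Supp P (- f)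
  Supp-neg s n with s n
  ... | inj₁ p = inj₁ p
  ... | inj₂ z = inj₂ (R.trans (R.-‿cong z) R.-0#≈0#)

  private
    sum-support : ∀ {A : Set} m (h : ℕ → R.Carrier) → (∀ i → i ℕ.< m → A ⊎ h i R.≈ R.0#) → A ⊎ R.∑ m h R.≈ R.0#
    sum-support zero h s = inj₂ R.refl
    sum-support (suc m) h s with sum-support m h (λ i i<m → s i (ℕ.m<n⇒m<1+n i<m)) | s m ℕ.≤-refl
    ... | inj₁ a | _ = inj₁ a
    ... | inj₂ _ | inj₁ a = inj₁ a
    ... | inj₂ z | inj₂ z′ = inj₂ (R.trans (R.+-cong z z′) (R.+-identityˡ R.0#))

  Supp-* : (∀ {i j} → P i → P′ j → P″ (i ℕ.+ j)) → Supp P f → Supp P′ g → Supp P″ (f * g)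
  Supp-* {P = P} {P′} {P″} {f} {g} h s t n with sum-support {P″ n} (suc n) (λ i → f i R.* g (n ∸ i)) term
    where
    term : ∀ i → i ℕ.< suc n → P″ n ⊎ f i R.* g (n ∸ i) R.≈ R.0#
    term i i≤n with s i | t (n ∸ i)
    ... | inj₁ p | inj₁ p′ = inj₁ (≡.subst P″ (ℕ.m+[n∸m]≡n (ℕ.≤-pred i≤n)) (h p p′))
    ... | inj₂ z | _ = inj₂ (R.trans (R.*-congʳ z) (R.zeroˡ _))
    ... | inj₁ _ | inj₂ z = inj₂ (R.trans (R.*-congˡ z) (R.zeroʳ _))
  ... | inj₁ p = inj₁ p
  ... | inj₂ z = inj₂ (R.trans (⊠-sum f g n) z)

  Supp-∑ : ∀ m {h : ℕ → PS} → (∀ k → Supp P (h k)) → Supp P (∑ m h)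
  Supp-∑ zero s = Supp-0
  Supp-∑ (suc m) s = Supp-+ (Supp-∑ m s) (s m)

  Supp-∑∞ : ∀ {h : ℕ → PS} → (∀ k → Supp P (h k)) → Supp P (∑∞ h)
  Supp-∑∞ {P = P} {h} s n = ≡.subst (λ c → P n ⊎ c R.≈ R.0#) (≡.sym (∑∞-coeff h n)) (Supp-∑ (suc n) s n)

  Supp-∑ℤ : ∀ {h : ℤ → PS} → (∀ k → Supp P (h k)) → Supp P (∑ℤ h)
  Supp-∑ℤ s = Supp-cong (sym (∑ℤ-def _)) (Supp-∑∞ λ k → Supp-+ (s _) (s _))

  Supp-const-* : Supp (_≡ 0) f → Supp P g → Supp P (f * g)
  Supp-const-* = Supp-* λ { ≡.refl p → p }

  Supp-sgn : ∀ n → Supp (_≡ 0) (sgn n)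
  Supp-sgn zero = Supp-1 ≡.refl
  Supp-sgn (suc n) = Supp-neg (Supp-sgn n)

  Supp-sgn-* : ∀ n → Supp P f → Supp P (sgn n * f)
  Supp-sgn-* n = Supp-const-* (Supp-sgn n)

  Mult : ℕ → PS → Set
  Mult m = Supp (m ∣_)

  module _ {m : ℕ} where
    Mult-1 : Mult m 1#
    Mult-1 = Supp-1 (m ∣0)

    Mult-* : Mult m f → Mult m g → Mult m (f * g)
    Mult-* = Supp-* ∣m∣n⇒∣m+n

    Mult-^ : Mult m f → ∀ n → Mult m (f ^ n)
    Mult-^ s zero = Mult-1
    Mult-^ s (suc n) = Mult-* s (Mult-^ s n)

    Mult-E : Mult m f → Mult m (E f)
    Mult-E {f = f} s n = ≡.subst (λ c → m ∣ n ⊎ c R.≈ R.0#) (≡.sym (∏∞-coeff (λ k → 1# - f ^ suc k) n)) (product (suc n) n)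
      where
      product : ∀ l → Mult m (∏ l (λ k → 1# - f ^ suc k))
      product zero = Mult-1
      product (suc l) = Mult-* (product l) (Supp-+ Mult-1 (Supp-neg (Mult-^ s (suc l))))

    Mult-φ : Mult m f → Mult m (φ f)
    Mult-φ s = Supp-∑ℤ λ k → Supp-sgn-* ∣ k ∣ (Mult-^ s (∣ k ∣ ℕ.* ∣ k ∣))

    Mult-B : Mult m f → Mult m (B f)
    Mult-B s = Supp-∑ℤ λ k → Supp-sgn-* ∣ k ∣ (Mult-^ s ∣ pos 3 ℤ.* (k ℤ.* k) ℤ.- pos 2 ℤ.* k ∣)

    Mult-geometric : Mult m f → Mult m (geometric f)
    Mult-geometric s = Supp-∑∞ (Mult-^ s)

  q : PS
  q zero = R.0#
  q (suc n) = 1# n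

  order-q : q ≈[ 1 ] 0#
  order-q = below λ { zero _ → R.refl ; (suc n) (s≤s ()) }

  Supp-q^ : ∀ n → Supp (_≡ n) (q ^ n)
  Supp-q^ zero = Supp-1 ≡.refl
  Supp-q^ (suc n) = Supp-* (λ { ≡.refl ≡.refl → ≡.refl }) Supp-q (Supp-q^ n)
    where
    Supp-q : Supp (_≡ 1) q
    Supp-q zero = inj₂ R.refl
    Supp-q (suc zero) = inj₁ ≡.refl
    Supp-q (suc (suc n)) = inj₂ R.refl

  Mult-q^ : ∀ {m n} → m ∣ n → Mult m (q ^ n)
  Mult-q^ {n = n} m∣n = Supp-map (λ { _ ≡.refl → m∣n }) (Supp-q^ n)

  module _ (m : ℕ) .{{_ : ℕ.NonZero m}} where
    Class : ℕ → ℕ → Set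
    Class c n = n % m ≡ c

    private
      shift-class : ∀ e {n} → m ∣ n → (e ℕ.+ n) % m ≡ e % m
      shift-class e (divides k ≡.refl) = [m+kn]%n≡m%n e k m

    Supp-class : ∀ e {g} → Mult m g → Supp (Class (e % m)) (q ^ e * g)
    Supp-class e {g} s = Supp-* {P = _≡ e} {m ∣_} {f = q ^ e} {g} (λ { ≡.refl m∣j → shift-class e m∣j }) (Supp-q^ e) s

    proj : ℕ → PS → PS
    proj c f n with n % m ℕ.≟ c
    ... | yes _ = f n
    ... | no _ = R.0#

    proj-at : ∀ c f {n} → n % m ≡ c → proj c f n ≡ f n
    proj-at c f {n} n≡c with n % m ℕ.≟ c
    ... | yes _ = ≡.refl
    ... | no n≢c = ⊥-elim (n≢c n≡c)

    private
      proj-coeff : ∀ c {f g n} → f n R.≈ g n → proj c f n R.≈ proj c g n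
      proj-coeff c {n = n} p with n % m ℕ.≟ c
      ... | yes _ = p
      ... | no _ = R.refl

    proj-cong : ∀ c → f ≈ g → proj c f ≈ proj c g
    proj-cong {f} {g} c f≈g = coeffs λ n → proj-coeff c {f} {g} (coeff f≈g n)

    proj-0 : ∀ c → proj c 0# ≈ 0#
    proj-0 c = coeffs go
      where
      go : ∀ n → proj c 0# n R.≈ R.0#
      go n with n % m ℕ.≟ c
      ... | yes _ = R.refl
      ... | no _ = R.refl

    proj-+ : ∀ c f g → proj c (f + g) ≈ proj c f + proj c g
    proj-+ c f g = coeffs go
      where
      go : ∀ n → proj c (f + g) n R.≈ proj c f n R.+ proj c g n
      go n with n % m ℕ.≟ c
      ... | yes _ = R.refl
      ... | no _ = R.sym (R.+-identityˡ R.0#)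

    proj-∑∞ : ∀ c (h : ℕ → PS) → proj c (∑∞ h) ≈ ∑∞ (λ k → proj c (h k))
    proj-∑∞ c h = coeffs λ n → R.trans (proj-coeff c {∑∞ h} {∑ (suc n) h} (R.reflexive (∑∞-coeff h n)))
      (R.trans (coeff (go (suc n)) n) (R.reflexive (≡.sym (∑∞-coeff (λ k → proj c (h k)) n))))
      where
      go : ∀ l → proj c (∑ l h) ≈ ∑ l (λ k → proj c (h k))
      go zero = proj-0 c
      go (suc l) = trans (proj-+ c (∑ l h) (h l)) (+-congʳ (go l))

    -- A factor supported on multiples of m moves no exponent to another residue class.
    proj-* : ∀ c {g} f → Mult m g → proj c (g * f) ≈ g * proj c f
    proj-* c {g} f s = coeffs go
      where
      residue : ∀ {n i} → i ℕ.≤ n → m ∣ i → (n ∸ i) % m ≡ n % m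
      residue i≤n (divides k ≡.refl) = m*n≤o⇒[o∸m*n]%n≡o%n k i≤n

      go : ∀ n → proj c (g * f) n R.≈ (g * proj c f) n
      go n with n % m ℕ.≟ c
      ... | yes n≡c = R.trans (⊠-sum g f n) (R.trans (R.∑-cong (suc n) λ i i≤n → term i (ℕ.≤-pred i≤n)) (R.sym (⊠-sum g (proj c f) n)))
        where
        term : ∀ i → i ℕ.≤ n → g i R.* f (n ∸ i) R.≈ g i R.* proj c f (n ∸ i)
        term i i≤n with s i
        ... | inj₁ m∣i = R.*-congˡ (R.reflexive (≡.sym (proj-at c f (≡.trans (residue i≤n m∣i) n≡c))))
        ... | inj₂ z = R.trans (R.*-congʳ z) (R.trans (R.zeroˡ _) (R.sym (R.trans (R.*-congʳ z) (R.zeroˡ _))))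
      ... | no n≢c = R.sym (R.trans (⊠-sum g (proj c f) n) (R.∑-0 (suc n) λ i i≤n → term i (ℕ.≤-pred i≤n)))
        where
        proj-off : ∀ {k} → k % m ≢ c → proj c f k R.≈ R.0#
        proj-off {k} k≢c with k % m ℕ.≟ c
        ... | yes k≡c = ⊥-elim (k≢c k≡c)
        ... | no _ = R.refl
        term : ∀ i → i ℕ.≤ n → g i R.* proj c f (n ∸ i) R.≈ R.0#
        term i i≤n with s i
        ... | inj₁ m∣i = R.trans (R.*-congˡ (proj-off (λ k≡c → n≢c (≡.trans (≡.sym (residue i≤n m∣i)) k≡c)))) (R.zeroʳ _)
        ... | inj₂ z = R.trans (R.*-congʳ z) (R.zeroˡ _)

    proj-inside : ∀ c {f} → Supp (Class c) f → proj c f ≈ f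
    proj-inside c {f} s = coeffs go
      where
      go : ∀ n → proj c f n R.≈ f n
      go n with n % m ℕ.≟ c | s n
      ... | yes _ | _ = R.refl
      ... | no n≢c | inj₁ n≡c = ⊥-elim (n≢c n≡c)
      ... | no _ | inj₂ z = R.sym z

    proj-outside : ∀ c {f} → Supp (λ n → n % m ≢ c) f → proj c f ≈ 0#
    proj-outside c {f} s = coeffs go
      where
      go : ∀ n → proj c f n R.≈ R.0#
      go n with n % m ℕ.≟ c | s n
      ... | no _ | _ = R.refl
      ... | yes n≡c | inj₁ n≢c = ⊥-elim (n≢c n≡c)
      ... | yes _ | inj₂ z = z

-- Residue classes of ξ modulo 3, 9 and 5

module Congruence (R : CommutativeRing 0ℓ 0ℓ) where
  private
    module R where
      open CommutativeRing R public
  open PowerSeries R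
  open CommutativeRing FPS
  open Exp commutativeSemiring using (_^_; ^-homo-*; ^-assocʳ; ^-congʳ)
  open IntegerSolver FPS
  open FiniteSums FPS
  open Limits R
  open EulerProducts R
  open Bilateral R
  open ThetaProducts R
  open CubicNorm R
  open Supports R
  open import Relation.Binary.Reasoning.Setoid setoid

  private
    x Q : PS
    x = q ^ 3
    Q = q ^ 6

    order-x : x ≈[ 1 ] 0#
    order-x = order-^₊ order-q 3 (s≤s z≤n)

    module Lq = Lambert order-q
    module Lx = Lambert order-x
    module Tq = Theta order-q
    module Tx = Theta order-x

    mult-x : ∀ {m} n → m ∣ 3 ℕ.* n → Mult m (x ^ n)
    mult-x n m∣ = Supp-cong (sym (^-assocʳ q 3 n)) (Mult-q^ m∣)

    geometric-cube : ∀ {y} → y ≈[ 1 ] 0# → geometric y ≈ (1# + y + y * y) * geometric (y ^ 3)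
    geometric-cube {y} o = *-cancelˡ-unit (order-1- o) (begin
      (1# - y) * geometric y
        ≈⟨ trans (*-comm _ _) (geometric-inverse o) ⟩
      1#
        ≈⟨ geometric-inverse (order-^₊ o 3 (s≤s z≤n)) ⟨
      geometric (y ^ 3) * (1# - y ^ 3)
        ≈⟨ solve 2 (λ g y → let o = con ℤ.1ℤ in g :* (o :- y :* (y :* (y :* o))) := (o :- y) :* ((o :+ y :+ y :* y) :* g)) refl _ y ⟩
      (1# - y) * ((1# + y + y * y) * geometric (y ^ 3)) ∎)

    -- 1/(1-y) = (1+y+y²)/(1-y³) sorts a term by its exponents mod 3 into W (r₀ + q r₁ + q² r₂).
    module Terms (k : ℕ) where
      P I₃ J₃ W r₀ r₁ r₂ : PS
      P = Q ^ k
      I₃ = Lx.I k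
      J₃ = Lx.J k
      W = sgn k * (Q ^ (k ℕ.* suc k) * (Q ^ tri k * P))
      r₀ = q ^ 3 * (P * P) * I₃ + q ^ 6 * P * J₃
      r₁ = I₃ + q ^ 15 * (P * P * P) * J₃
      r₂ = P * I₃ + q ^ 9 * (P * P) * J₃

      private
        cube : ∀ n → geometric ((q ^ n) ^ 3) ≈ geometric (x ^ n)
        cube n = geometric-cong (trans (^-assocʳ q n 3) (trans (^-congʳ q (ℕ.*-comm n 3)) (sym (^-assocʳ q 3 n))))

        y≈ : q ^ Lq.y⁺ k ≈ q * P
        y≈ = trans (^-congʳ q (ℕ.+-comm (6 ℕ.* k) 1)) (*-congˡ (sym (^-assocʳ q 6 k)))

        z≈ : q ^ Lq.y⁻ k ≈ q ^ 5 * P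
        z≈ = trans (^-congʳ q (ℕ.+-comm (6 ℕ.* k) 5)) (trans (^-homo-* q 5 (6 ℕ.* k)) (*-congˡ (sym (^-assocʳ q 6 k))))

        I≈ : Lq.I k ≈ (1# + q * P + q * P * (q * P)) * I₃
        I≈ = trans (geometric-cube (order-^₊ order-q _ (ℕ.m≤n+m 1 (6 ℕ.* k)))) (*-cong (+-cong (+-congˡ y≈) (*-cong y≈ y≈)) (cube (Lq.y⁺ k)))

        J≈ : Lq.J k ≈ (1# + q ^ 5 * P + q ^ 5 * P * (q ^ 5 * P)) * J₃
        J≈ = trans (geometric-cube (order-^₊ order-q _ (ℕ.≤-trans (s≤s z≤n) (ℕ.m≤n+m 5 (6 ℕ.* k))))) (*-cong (+-cong (+-congˡ z≈) (*-cong z≈ z≈)) (cube (Lq.y⁻ k)))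

      mult-P : Mult 3 P
      mult-P = Mult-^ (Mult-q^ (divides 2 ≡.refl)) k

      mult-W : Mult 3 W
      mult-W = Supp-sgn-* k (Mult-* (Mult-^ (Mult-q^ (divides 2 ≡.refl)) (k ℕ.* suc k)) (Mult-* (Mult-^ (Mult-q^ (divides 2 ≡.refl)) (tri k)) mult-P))

      mult-I₃ : Mult 3 I₃
      mult-I₃ = Mult-geometric (Mult-^ (Mult-q^ ∣-refl) (Lx.y⁺ k))

      mult-J₃ : Mult 3 J₃
      mult-J₃ = Mult-geometric (Mult-^ (Mult-q^ ∣-refl) (Lx.y⁻ k))

      mult-r₀ : Mult 3 r₀
      mult-r₀ = Supp-+ (Mult-* (Mult-* (Mult-q^ ∣-refl) (Mult-* mult-P mult-P)) mult-I₃) (Mult-* (Mult-* (Mult-q^ (divides 2 ≡.refl)) mult-P) mult-J₃)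

      mult-r₁ : Mult 3 r₁
      mult-r₁ = Supp-+ mult-I₃ (Mult-* (Mult-* (Mult-q^ (divides 5 ≡.refl)) (Mult-* (Mult-* mult-P mult-P) mult-P)) mult-J₃)

      mult-r₂ : Mult 3 r₂
      mult-r₂ = Supp-+ (Mult-* mult-P mult-I₃) (Mult-* (Mult-* (Mult-q^ (divides 3 ≡.refl)) (Mult-* mult-P mult-P)) mult-J₃)

      dissect : q * (Q ^ (k ℕ.* suc k) * Tq.A.c k) ≈ W * (q ^ 1 * r₁ + (q ^ 2 * r₂ + q ^ 0 * r₀))
      dissect = begin
        q * (Q ^ (k ℕ.* suc k) * Tq.A.c k)
          ≈⟨ *-congˡ (*-congˡ (trans (Tq.appell-term k) (*-congˡ (+-cong I≈ (*-cong z≈ J≈))))) ⟩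
        q * (Q ^ (k ℕ.* suc k) * (sgn k * (Q ^ tri k * P) * ((1# + q * P + q * P * (q * P)) * I₃
          + q ^ 5 * P * ((1# + q ^ 5 * P + q ^ 5 * P * (q ^ 5 * P)) * J₃))))
          ≈⟨ solve 7 (λ q w s t P i j → let o = con ℤ.1ℤ; q2 = q :* (q :* o); q3 = q :* q2; q5 = q :* (q :* q3); q6 = q :* q5;
                                             q9 = q :* (q :* (q :* q6)); q15 = q :* (q :* (q :* (q :* (q :* (q :* q9))))) in
               q :* (w :* (s :* (t :* P) :* ((o :+ q :* P :+ q :* P :* (q :* P)) :* i :+ q5 :* P :* ((o :+ q5 :* P :+ q5 :* P :* (q5 :* P)) :* j))))
               := s :* (w :* (t :* P)) :* (q :* o :* (i :+ q15 :* (P :* P :* P) :* j) :+ (q2 :* (P :* i :+ q9 :* (P :* P) :* j) :+ o :* (q3 :* (P :* P) :* i :+ q6 :* P :* j))))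
               refl q (Q ^ (k ℕ.* suc k)) (sgn k) (Q ^ tri k) P I₃ J₃ ⟩
        W * (q ^ 1 * r₁ + (q ^ 2 * r₂ + q ^ 0 * r₀)) ∎

      off : ∀ {e} {g} → e ≢ 0 → Supp (Class 3 e) g → proj 3 0 g ≈ 0#
      off e≢0 s = proj-outside 3 0 (Supp-map (λ _ n≡e n≡0 → e≢0 (≡.trans (≡.sym n≡e) n≡0)) s)

      proj-term : proj 3 0 (q * (Q ^ (k ℕ.* suc k) * Tq.A.c k))
        ≈ sgn k * ((x ^ 6) ^ tri k * (x ^ 6) ^ k) * (x ^ (4 ℕ.* k ℕ.+ 1) * I₃ + x ^ (2 ℕ.* k ℕ.+ 2) * J₃)
      proj-term = begin
        proj 3 0 (q * (Q ^ (k ℕ.* suc k) * Tq.A.c k))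
          ≈⟨ trans (proj-cong 3 0 dissect) (proj-* 3 0 _ mult-W) ⟩
        W * proj 3 0 (q ^ 1 * r₁ + (q ^ 2 * r₂ + q ^ 0 * r₀))
          ≈⟨ *-congˡ (trans (proj-+ 3 0 _ _) (+-cong (off (λ ()) (Supp-class 3 1 mult-r₁))
               (trans (proj-+ 3 0 _ _) (+-cong (off (λ ()) (Supp-class 3 2 mult-r₂)) (proj-inside 3 0 (Supp-class 3 0 mult-r₀)))))) ⟩
        W * (0# + (0# + 1# * r₀))
          ≈⟨ *-cong (*-congˡ W≈) (trans (+-identityˡ _) (trans (+-identityˡ _) (trans (*-identityˡ _) (+-cong (*-congʳ qI) (*-congʳ qJ))))) ⟩
        sgn k * ((x ^ 6) ^ tri k * (x ^ 6) ^ k) * (x ^ (4 ℕ.* k ℕ.+ 1) * I₃ + x ^ (2 ℕ.* k ℕ.+ 2) * J₃) ∎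
        where
        -- k(k+1) + k(k+1)/2 is three times k(k+1)/2. The factor 3 turns the base q^6 into q^18 =
        -- x^6, so the class 0 mod 3 has the same base as the series `Θ` in x.
        W≈ : Q ^ (k ℕ.* suc k) * (Q ^ tri k * P) ≈ (x ^ 6) ^ tri k * (x ^ 6) ^ k
        W≈ = begin
          Q ^ (k ℕ.* suc k) * (Q ^ tri k * Q ^ k)          ≈⟨ trans (*-congˡ (sym (^-homo-* Q (tri k) k))) (sym (^-homo-* Q (k ℕ.* suc k) _)) ⟩
          Q ^ (k ℕ.* suc k ℕ.+ (tri k ℕ.+ k))              ≈⟨ ^-congʳ Q (≡.trans (≡.cong (ℕ._+ (tri k ℕ.+ k)) (≡.trans (ℕ.*-suc k k) (≡.cong (k ℕ.+_) (≡.sym (tri-square k))))) (eq (tri k) k)) ⟩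
          Q ^ (3 ℕ.* (tri k ℕ.+ k))                        ≈⟨ trans (sym (^-assocʳ Q 3 (tri k ℕ.+ k))) (^-cong (trans (^-assocʳ q 6 3) (sym (^-assocʳ q 3 6))) (tri k ℕ.+ k)) ⟩
          (x ^ 6) ^ (tri k ℕ.+ k)                          ≈⟨ ^-homo-* (x ^ 6) (tri k) k ⟩
          (x ^ 6) ^ tri k * (x ^ 6) ^ k                    ∎
          where
          eq : ∀ t k → k ℕ.+ (t ℕ.+ t ℕ.+ k) ℕ.+ (t ℕ.+ k) ≡ 3 ℕ.* (t ℕ.+ k)
          eq = solve-∀

        qI : q ^ 3 * (P * P) ≈ x ^ (4 ℕ.* k ℕ.+ 1)
        qI = begin
          q ^ 3 * (Q ^ k * Q ^ k)       ≈⟨ *-congˡ (trans (sym (^-homo-* Q k k)) (^-assocʳ q 6 (k ℕ.+ k))) ⟩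
          q ^ 3 * q ^ (6 ℕ.* (k ℕ.+ k)) ≈⟨ trans (sym (^-homo-* q 3 (6 ℕ.* (k ℕ.+ k)))) (^-congʳ q (eq k)) ⟩
          q ^ (3 ℕ.* (4 ℕ.* k ℕ.+ 1))   ≈⟨ ^-assocʳ q 3 (4 ℕ.* k ℕ.+ 1) ⟨
          x ^ (4 ℕ.* k ℕ.+ 1)           ∎
          where
          eq : ∀ k → 3 ℕ.+ 6 ℕ.* (k ℕ.+ k) ≡ 3 ℕ.* (4 ℕ.* k ℕ.+ 1)
          eq = solve-∀

        qJ : q ^ 6 * P ≈ x ^ (2 ℕ.* k ℕ.+ 2)
        qJ = begin
          q ^ 6 * Q ^ k                 ≈⟨ *-congˡ (^-assocʳ q 6 k) ⟩
          q ^ 6 * q ^ (6 ℕ.* k)         ≈⟨ trans (sym (^-homo-* q 6 (6 ℕ.* k))) (^-congʳ q (eq k)) ⟩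
          q ^ (3 ℕ.* (2 ℕ.* k ℕ.+ 2))   ≈⟨ ^-assocʳ q 3 (2 ℕ.* k ℕ.+ 2) ⟨
          x ^ (2 ℕ.* k ℕ.+ 2)           ∎
          where
          eq : ∀ k → 6 ℕ.+ 6 ℕ.* k ≡ 3 ℕ.* (2 ℕ.* k ℕ.+ 2)
          eq = solve-∀

  module Xi (p : ℕ → PS)
    (p-inverse : ∀ N → FiniteSums.∏ FPS (suc N) (λ k → (1# - q * (q ^ 6) ^ k) * (1# - q ^ 5 * (q ^ 6) ^ k)) * p N ≈ 1#) where

    -- With n = N + 1 the exponent 6n² - 6n + 1 is 1 + 6N(N+1); p N stands for the reciprocal of the
    -- product of n pairs of factors.
    mock : PS
    mock = q * ∑∞ (λ N → Q ^ (N ℕ.* suc N) * p N)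

    ξ : PS
    ξ = 1# + (mock + mock)

    F : PS
    F = proj 3 0 ξ

    E·mock : E Q * mock ≈ ∑∞ (λ k → q * (Q ^ (k ℕ.* suc k) * Tq.A.c k))
    E·mock = begin
      E Q * (q * ∑∞ (λ N → Q ^ (N ℕ.* suc N) * p N))
        ≈⟨ solve 3 (λ e q s → e :* (q :* s) := q :* (e :* s)) refl _ q _ ⟩
      q * (E Q * ∑∞ (λ N → Q ^ (N ℕ.* suc N) * p N))
        ≈⟨ *-congˡ (Tq.A.mock-appell p p-inverse) ⟩
      q * ∑∞ (λ k → Q ^ (k ℕ.* suc k) * Tq.A.c k)
        ≈⟨ *-∑∞ q (λ k → order-*ˡ _ ([]-weaken (ℕ.m≤m*n k (suc k)) (order-^ (order-^₊ order-q 6 (s≤s z≤n)) (k ℕ.* suc k)))) ⟩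
      ∑∞ (λ k → q * (Q ^ (k ℕ.* suc k) * Tq.A.c k)) ∎

    -- E(q^6) is a series in q³, so it passes through the projection and `E·mock` can be projected
    -- term by term. The contribution of the constant 1 of ξ is E(q^6) itself, which is the
    -- pentagonal series `θ₂′`.
    E·F : E (x ^ 2) * F ≈ AppellIdentities.Identities.Second.Θ R order-x (pos 0)
    E·F = begin
      E (x ^ 2) * F
        ≈⟨ *-congʳ E≈ ⟩
      E Q * proj 3 0 ξ
        ≈⟨ proj-* 3 0 ξ mult-E ⟨
      proj 3 0 (E Q * ξ)
        ≈⟨ proj-cong 3 0 (solve 2 (λ e m → e :* (con ℤ.1ℤ :+ (m :+ m)) := e :+ (e :* m :+ e :* m)) refl (E Q) mock) ⟩
      proj 3 0 (E Q + (E Q * mock + E Q * mock))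
        ≈⟨ trans (proj-+ 3 0 _ _) (+-cong (proj-inside 3 0 (Supp-map (λ { _ (divides k ≡.refl) → m*n%n≡0 k 3 }) mult-E))
             (trans (proj-+ 3 0 _ _) (+-cong T≈ T≈))) ⟩
      E Q + (∑∞ v + ∑∞ v)
        ≈⟨ +-congʳ (trans (sym E≈) (trans (E-even order-x) (trans (*-congʳ (*-comm _ _)) (sym Tx.θ₂′-product)))) ⟩
      Tx.θ₂′ + (∑∞ v + ∑∞ v)
        ≈⟨ Tx.Θ-terms ⟨
      AppellIdentities.Identities.Second.Θ R order-x (pos 0) ∎
      where
      v : ℕ → PS
      v k = sgn k * ((x ^ 6) ^ tri k * (x ^ 6) ^ k) * (x ^ (4 ℕ.* k ℕ.+ 1) * Lx.I k + x ^ (2 ℕ.* k ℕ.+ 2) * Lx.J k)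

      E≈ : E (x ^ 2) ≈ E Q
      E≈ = E-cong (^-assocʳ q 3 2)

      mult-E : Mult 3 (E Q)
      mult-E = Mult-E (Mult-q^ (divides 2 ≡.refl))

      T≈ : proj 3 0 (E Q * mock) ≈ ∑∞ v
      T≈ = trans (proj-cong 3 0 E·mock) (trans (proj-∑∞ 3 0 _) (∑∞-cong λ k → Terms.proj-term k))

    F·φ : F * φ x ≈ φ (x ^ 3) * φ (x ^ 3)
    F·φ = φ-equation order-x F E·F

    module Characteristic5 (ω : PS) (ω-root : 1# + ω + ω * ω ≈ 0#) (5≈0 : 1# + 1# + 1# + 1# + 1# ≈ 0#) where
      open CubeRoot ω ω-root
      open Norm order-x

      H : PS
      H = proj 9 6 F

      private
        A b a : PS
        A = φ (x ^ 9)
        b = B (x ^ 3)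
        a = φ (x ^ 3)

        mult-A : Mult 9 A
        mult-A = Mult-φ (mult-x 9 (divides 3 ≡.refl))

        mult-a : Mult 9 a
        mult-a = Mult-φ (mult-x 3 ∣-refl)

        mult-b : Mult 9 b
        mult-b = Mult-B (mult-x 3 ∣-refl)

        mult-2 : ∀ {m} → Mult m (1# + 1#)
        mult-2 = Supp-+ Mult-1 Mult-1

        mult-4 : ∀ {m} → Mult m four
        mult-4 = Mult-* mult-2 mult-2

        mult-N : Mult 9 N
        mult-N = Supp-cong (sym N-cubes) (Supp-+ (Mult-* (Mult-* mult-A mult-A) mult-A)
          (Supp-neg (Mult-* (Mult-* (Mult-* mult-2 mult-4) (mult-x 3 ∣-refl)) (Mult-* (Mult-* mult-b mult-b) mult-b))))

        -- N, a, A and b are series in q^9 and x is q³, so in a²(A² + 2xAb + 4x²b²) the powers 1, x,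
        -- x² mark the classes 0, 3, 6 mod 9 and only the last survives.
        H·N : H * N ≈ four * (x * x) * (a * a) * (b * b)
        H·N = begin
          H * N
            ≈⟨ trans (*-comm _ _) (sym (proj-* 9 6 F mult-N)) ⟩
          proj 9 6 (N * F)
            ≈⟨ proj-cong 9 6 (trans (*-comm N F) (F·N F·φ)) ⟩
          proj 9 6 (a * a * (A * A + (1# + 1#) * x * A * b + four * (x * x) * b * b))
            ≈⟨ proj-cong 9 6 (solve 5 (λ c q A a b → let o = con ℤ.1ℤ; q3 = q :* (q :* (q :* o)) in
                 a :* a :* (A :* A :+ (o :+ o) :* q3 :* A :* b :+ c :* (q3 :* q3) :* b :* b)
                 := o :* (a :* a :* (A :* A)) :+ (q3 :* (a :* a :* ((o :+ o) :* A :* b)) :+ q :* (q :* (q :* q3)) :* (c :* (a :* a) :* (b :* b))))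
                 refl four q A a b) ⟩
          proj 9 6 (q ^ 0 * g₀ + (q ^ 3 * g₁ + q ^ 6 * g₂))
            ≈⟨ trans (proj-+ 9 6 _ _) (+-cong (off (λ ()) (Supp-class 9 0 mult-g₀))
                 (trans (proj-+ 9 6 _ _) (+-cong (off (λ ()) (Supp-class 9 3 mult-g₁)) (proj-inside 9 6 (Supp-class 9 6 mult-g₂))))) ⟩
          0# + (0# + q ^ 6 * g₂)
            ≈⟨ solve 4 (λ c q a b → let o = con ℤ.1ℤ; z = con ℤ.0ℤ; q3 = q :* (q :* (q :* o)) in
                 z :+ (z :+ q :* (q :* (q :* q3)) :* (c :* (a :* a) :* (b :* b))) := c :* (q3 :* q3) :* (a :* a) :* (b :* b)) refl four q a b ⟩
          four * (x * x) * (a * a) * (b * b) ∎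
          where
          g₀ g₁ g₂ : PS
          g₀ = a * a * (A * A)
          g₁ = a * a * ((1# + 1#) * A * b)
          g₂ = four * (a * a) * (b * b)

          mult-g₀ : Mult 9 g₀
          mult-g₀ = Mult-* (Mult-* mult-a mult-a) (Mult-* mult-A mult-A)

          mult-g₁ : Mult 9 g₁
          mult-g₁ = Mult-* (Mult-* mult-a mult-a) (Mult-* (Mult-* mult-2 mult-A) mult-b)

          mult-g₂ : Mult 9 g₂
          mult-g₂ = Mult-* (Mult-* mult-4 (Mult-* mult-a mult-a)) (Mult-* mult-b mult-b)

          off : ∀ {e} {g} → e ≢ 6 → Supp (Class 9 e) g → proj 9 6 g ≈ 0#
          off e≢6 s = proj-outside 9 6 (Supp-map (λ _ n≡e n≡6 → e≢6 (≡.trans (≡.sym n≡e) n≡6)) s)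

        5·≈0 : ∀ f → (1# + 1# + 1# + 1# + 1#) * f ≈ 0#
        5·≈0 f = trans (*-congʳ 5≈0) (zeroˡ f)

      E-frobenius : ∀ {y} → y ≈[ 1 ] 0# → E y * E y * E y * E y * E y ≈ E (y ^ 5)
      E-frobenius {y} o = begin
        E y * E y * E y * E y * E y
          ≈⟨ trans (∏∞-* m₄ m₁) (*-congʳ (trans (∏∞-* m₃ m₁) (*-congʳ (trans (∏∞-* m₂ m₁) (*-congʳ (∏∞-* m₁ m₁)))))) ⟨
        ∏∞ (λ k → f k * f k * f k * f k * f k)
          ≈⟨ ∏∞-cong factor ⟩
        E (y ^ 5) ∎
        where
        f : ℕ → PS
        f k = 1# - y ^ suc k

        m₁ = E-multipliable o
        m₂ = Multipliable-* m₁ m₁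
        m₃ = Multipliable-* m₂ m₁
        m₄ = Multipliable-* m₃ m₁

        factor : ∀ k → f k * f k * f k * f k * f k ≈ 1# - (y ^ 5) ^ suc k
        factor k = begin
          (1# - t) * (1# - t) * (1# - t) * (1# - t) * (1# - t)
            -- The cofactor of 5 is ((1-t)^5 - (1-t^5)) / 5 = t⁴ - 2t³ + 2t² - t.
            ≈⟨ solve 1 (λ t → let o = con ℤ.1ℤ in (o :- t) :* (o :- t) :* (o :- t) :* (o :- t) :* (o :- t)
                 := (o :+ o :+ o :+ o :+ o) :* (t :* t :* t :* t :+ t :* t :+ t :* t :- t :- (t :* t :* t :+ t :* t :* t))
                    :+ (o :- t :* (t :* (t :* (t :* (t :* o)))))) refl t ⟩
          (1# + 1# + 1# + 1# + 1#) * _ + (1# - t ^ 5)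
            ≈⟨ trans (+-congʳ (5·≈0 _)) (+-identityˡ _) ⟩
          1# - t ^ 5
            ≈⟨ +-congˡ (-‿cong (trans (^-assocʳ y (suc k) 5) (trans (^-congʳ y (ℕ.*-comm (suc k) 5)) (sym (^-assocʳ y 5 (suc k)))))) ⟩
          1# - (y ^ 5) ^ suc k ∎
          where
          t : PS
          t = y ^ suc k

      -- Exponents of E(q^e)³ modulo 5, for e ≡ 4 mod 5: in Jacobi's series a
      -- triangular number is 0, 1 or 3 mod 5, and in the last case the coefficient vanishes.
      data Residue₀₄ (n : ℕ) : Set where
        res₀ : n % 5 ≡ 0 → Residue₀₄ n
        res₄ : n % 5 ≡ 4 → Residue₀₄ n

      private
        data Triangular (k : ℕ) : Set where
          vanishing : odd k ≈ 0# → Triangular k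
          tri≡0 : (tri k ℕ.+ k) % 5 ≡ 0 → Triangular k
          tri≡1 : (tri k ℕ.+ k) % 5 ≡ 1 → Triangular k

        tri-shift : ∀ k → (tri (5 ℕ.+ k) ℕ.+ (5 ℕ.+ k)) % 5 ≡ (tri k ℕ.+ k) % 5
        tri-shift k = ≡.trans (≡.cong (_% 5) (eq (tri k) k)) ([m+kn]%n≡m%n (tri k ℕ.+ k) (k ℕ.+ 3) 5)
          where
          eq : ∀ t k → t ℕ.+ k ℕ.+ (1 ℕ.+ k) ℕ.+ (2 ℕ.+ k) ℕ.+ (3 ℕ.+ k) ℕ.+ (4 ℕ.+ k) ℕ.+ (5 ℕ.+ k) ≡ t ℕ.+ k ℕ.+ (k ℕ.+ 3) ℕ.* 5
          eq = solve-∀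

        triangular : ∀ k → Triangular k
        triangular 0 = tri≡0 ≡.refl
        triangular 1 = tri≡1 ≡.refl
        triangular 2 = vanishing (trans (solve 0 (let o = con ℤ.1ℤ in o :+ (o :+ o) :+ (o :+ o) := o :+ o :+ o :+ o :+ o) refl) 5≈0)
        triangular 3 = tri≡1 ≡.refl
        triangular 4 = tri≡0 ≡.refl
        triangular (suc (suc (suc (suc (suc k))))) with triangular k
        ... | vanishing z = vanishing (trans
          (solve 1 (λ n → let o = con ℤ.1ℤ; t = o :+ o in n :+ t :+ t :+ t :+ t :+ t := n :+ (o :+ o :+ o :+ o :+ o) :* t) refl (odd k))
          (trans (+-cong z (5·≈0 _)) (+-identityˡ 0#)))
        ... | tri≡0 z = tri≡0 (≡.trans (tri-shift k) z)
        ... | tri≡1 z = tri≡1 (≡.trans (tri-shift k) z)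

      E³-support : ∀ e → 1 ℕ.≤ e → e % 5 ≡ 4 → Supp Residue₀₄ (E (q ^ e) * E (q ^ e) * E (q ^ e))
      E³-support e 1≤e e≡4 = Supp-cong (Base.Jacobi-cube (order-^₊ order-q e 1≤e)) (Supp-∑∞ term)
        where
        term : ∀ k → Supp Residue₀₄ (sgn k * (q ^ e) ^ tri k * ((q ^ e) ^ k * odd k))
        term k = Supp-cong (trans (*-congˡ (*-congʳ (trans (sym (^-assocʳ q e (tri k ℕ.+ k))) (^-homo-* (q ^ e) (tri k) k))))
            (solve 4 (λ s t p o → s :* (t :* p :* o) := s :* t :* (p :* o)) refl (sgn k) _ _ (odd k)))
          (Supp-sgn-* k (power (triangular k)))
          where
          residue : ∀ {r} → (tri k ℕ.+ k) % 5 ≡ r → (e ℕ.* (tri k ℕ.+ k)) % 5 ≡ (4 ℕ.* r) % 5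
          residue r≡ = ≡.trans (%-distribˡ-* e (tri k ℕ.+ k) 5) (≡.cong₂ (λ u v → (u ℕ.* v) % 5) e≡4 r≡)

          odd-constant : ∀ k → Supp (_≡ 0) (odd k)
          odd-constant zero = Supp-1 ≡.refl
          odd-constant (suc k) = Supp-+ (odd-constant k) (Supp-+ (Supp-1 ≡.refl) (Supp-1 ≡.refl))

          power : Triangular k → Supp Residue₀₄ (q ^ (e ℕ.* (tri k ℕ.+ k)) * odd k)
          power (vanishing z) = Supp-cong (sym (trans (*-congˡ z) (zeroʳ _))) Supp-0
          power (tri≡0 z) = Supp-cong (*-comm _ _) (Supp-const-* (odd-constant k) (Supp-map (λ { _ ≡.refl → res₀ (residue z) }) (Supp-q^ (e ℕ.* (tri k ℕ.+ k)))))
          power (tri≡1 z) = Supp-cong (*-comm _ _) (Supp-const-* (odd-constant k) (Supp-map (λ { _ ≡.refl → res₄ (residue z) }) (Supp-q^ (e ℕ.* (tri k ℕ.+ k)))))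

      data Residue₀₁₄ (n : ℕ) : Set where
        res₀ : n % 5 ≡ 0 → Residue₀₁₄ n
        res₁ : n % 5 ≡ 1 → Residue₀₁₄ n
        res₄ : n % 5 ≡ 4 → Residue₀₁₄ n

      private
        six+ : ∀ {i j r s} → i % 5 ≡ r → j % 5 ≡ s → (6 ℕ.+ (i ℕ.+ j)) % 5 ≡ (1 ℕ.+ (r ℕ.+ s) % 5) % 5
        six+ {i} {j} r s = ≡.trans (%-distribˡ-+ 6 (i ℕ.+ j) 5)
          (≡.cong (λ u → (1 ℕ.+ u) % 5) (≡.trans (%-distribˡ-+ i j 5) (≡.cong₂ (λ u v → (u ℕ.+ v) % 5) r s)))

        residues : ∀ {i j} → Residue₀₄ i → Residue₀₄ j → Residue₀₁₄ (6 ℕ.+ (i ℕ.+ j))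
        residues {i} {j} (res₀ r) (res₀ s) = res₁ (six+ {i} {j} r s)
        residues {i} {j} (res₀ r) (res₄ s) = res₀ (six+ {i} {j} r s)
        residues {i} {j} (res₄ r) (res₀ s) = res₀ (six+ {i} {j} r s)
        residues {i} {j} (res₄ r) (res₄ s) = res₄ (six+ {i} {j} r s)

        U V : PS
        U = E (q ^ 9) * E (q ^ 9) * E (q ^ 9)
        V = E (q ^ 54) * E (q ^ 54) * E (q ^ 54)

        RHS-support : Supp Residue₀₁₄ (q ^ 6 * (U * V))
        RHS-support = Supp-* {f = q ^ 6} {g = U * V} (λ { ≡.refl r → r }) (Supp-q^ 6)
          (Supp-* {P = Residue₀₄} {Residue₀₄} {λ n → Residue₀₁₄ (6 ℕ.+ n)} {U} {V} residues
            -- 9 and 54 are both 4 mod 5, so each cube has exponents 0 and 4 only. With the 6 from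
            -- q^6 the sums are 1, 0 and 4, and 2 and 3 are missed.
            (E³-support 9 (s≤s z≤n) ≡.refl) (E³-support 54 (s≤s z≤n) ≡.refl))

      -- `E³-equation` carries E(x³)²; multiplying by the cube of E(x³) completes a fifth power,
      -- which is E(x^15) in characteristic 5, and adds a second cube on the right.
      H·E : E ((x ^ 3) ^ 5) * H ≈ four * (q ^ 6 * (U * V))
      H·E = begin
        E ((x ^ 3) ^ 5) * H
          ≈⟨ *-congʳ (E-frobenius (order-^₊ order-x 3 (s≤s z≤n))) ⟨
        E (x ^ 3) * E (x ^ 3) * E (x ^ 3) * E (x ^ 3) * E (x ^ 3) * H
          ≈⟨ solve 2 (λ e h → e :* e :* e :* e :* e :* h := h :* (e :* e) :* (e :* e :* e)) refl (E (x ^ 3)) H ⟩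
        H * (E (x ^ 3) * E (x ^ 3)) * (E (x ^ 3) * E (x ^ 3) * E (x ^ 3))
          ≈⟨ *-cong (E³-equation H·N) (*-cong (*-cong e₉ e₉) e₉) ⟩
        four * (x * x) * (E (x ^ 18) * E (x ^ 18) * E (x ^ 18)) * U
          ≈⟨ *-congʳ (*-cong (*-congˡ (sym (^-homo-* q 3 3))) (*-cong (*-cong e₅₄ e₅₄) e₅₄)) ⟩
        four * q ^ 6 * V * U
          ≈⟨ solve 4 (λ f q u v → f :* q :* v :* u := f :* (q :* (u :* v))) refl four (q ^ 6) U V ⟩
        four * (q ^ 6 * (U * V)) ∎
        where
        e₉ : E (x ^ 3) ≈ E (q ^ 9)
        e₉ = E-cong (^-assocʳ q 3 3)
        e₅₄ : E (x ^ 18) ≈ E (q ^ 54)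
        e₅₄ = E-cong (^-assocʳ q 3 18)

      -- E(q^45) is a series in q^5 with constant term 1: it passes through the projection and can
      -- be cancelled.
      H-vanishes : ∀ c → (∀ n → Residue₀₁₄ n → n % 5 ≢ c) → proj 5 c H ≈ 0#
      H-vanishes c avoid = *-cancelˡ-unit (E-unit order-e) (begin
        E ((x ^ 3) ^ 5) * proj 5 c H       ≈⟨ proj-* 5 c H (Mult-E mult-e) ⟨
        proj 5 c (E ((x ^ 3) ^ 5) * H)     ≈⟨ proj-cong 5 c H·E ⟩
        proj 5 c (four * (q ^ 6 * (U * V)))  ≈⟨ proj-* 5 c _ mult-4 ⟩
        four * proj 5 c (q ^ 6 * (U * V))  ≈⟨ *-congˡ (proj-outside 5 c (Supp-map avoid RHS-support)) ⟩
        four * 0#                          ≈⟨ trans (zeroʳ four) (sym (zeroʳ _)) ⟩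
        E ((x ^ 3) ^ 5) * 0#               ∎)
        where
        order-e : (x ^ 3) ^ 5 ≈[ 1 ] 0#
        order-e = order-^₊ (order-^₊ order-x 3 (s≤s z≤n)) 5 (s≤s z≤n)

        mult-e : Mult 5 ((x ^ 3) ^ 5)
        mult-e = Supp-cong (sym (^-assocʳ x 3 5)) (mult-x 15 (divides 9 ≡.refl))

      ξ-coefficient : ∀ c → (∀ n → Residue₀₁₄ n → n % 5 ≢ c) →
        ∀ n → n % 3 ≡ 0 → n % 9 ≡ 6 → n % 5 ≡ c → ξ n R.≈ R.0#
      ξ-coefficient c avoid n n%3 n%9 n%5 = R.trans (R.reflexive (≡.sym (≡.trans (proj-at 5 c H {n} n%5)
        (≡.trans (proj-at 9 6 F {n} n%9) (proj-at 3 0 ξ {n} n%3))))) (coeff (H-vanishes c avoid) n)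

      avoid₂ : ∀ n → Residue₀₁₄ n → n % 5 ≢ 2
      avoid₂ n (res₀ r) s with ≡.trans (≡.sym r) s
      ... | ()
      avoid₂ n (res₁ r) s with ≡.trans (≡.sym r) s
      ... | ()
      avoid₂ n (res₄ r) s with ≡.trans (≡.sym r) s
      ... | ()

      avoid₃ : ∀ n → Residue₀₁₄ n → n % 5 ≢ 3
      avoid₃ n (res₀ r) s with ≡.trans (≡.sym r) s
      ... | ()
      avoid₃ n (res₁ r) s with ≡.trans (≡.sym r) s
      ... | ()
      avoid₃ n (res₄ r) s with ≡.trans (≡.sym r) s
      ... | ()

-- The coefficients of ξ as a series over the coefficient ring

open import Defs

module Coefficients (R : CommutativeRing 0ℓ 0ℓ) where
  private
    module R where
      open CommutativeRing R public
      open FiniteSums R public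
      open Mult +-monoid public using (1+×; ×-homo-+) renaming (_×_ to _·_)
      open SemiringMult semiring public using (×1-homo-*)
      open RingProperties ring public using (-0#≈0#)
  open PowerSeries R
  open CommutativeRing FPS
  open Exp commutativeSemiring using (_^_; ^-homo-*; ^-assocʳ; ^-congʳ)
  open IntegerSolver FPS
  open FiniteSums FPS
  open Limits R
  open ThetaProducts R
  open Supports R
  open Congruence R
  open import Relation.Binary.Reasoning.Setoid setoid

  ι : ℕ → R.Carrier
  ι n = n R.· R.1#

  lift : Series → PS
  lift f n = ι (f n)

  ι-sumTo : ∀ N f → ι (sumTo N f) R.≈ R.∑ (suc N) (λ i → ι (f i))
  ι-sumTo zero f = R.sym (R.+-identityˡ _)
  ι-sumTo (suc N) f = R.trans (R.×-homo-+ R.1# (sumTo N f) (f (suc N))) (R.+-congʳ (ι-sumTo N f))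

  lift-⊛ : ∀ f g → lift (f ⊛ g) ≈ lift f * lift g
  lift-⊛ f g = coeffs λ n → R.trans (ι-sumTo n _) (R.trans
    (R.∑-cong (suc n) λ i _ → R.×1-homo-* (f i) (g (n ∸ i))) (R.sym (⊠-sum (lift f) (lift g) n)))

  lift-one : lift one ≈ 1#
  lift-one = coeffs λ { zero → R.refl ; (suc n) → R.refl }

  private
    q*-suc : ∀ f n → (q * f) (suc n) R.≈ f n
    q*-suc f n = R.trans (R.reflexive (⊠-def q f (suc n))) (R.trans (R.+-congʳ (R.zeroˡ _)) (R.trans (R.+-identityˡ _)
      (R.trans (R.reflexive (≡.sym (⊠-def (tail q) f n))) (R.trans (coeff (*-congʳ {f} {tail q} {1#} (coeffs λ _ → R.refl)) n) (coeff (*-identityˡ f) n)))))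

    q^*-below : ∀ d f n → n ℕ.< d → (q ^ d * f) n R.≈ R.0#
    q^*-below d f = at (order-*ˡ f (order-^ order-q d))

    q^*-above : ∀ d f n → (q ^ d * f) (d ℕ.+ n) R.≈ f n
    q^*-above zero f n = coeff (*-identityˡ f) n
    q^*-above (suc d) f n = R.trans (coeff (*-assoc q (q ^ d) f) (suc (d ℕ.+ n))) (R.trans (q*-suc (q ^ d * f) (d ℕ.+ n)) (q^*-above d f n))

  shifted : ∀ d {f g : PS} → (∀ n → n ℕ.< d → f n R.≈ R.0#) → (∀ n → f (d ℕ.+ n) R.≈ g n) → f ≈ q ^ d * g
  shifted d {f} {g} low high = coeffs go
    where
    go : ∀ n → f n R.≈ (q ^ d * g) n
    go n with n ℕ.<? d
    ... | yes n<d = R.trans (low n n<d) (R.sym (q^*-below d g n n<d))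
    ... | no n≮d = ≡.subst (λ k → f k R.≈ (q ^ d * g) k) (ℕ.m+[n∸m]≡n (ℕ.≮⇒≥ n≮d))
      (R.trans (high (n ∸ d)) (R.sym (q^*-above d g (n ∸ d))))

  lift-shift : ∀ d f → lift (shift d f) ≈ q ^ d * lift f
  lift-shift d f = shifted d low high
    where
    low : ∀ n → n ℕ.< d → lift (shift d f) n R.≈ R.0#
    low n n<d = R.reflexive (≡.cong (λ b → ι (if b then f (n ∸ d) else 0)) (dec-false (d ℕ.≤? n) (ℕ.<⇒≱ n<d)))

    high : ∀ n → lift (shift d f) (d ℕ.+ n) R.≈ lift f n
    high n = R.reflexive (≡.trans (≡.cong (λ b → ι (if b then f (d ℕ.+ n ∸ d) else 0)) (dec-true (d ℕ.≤? (d ℕ.+ n)) (ℕ.m≤m+n d n)))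
      (≡.cong (λ k → ι (f k)) (ℕ.m+n∸m≡n d n)))

  -- Divisibility by k+1 is periodic, so G - 1 is G shifted by k+1.
  lift-geomInv : ∀ k → lift (geomInv k) * (1# - q ^ suc k) ≈ 1#
  lift-geomInv k = begin
    G * (1# - q ^ suc k)      ≈⟨ solve 2 (λ g p → g :* (con ℤ.1ℤ :- p) := g :- p :* g) refl G (q ^ suc k) ⟩
    G - q ^ suc k * G         ≈⟨ +-congˡ (-‿cong (sym (shifted (suc k) {G - 1#} low high))) ⟩
    G - (G - 1#)              ≈⟨ solve 1 (λ g → g :- (g :- con ℤ.1ℤ) := con ℤ.1ℤ) refl G ⟩
    1#                        ∎
    where
    G : PS
    G = lift (geomInv k)

    at-multiple : ∀ n → suc k ∣ n → G n R.≈ R.1#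
    at-multiple n k∣n = R.reflexive (≡.cong (λ b → ι (if b then 1 else 0)) (dec-true (suc k ∣? n) k∣n))

    off-multiple : ∀ n → ¬ suc k ∣ n → G n R.≈ R.0#
    off-multiple n k∤n = R.reflexive (≡.cong (λ b → ι (if b then 1 else 0)) (dec-false (suc k ∣? n) k∤n))

    low : ∀ n → n ℕ.< suc k → (G - 1#) n R.≈ R.0#
    low zero _ = R.trans (R.+-congʳ (at-multiple 0 (suc k ∣0))) (R.-‿inverseʳ R.1#)
    low (suc n) n<k = R.trans (R.+-congʳ (off-multiple (suc n) λ k∣n → ℕ.<⇒≱ n<k (∣⇒≤ k∣n))) (R.-‿inverseʳ R.0#)

    high : ∀ n → (G - 1#) (suc k ℕ.+ n) R.≈ G n
    high n = R.trans (R.+-congˡ R.-0#≈0#) (R.trans (R.+-identityʳ _) periodic)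
      where
      periodic : G (suc k ℕ.+ n) R.≈ G n
      periodic with suc k ∣? n
      ... | yes k∣n = R.trans (at-multiple (suc k ℕ.+ n) (∣m∣n⇒∣m+n ∣-refl k∣n)) (R.sym (at-multiple n k∣n))
      ... | no k∤n = R.trans (off-multiple (suc k ℕ.+ n) λ k∣ → k∤n (∣m+n∣m⇒∣n k∣ ∣-refl)) (R.sym (off-multiple n k∤n))

  factors : ℕ → PS
  factors k = (1# - q * (q ^ 6) ^ k) * (1# - q ^ 5 * (q ^ 6) ^ k)

  lift-invPoch : ∀ n → ∏ n factors * lift (invPoch n) ≈ 1#
  lift-invPoch zero = trans (*-identityˡ _) lift-one
  lift-invPoch (suc j) = begin
    ∏ j factors * factors j * lift ((invPoch j ⊛ geomInv (6 ℕ.* j)) ⊛ geomInv (6 ℕ.* j ℕ.+ 4))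
      ≈⟨ *-cong (*-congˡ (*-cong (+-congˡ (-‿cong e₁)) (+-congˡ (-‿cong e₅)))) (trans (lift-⊛ (invPoch j ⊛ geomInv (6 ℕ.* j)) (geomInv (6 ℕ.* j ℕ.+ 4))) (*-congʳ (lift-⊛ (invPoch j) (geomInv (6 ℕ.* j))))) ⟩
    ∏ j factors * ((1# - q ^ suc (6 ℕ.* j)) * (1# - q ^ suc (6 ℕ.* j ℕ.+ 4)))
      * (lift (invPoch j) * lift (geomInv (6 ℕ.* j)) * lift (geomInv (6 ℕ.* j ℕ.+ 4)))
      ≈⟨ solve 6 (λ p a b i g h → p :* (a :* b) :* (i :* g :* h) := (p :* i) :* ((g :* a) :* (h :* b))) refl _ _ _ _ _ _ ⟩
    (∏ j factors * lift (invPoch j)) * ((lift (geomInv (6 ℕ.* j)) * (1# - q ^ suc (6 ℕ.* j)))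
      * (lift (geomInv (6 ℕ.* j ℕ.+ 4)) * (1# - q ^ suc (6 ℕ.* j ℕ.+ 4))))
      ≈⟨ *-cong (lift-invPoch j) (*-cong (lift-geomInv (6 ℕ.* j)) (lift-geomInv (6 ℕ.* j ℕ.+ 4))) ⟩
    1# * (1# * 1#) ≈⟨ trans (*-identityˡ _) (*-identityˡ _) ⟩
    1# ∎
    where
    e₁ : q * (q ^ 6) ^ j ≈ q ^ suc (6 ℕ.* j)
    e₁ = *-congˡ (^-assocʳ q 6 j)
    e₅ : q ^ 5 * (q ^ 6) ^ j ≈ q ^ suc (6 ℕ.* j ℕ.+ 4)
    e₅ = trans (*-congˡ (^-assocʳ q 6 j)) (trans (sym (^-homo-* q 5 (6 ℕ.* j))) (^-congʳ q (≡.cong suc (ℕ.+-comm 4 (6 ℕ.* j)))))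

  open Xi (λ N → lift (invPoch (suc N))) (λ N → lift-invPoch (suc N)) public

  lift-ξ : ∀ n → ι (pξ n) R.≈ ξ n
  lift-ξ n = R.trans (R.×-homo-+ R.1# (one n) (2 ℕ.* sumTo n t)) (R.+-cong (coeff lift-one n)
    (R.trans (R.reflexive (≡.cong (λ s → ι (sumTo n t ℕ.+ s)) (ℕ.+-identityʳ (sumTo n t))))
      (R.trans (R.×-homo-+ R.1# (sumTo n t) (sumTo n t)) (R.+-cong sum≈ sum≈))))
    where
    t : ℕ → ℕ
    t k = if does (1 ℕ.≤? k) then term k n else 0

    M : ℕ → PS
    M N = q * ((q ^ 6) ^ (N ℕ.* suc N) * lift (invPoch (suc N)))

    exponent : ℕ → ℕ
    exponent k = 6 ℕ.* k ℕ.* k ∸ 6 ℕ.* k ℕ.+ 1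

    exponent-suc : ∀ N → exponent (suc N) ≡ suc (6 ℕ.* (N ℕ.* suc N))
    exponent-suc N = ≡.trans (≡.cong (λ e → e ∸ 6 ℕ.* suc N ℕ.+ 1) (eq N))
      (≡.trans (≡.cong (ℕ._+ 1) (ℕ.m+n∸n≡m (6 ℕ.* (N ℕ.* suc N)) (6 ℕ.* suc N))) (ℕ.+-comm _ 1))
      where
      eq : ∀ N → 6 ℕ.* suc N ℕ.* suc N ≡ 6 ℕ.* (N ℕ.* suc N) ℕ.+ 6 ℕ.* suc N
      eq = solve-∀

    term≈M : ∀ N → lift (term (suc N)) ≈ M N
    term≈M N = begin
      lift (term (suc N))                                                   ≈⟨ lift-shift (exponent (suc N)) (invPoch (suc N)) ⟩
      q ^ exponent (suc N) * lift (invPoch (suc N))                         ≈⟨ *-congʳ (^-congʳ q (exponent-suc N)) ⟩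
      q * q ^ (6 ℕ.* (N ℕ.* suc N)) * lift (invPoch (suc N))                ≈⟨ *-congʳ (*-congˡ (sym (^-assocʳ q 6 (N ℕ.* suc N)))) ⟩
      q * (q ^ 6) ^ (N ℕ.* suc N) * lift (invPoch (suc N))                  ≈⟨ *-assoc _ _ _ ⟩
      M N                                                                   ∎

    order-M : ∀ N → M N ≈[ suc N ] 0#
    order-M N = order-* order-q (order-*ˡ _ ([]-weaken (ℕ.m≤m*n N (suc N)) (order-^ (order-^₊ order-q 6 (s≤s z≤n)) (N ℕ.* suc N))))

    mock≈ : mock ≈ ∑∞ M
    mock≈ = *-∑∞ q (λ N → order-*ˡ _ ([]-weaken (ℕ.m≤m*n N (suc N)) (order-^ (order-^₊ order-q 6 (s≤s z≤n)) (N ℕ.* suc N))))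

    ∑-at : ∀ m (f : ℕ → PS) → ∑ m f n R.≈ R.∑ m (λ k → f k n)
    ∑-at zero f = R.refl
    ∑-at (suc m) f = R.+-congʳ (∑-at m f)

    -- The summand of index 0 is zero and index N+1 becomes `M N`, so `sumTo` covers N < n. The
    -- infinite sum also reads N = n at this coefficient, but `M n` has order n+1.
    sum≈ : ι (sumTo n t) R.≈ mock n
    sum≈ = R.trans (ι-sumTo n t) (R.trans (R.∑-head n _) (R.trans (R.+-identityˡ _) (R.trans
      (R.∑-cong n λ N _ → coeff (term≈M N) n) (R.trans (R.sym (∑-at n M)) (R.trans
      (R.sym (R.trans (R.+-congˡ (at (order-M n) n ℕ.≤-refl)) (R.+-identityʳ _)))
      (R.trans (R.reflexive (≡.sym (∑∞-coeff M n))) (R.sym (coeff mock≈ n))))))))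

-- The coefficient ring and the return to divisibility by 5

-- ℤ[ω]/5 with ω² + ω + 1 = 0: the quotient is taken by the setoid equality.
module EisensteinMod5 where
  open import Data.Integer.Base using (_+_; _*_; -_; _-_)

  infix 4 _≡₅_ _≃_
  infix 3 _&_
  record _≡₅_ (a b : ℤ) : Set where
    constructor by
    field
      quotient : ℤ
      equation : a ≡ b + pos 5 * quotient

  ≡⇒≡₅ : ∀ {a b} → a ≡ b → a ≡₅ b
  ≡⇒≡₅ {a} ≡.refl = by (pos 0) (≡.sym (ℤ.+-identityʳ a))

  ≡₅-sym : ∀ {a b} → a ≡₅ b → b ≡₅ a
  ≡₅-sym {b = b} (by k ≡.refl) = by (- k) (eq b k)
    where
    eq : ∀ b k → b ≡ b + pos 5 * k + pos 5 * - k
    eq = ℤ-solve-∀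

  ≡₅-trans : ∀ {a b c} → a ≡₅ b → b ≡₅ c → a ≡₅ c
  ≡₅-trans {c = c} (by k ≡.refl) (by l ≡.refl) = by (l + k) (eq c k l)
    where
    eq : ∀ c k l → c + pos 5 * l + pos 5 * k ≡ c + pos 5 * (l + k)
    eq = ℤ-solve-∀

  ≡₅-+ : ∀ {a b c d} → a ≡₅ b → c ≡₅ d → a + c ≡₅ b + d
  ≡₅-+ {b = b} {d = d} (by k ≡.refl) (by l ≡.refl) = by (k + l) (eq b d k l)
    where
    eq : ∀ b d k l → (b + pos 5 * k) + (d + pos 5 * l) ≡ b + d + pos 5 * (k + l)
    eq = ℤ-solve-∀

  ≡₅-neg : ∀ {a b} → a ≡₅ b → - a ≡₅ - b
  ≡₅-neg {b = b} (by k ≡.refl) = by (- k) (eq b k)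
    where
    eq : ∀ b k → - (b + pos 5 * k) ≡ - b + pos 5 * - k
    eq = ℤ-solve-∀

  ≡₅-* : ∀ {a b c d} → a ≡₅ b → c ≡₅ d → a * c ≡₅ b * d
  ≡₅-* {b = b} {d = d} (by k ≡.refl) (by l ≡.refl) = by (b * l + k * d + pos 5 * (k * l)) (eq b d k l)
    where
    eq : ∀ b d k l → (b + pos 5 * k) * (d + pos 5 * l) ≡ b * d + pos 5 * (b * l + k * d + pos 5 * (k * l))
    eq = ℤ-solve-∀

  record _≃_ (u v : ℤ × ℤ) : Set where
    constructor _&_
    field
      re : proj₁ u ≡₅ proj₁ v
      im : proj₂ u ≡₅ proj₂ v

  _⊕_ _⊙_ : ℤ × ℤ → ℤ × ℤ → ℤ × ℤ
  (a , b) ⊕ (c , d) = a + c , b + d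
  (a , b) ⊙ (c , d) = a * c - b * d , a * d + b * c - b * d

  ⊖_ : ℤ × ℤ → ℤ × ℤ
  ⊖ (a , b) = - a , - b

  ring : CommutativeRing 0ℓ 0ℓ
  ring = record
    { Carrier = ℤ × ℤ ; _≈_ = _≃_ ; _+_ = _⊕_ ; _*_ = _⊙_ ; -_ = ⊖_ ; 0# = pos 0 , pos 0 ; 1# = pos 1 , pos 0
    ; isCommutativeRing = record
      { isRing = record
        { +-isAbelianGroup = record
          { isGroup = record
            { isMonoid = record
              { isSemigroup = record
                { isMagma = record
                  { isEquivalence = record
                    { refl = ≡⇒≡₅ ≡.refl & ≡⇒≡₅ ≡.refl
                    ; sym = λ (p & q) → ≡₅-sym p & ≡₅-sym q
                    ; trans = λ (p & q) (r & s) → ≡₅-trans p r & ≡₅-trans q s }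
                  ; ∙-cong = λ (p & q) (r & s) → ≡₅-+ p r & ≡₅-+ q s }
                ; assoc = λ (a , b) (c , d) (e , f) → ≡⇒≡₅ (ℤ.+-assoc a c e) & ≡⇒≡₅ (ℤ.+-assoc b d f) }
              ; identity = (λ (a , b) → ≡⇒≡₅ (ℤ.+-identityˡ a) & ≡⇒≡₅ (ℤ.+-identityˡ b))
                , (λ (a , b) → ≡⇒≡₅ (ℤ.+-identityʳ a) & ≡⇒≡₅ (ℤ.+-identityʳ b)) }
            ; inverse = (λ (a , b) → ≡⇒≡₅ (ℤ.+-inverseˡ a) & ≡⇒≡₅ (ℤ.+-inverseˡ b))
                , (λ (a , b) → ≡⇒≡₅ (ℤ.+-inverseʳ a) & ≡⇒≡₅ (ℤ.+-inverseʳ b))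
            ; ⁻¹-cong = λ (p & q) → ≡₅-neg p & ≡₅-neg q }
          ; comm = λ (a , b) (c , d) → ≡⇒≡₅ (ℤ.+-comm a c) & ≡⇒≡₅ (ℤ.+-comm b d) }
        ; *-cong = λ (p & q) (r & s) → ≡₅-+ (≡₅-* p r) (≡₅-neg (≡₅-* q s))
            & ≡₅-+ (≡₅-+ (≡₅-* p s) (≡₅-* q r)) (≡₅-neg (≡₅-* q s))
        ; *-assoc = λ (a , b) (c , d) (e , f) → ≡⇒≡₅ (assoc₁ a b c d e f) & ≡⇒≡₅ (assoc₂ a b c d e f)
        ; *-identity = (λ (a , b) → ≡⇒≡₅ (idˡ₁ a b) & ≡⇒≡₅ (idˡ₂ a b)) , (λ (a , b) → ≡⇒≡₅ (idʳ₁ a b) & ≡⇒≡₅ (idʳ₂ a b))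
        ; distrib = (λ (a , b) (c , d) (e , f) → ≡⇒≡₅ (dˡ₁ a b c d e f) & ≡⇒≡₅ (dˡ₂ a b c d e f))
            , (λ (a , b) (c , d) (e , f) → ≡⇒≡₅ (dʳ₁ a b c d e f) & ≡⇒≡₅ (dʳ₂ a b c d e f)) }
      ; *-comm = λ (a , b) (c , d) → ≡⇒≡₅ (comm₁ a b c d) & ≡⇒≡₅ (comm₂ a b c d) } }
    where
    assoc₁ : ∀ a b c d e f → (a * c - b * d) * e - (a * d + b * c - b * d) * f
      ≡ a * (c * e - d * f) - b * (c * f + d * e - d * f)
    assoc₁ = ℤ-solve-∀
    assoc₂ : ∀ a b c d e f → (a * c - b * d) * f + (a * d + b * c - b * d) * e - (a * d + b * c - b * d) * f
      ≡ a * (c * f + d * e - d * f) + b * (c * e - d * f) - b * (c * f + d * e - d * f)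
    assoc₂ = ℤ-solve-∀
    idˡ₁ : ∀ a b → pos 1 * a - pos 0 * b ≡ a
    idˡ₁ = ℤ-solve-∀
    idˡ₂ : ∀ a b → pos 1 * b + pos 0 * a - pos 0 * b ≡ b
    idˡ₂ = ℤ-solve-∀
    idʳ₁ : ∀ a b → a * pos 1 - b * pos 0 ≡ a
    idʳ₁ = ℤ-solve-∀
    idʳ₂ : ∀ a b → a * pos 0 + b * pos 1 - b * pos 0 ≡ b
    idʳ₂ = ℤ-solve-∀
    dˡ₁ : ∀ a b c d e f → a * (c + e) - b * (d + f) ≡ (a * c - b * d) + (a * e - b * f)
    dˡ₁ = ℤ-solve-∀
    dˡ₂ : ∀ a b c d e f → a * (d + f) + b * (c + e) - b * (d + f) ≡ (a * d + b * c - b * d) + (a * f + b * e - b * f)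
    dˡ₂ = ℤ-solve-∀
    dʳ₁ : ∀ a b c d e f → (c + e) * a - (d + f) * b ≡ (c * a - d * b) + (e * a - f * b)
    dʳ₁ = ℤ-solve-∀
    dʳ₂ : ∀ a b c d e f → (c + e) * b + (d + f) * a - (d + f) * b ≡ (c * b + d * a - d * b) + (e * b + f * a - f * b)
    dʳ₂ = ℤ-solve-∀
    comm₁ : ∀ a b c d → a * c - b * d ≡ c * a - d * b
    comm₁ = ℤ-solve-∀
    comm₂ : ∀ a b c d → a * d + b * c - b * d ≡ c * b + d * a - d * b
    comm₂ = ℤ-solve-∀

  open CommutativeRing ring using (1#; 0#; _≈_; trans; sym; refl; +-cong; +-monoid; zeroˡ; *-congʳ; +-identityˡ)
  open Coefficients ring using (ι; lift-ξ; module Characteristic5)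
  open PowerSeries ring

  ι-def : ∀ n → ι n ≈ (pos n , pos 0)
  ι-def zero = refl
  ι-def (suc n) = trans (Mult.1+× +-monoid n 1#) (+-cong {1#} {1#} {ι n} {pos n , pos 0} refl (ι-def n))

  -- The image of n is (n, 0), so vanishing gives n = 5k for an integer k, and the absolute value of
  -- k is the natural cofactor.
  ι-divides : ∀ n → ι n ≈ 0# → 5 ∣ n
  ι-divides n ιn≈0 with trans {pos n , pos 0} {ι n} {0#} (sym {ι n} {pos n , pos 0} (ι-def n)) ιn≈0
  ... | by k n≡5k & _ = divides ∣ k ∣ (≡.trans (≡.cong ∣_∣ (≡.trans n≡5k (ℤ.+-identityˡ (pos 5 * k))))
    (≡.trans (ℤ.abs-* (pos 5) k) (ℕ.*-comm 5 ∣ k ∣)))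

  private
    -- As a constant series, so that the substitution x → ωx is a product in the ring of power
    -- series.
    ω : PS
    ω = constant (pos 0 , pos 1)

    module S = CommutativeRing FPS

    ω-root : S.1# S.+ ω S.+ ω S.* ω S.≈ S.0#
    ω-root = coeffs go
      where
      tail-0 : ∀ n → (tail ω ⊗ ω) n ≈ 0#
      tail-0 n = trans (CommutativeRing.reflexive ring (≡.sym (⊠-def (tail ω) ω n))) (coeff (S.zeroˡ ω) n)

      go : ∀ n → (S.1# S.+ ω S.+ ω S.* ω) n ≈ 0#
      go zero = ≡.subst (λ t → (pos 1 , pos 1) ⊕ t ≃ 0#) (≡.sym (⊠-def ω ω 0)) (≡⇒≡₅ ≡.refl & ≡⇒≡₅ ≡.refl)
      go (suc n) = ≡.subst (λ t → 0# ⊕ t ≃ 0#) (≡.sym (⊠-def ω ω (suc n)))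
        (trans {0# ⊕ (0# ⊕ (tail ω ⊗ ω) n)} (+-identityˡ (0# ⊕ (tail ω ⊗ ω) n))
          (trans {0# ⊕ (tail ω ⊗ ω) n} (+-identityˡ ((tail ω ⊗ ω) n)) (tail-0 n)))

    5≈0 : S.1# S.+ S.1# S.+ S.1# S.+ S.1# S.+ S.1# S.≈ S.0#
    5≈0 = coeffs λ { zero → by (pos 1) ≡.refl & by (pos 0) ≡.refl ; (suc n) → refl }

  open Characteristic5 ω ω-root 5≈0 public using (ξ-coefficient; avoid₂; avoid₃)

  pξ-divisible : ∀ n c → (∀ n → Characteristic5.Residue₀₁₄ ω ω-root 5≈0 n → n % 5 ≢ c) → n % 3 ≡ 0 → n % 9 ≡ 6 → n % 5 ≡ c → 5 ∣ pξ n
  pξ-divisible n c avoid n%3 n%9 n%5 = ι-divides (pξ n) (trans {ι (pξ n)} (lift-ξ n) (ξ-coefficient c avoid n n%3 n%9 n%5))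

open import Data.Nat using (_+_; _*_)

-- 33 and 42 are 6 mod 9, and mod 5 they are 3 and 2, the two residues that the exponents of H
-- multiplied by E(q^45) avoid.
theorem5p3 : (n : ℕ) → (5 ∣ pξ (45 * n + 33)) × (5 ∣ pξ (45 * n + 42))
theorem5p3 n =
  EisensteinMod5.pξ-divisible (45 ℕ.* n ℕ.+ 33) 3 avoid₃ (residue 33 3 15 (e₁ n)) (residue 33 9 5 (e₂ n)) (residue 33 5 9 (e₃ n)) ,
  EisensteinMod5.pξ-divisible (45 ℕ.* n ℕ.+ 42) 2 avoid₂ (residue 42 3 15 (e₄ n)) (residue 42 9 5 (e₅ n)) (residue 42 5 9 (e₆ n))
  where
  open EisensteinMod5 using (avoid₂; avoid₃)

  residue : ∀ a m .{{_ : ℕ.NonZero m}} k {N} → N ≡ a ℕ.+ k ℕ.* n ℕ.* m → N % m ≡ a % m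
  residue a m k eq = ≡.trans (≡.cong (_% m) eq) ([m+kn]%n≡m%n a (k ℕ.* n) m)

  e₁ : ∀ n → 45 ℕ.* n ℕ.+ 33 ≡ 33 ℕ.+ 15 ℕ.* n ℕ.* 3
  e₁ = solve-∀
  e₂ : ∀ n → 45 ℕ.* n ℕ.+ 33 ≡ 33 ℕ.+ 5 ℕ.* n ℕ.* 9
  e₂ = solve-∀
  e₃ : ∀ n → 45 ℕ.* n ℕ.+ 33 ≡ 33 ℕ.+ 9 ℕ.* n ℕ.* 5
  e₃ = solve-∀
  e₄ : ∀ n → 45 ℕ.* n ℕ.+ 42 ≡ 42 ℕ.+ 15 ℕ.* n ℕ.* 3
  e₄ = solve-∀
  e₅ : ∀ n → 45 ℕ.* n ℕ.+ 42 ≡ 42 ℕ.+ 5 ℕ.* n ℕ.* 9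
  e₅ = solve-∀
  e₆ : ∀ n → 45 ℕ.* n ℕ.+ 42 ≡ 42 ℕ.+ 9 ℕ.* n ℕ.* 5
  e₆ = solve-∀
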